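{- Every 3-path-configuration (3PC) is an HC-obstruction. Moreover, these are the only HC-obstructions which are wheel-free graphs; that is, if a graph $G$ is an HC-obstruction and $G$ has no induced subgraph isomorphic to a wheel, then $G$ is a 3PC.
   Context: All graphs are finite, undirected, without loops or multiple edges. A graph is 2-connected if it has at least three vertices, is connected, and has no cutvertex. A graph is Hamiltonian if it has a (not necessarily induced) cycle containing all of its vertices, and non-Hamiltonian otherwise. The length of a path is its number of edges. A $(u,v)$-path is a path with ends $u$ and $v$. The union of graphs $G_1\cup G_2$ is the graph $(V(G_1)\cup V(G_2),E(G_1)\cup E(G_2))$. Write $[3]=\{1,2,3\}$. HC-obstruction: a graph $H$ such that $H$ is 2-connected, $H$ has no Hamiltonian cycle, and every induced subgraph of $H$ either equals $H$, is not 2-connected, or is Hamiltonian. Wheel: a graph obtained from a cycle $C$ (of any length at least three) by adding one new vertex not in $V(C)$ which is adjacent to at least three vertices of $C$ (so $K_4$ is a wheel). A graph is wheel-free if none of its induced subgraphs is isomorphic to a wheel. Prism: let $K$ and $L$ be two disjoint triangles on $\{k_1,k_2,k_3\}$ and $\{l_1,l_2,l_3\}$ respectively, and for each $i\in[3]$ let $P_i$ be a $(k_i,l_i)$-path of length at least two, such that $P_1,P_2,P_3$ are pairwise vertex-disjoint (and each $P_i$ meets $K\cup L$ only in its ends). The graph $K\cup L\cup P_1\cup P_2\cup P_3$ is a prism. Pyramid: let $K$ be a triangle on $\{k_1,k_2,k_3\}$, let $l$ be a vertex not in $K$, and for each $i\in[3]$ let $P_i$ be a $(k_i,l)$-path of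 length at least two, such that $P_1,P_2,P_3$ are internally vertex-disjoint (any two of them share only the vertex $l$). The graph $K\cup P_1\cup P_2\cup P_3$ is a pyramid. Theta: let $a,b$ be two distinct vertices, and for each $i\in[3]$ let $P_i$ be an $(a,b)$-path of length at least two, such that $P_1,P_2,P_3$ are internally vertex-disjoint (any two of them share only $a$ and $b$). The graph $P_1\cup P_2\cup P_3$ is a theta. A prism$^+$ (respectively pyramid$^+$, theta$^+$) is a graph obtained from a prism (respectively pyramid, theta) by selecting one or more of the three paths $P_1,P_2,P_3$ in its definition and adding, for each selected path, an edge joining the two ends of that path. In the case of a theta$^+$, only one edge $ab$ is added. A 3-path-configuration (3PC) is a graph isomorphic to a prism, a pyramid, a theta, a prism$^+$, a pyramid$^+$, or a theta$^+$. -}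

module Defs where

open import Level using (0ℓ)
open import Data.Bool using (true; false)
open import Data.Nat using (ℕ; zero; suc; _≤_)
open import Data.Fin using (Fin; zero; suc; fromℕ; inject₁)
open import Data.Fin.Subset using (Subset; Nonempty; ⊤; ∣_∣; _-_) renaming (_∈_ to _∈ₛ_)
open import Data.Vec using ([]; _∷_)
open import Data.Product using (Σ; ∃; ∃-syntax; _×_; _,_)
open import Data.Sum using (_⊎_)
open import Function using (_∘_; _on_)
open import Function.Bundles using (_↔_; module Inverse)
open import Function.Definitions using (Injective)
open import Relation.Nullary using (¬_)
open import Relation.Unary using (Pred; U; _≐_)
open import Relation.Binary.Core using (Rel; _⇒_; _⇔_)
open import Relation.Binary.Definitions using (Decidable; Symmetric; Irreflexive)
open import Relation.Binary.PropositionalEquality using (_≡_; _≢_; cong)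
open import Relation.Binary.Construct.Closure.ReflexiveTransitive using (Star)
import Relation.Unary as U₁
import Relation.Binary.Construct.Union as U₂

record Graph : Set₁ where
  infix 4 _~_
  field
    order  : ℕ
  Vertex : Set
  Vertex = Fin order
  field
    _~_    : Rel Vertex 0ℓ
    _~?_   : Decidable _~_
    sym    : Symmetric _~_
    irrefl : Irreflexive _≡_ _~_

open Graph using (order; Vertex)

record _≅_ (G H : Graph) : Set where
  field
    bijection : Vertex G ↔ Vertex H
  open Inverse bijection public using (to)
  field
    preserves : Graph._~_ G ⇔ (Graph._~_ H on to)

-- The increasing enumeration of the elements of a subset.
elem : ∀ {n} (S : Subset n) → Fin ∣ S ∣ → Fin n
elem (true  ∷ S) zero    = zero
elem (true  ∷ S) (suc i) = suc (elem S i)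
elem (false ∷ S) i       = suc (elem S i)

-- The induced subgraph G[S], with vertex set S relabelled by elem S.
infix 8 _[_]
_[_] : (G : Graph) → Subset (order G) → Graph
G [ S ] = record
  { order  = ∣ S ∣
  ; _~_    = _~_ on elem S
  ; _~?_   = λ i j → elem S i ~? elem S j
  ; sym    = sym
  ; irrefl = irrefl ∘ cong (elem S)
  }
  where open Graph G

Reachable : (G : Graph) → Rel (Vertex G) 0ℓ
Reachable G = Star (Graph._~_ G)

Connected : Graph → Set
Connected G = ∀ u v → Reachable G u v

-- Deleting v separates two vertices from one component, i.e. it
-- increases the number of components.
IsCutvertex : (G : Graph) → Vertex G → Set
IsCutvertex G v = ∃[ x ] ∃[ y ]
    Reachable G (elem (⊤ - v) x) (elem (⊤ - v) y)
  × ¬ Reachable (G [ ⊤ - v ]) x y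

2-Connected : Graph → Set
2-Connected G = 3 ≤ order G × Connected G × (∀ v → ¬ IsCutvertex G v)

-- Unlike Graph, its vertex set may be a proper part of the ambient type, so
-- that the union of two graphs sharing some vertices makes sense.
record GraphOn (A : Set) : Set₁ where
  field
    V : Pred A 0ℓ
    E : Rel A 0ℓ

open GraphOn public

module _ {A : Set} where

  infixl 6 _∪_
  _∪_ : GraphOn A → GraphOn A → GraphOn A
  X ∪ Y = record { V = V X U₁.∪ V Y ; E = E X U₂.∪ E Y }

  ⋃ : {I : Set} → (I → GraphOn A) → GraphOn A
  ⋃ X = record
    { V = λ x → ∃[ i ] V (X i) x
    ; E = λ x y → ∃[ i ] E (X i) x y
    }

  edge : A → A → GraphOn A
  edge a b = record
    { V = λ x → x ≡ a ⊎ x ≡ b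
    ; E = λ x y → (x ≡ a × y ≡ b) ⊎ (x ≡ b × y ≡ a)
    }

  triangle : (Fin 3 → A) → GraphOn A
  triangle k = record
    { V = λ x → ∃[ i ] x ≡ k i
    ; E = λ x y → ∃[ i ] ∃[ j ] i ≢ j × x ≡ k i × y ≡ k j
    }

  star : A → Pred A 0ℓ → GraphOn A
  star h N = record
    { V = λ x → x ≡ h ⊎ N x
    ; E = λ x y → (x ≡ h × N y) ⊎ (N x × y ≡ h)
    }

record Path {A : Set} (u v : A) : Set where
  field
    length    : ℕ
    vertex    : Fin (suc length) → A
    injective : Injective _≡_ _≡_ vertex
    start     : vertex zero ≡ u
    end       : vertex (fromℕ length) ≡ v

  graph : GraphOn A
  graph = record
    { V = λ x → ∃[ i ] x ≡ vertex i
    ; E = λ x y → ∃[ i ] E (edge (vertex (inject₁ i)) (vertex (suc i))) x y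
    }

open Path using (length)

-- A cycle is a path of length at least two together with an edge
-- joining its ends.
record Cycle (A : Set) : Set where
  field
    {u v} : A
    path  : Path u v
    long  : 2 ≤ length path

  graph : GraphOn A
  graph = Path.graph path ∪ edge u v

-- An equality of vertex and edge sets, not merely a containment of X in G.
infix 4 _Is_
_Is_ : (G : Graph) → GraphOn (Vertex G) → Set
G Is X = U ≐ V X × Graph._~_ G ⇔ E X

Hamiltonian : Graph → Set
Hamiltonian G = Σ (Cycle (Vertex G)) λ C →
  E (Cycle.graph C) ⇒ Graph._~_ G × (∀ v → V (Cycle.graph C) v)

IsHCObstruction : Graph → Set
IsHCObstruction H =
    2-Connected H
  × ¬ Hamiltonian H
  × (∀ S → S ≡ ⊤ ⊎ ¬ 2-Connected (H [ S ]) ⊎ Hamiltonian (H [ S ]))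

record IsWheel (G : Graph) : Set where
  field
    rim        : Cycle (Vertex G)
    hub        : Vertex G
    hub∉rim    : ¬ V (Cycle.graph rim) hub
    spokes     : Subset (order G)
    spokes⊆rim : ∀ {x} → x ∈ₛ spokes → V (Cycle.graph rim) x
    3≤spokes   : 3 ≤ ∣ spokes ∣
    isUnion    : G Is Cycle.graph rim ∪ star hub (_∈ₛ spokes)

WheelFree : Graph → Set₁
WheelFree G = ∀ S → ¬ (∃[ W ] IsWheel W × W ≅ (G [ S ]))

record Prism (A : Set) : Set where
  field
    k l         : Fin 3 → A
    k-injective : Injective _≡_ _≡_ k
    l-injective : Injective _≡_ _≡_ l
    k≢l         : ∀ i j → k i ≢ l j
    P           : ∀ i → Path (k i) (l i)
    long        : ∀ i → 2 ≤ length (P i)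
    disjoint    : ∀ {i j} → i ≢ j → ∀ {x} →
                  V (Path.graph (P i)) x → ¬ V (Path.graph (P j)) x
    meets       : ∀ i {x} → V (Path.graph (P i)) x →
                  V (triangle k ∪ triangle l) x → x ≡ k i ⊎ x ≡ l i

  graph : GraphOn A
  graph = triangle k ∪ triangle l ∪ ⋃ (Path.graph ∘ P)

  chords : Subset 3 → GraphOn A
  chords s = ⋃ {I = ∃ (_∈ₛ s)} λ (i , _) → edge (k i) (l i)

record Pyramid (A : Set) : Set where
  field
    k           : Fin 3 → A
    l           : A
    k-injective : Injective _≡_ _≡_ k
    k≢l         : ∀ i → k i ≢ l
    P           : ∀ i → Path (k i) l
    long        : ∀ i → 2 ≤ length (P i)
    disjoint    : ∀ {i j} → i ≢ j → ∀ {x} →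
                  V (Path.graph (P i)) x → V (Path.graph (P j)) x → x ≡ l

  graph : GraphOn A
  graph = triangle k ∪ ⋃ (Path.graph ∘ P)

  chords : Subset 3 → GraphOn A
  chords s = ⋃ {I = ∃ (_∈ₛ s)} λ (i , _) → edge (k i) l

record Theta (A : Set) : Set where
  field
    a b      : A
    a≢b      : a ≢ b
    P        : Fin 3 → Path a b
    long     : ∀ i → 2 ≤ length (P i)
    disjoint : ∀ {i j} → i ≢ j → ∀ {x} →
               V (Path.graph (P i)) x → V (Path.graph (P j)) x → x ≡ a ⊎ x ≡ b

  graph : GraphOn A
  graph = ⋃ (Path.graph ∘ P)

  chord : GraphOn A
  chord = edge a b

IsPrism IsPyramid IsTheta IsPrism⁺ IsPyramid⁺ IsTheta⁺ : Graph → Set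

IsPrism   G = Σ (Prism   (Vertex G)) λ X → G Is Prism.graph X
IsPyramid G = Σ (Pyramid (Vertex G)) λ X → G Is Pyramid.graph X
IsTheta   G = Σ (Theta   (Vertex G)) λ X → G Is Theta.graph X

IsPrism⁺ G = Σ (Prism (Vertex G)) λ X → ∃[ s ]
  Nonempty s × G Is Prism.graph X ∪ Prism.chords X s
IsPyramid⁺ G = Σ (Pyramid (Vertex G)) λ X → ∃[ s ]
  Nonempty s × G Is Pyramid.graph X ∪ Pyramid.chords X s
IsTheta⁺ G = Σ (Theta (Vertex G)) λ X →
  G Is Theta.graph X ∪ Theta.chord X

Is3PC : Graph → Set₁
Is3PC G = ∃[ H ] H ≅ G ×
  ( IsPrism H ⊎ IsPyramid H ⊎ IsTheta H
  ⊎ IsPrism⁺ H ⊎ IsPyramid⁺ H ⊎ IsTheta⁺ H )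

{-# OPTIONS --safe #-}
-- The interior vertices of the three paths of a 3PC have degree two, so a Hamiltonian cycle would
-- contain these paths. That is one edge too many at an apex or at an end of a theta, while the
-- vertices of two triangles would have to be matched within each triangle, which is impossible.
-- A 2-connected proper induced subgraph misses the interior of a path; two of its links between
-- the two sides close up to a Hamiltonian cycle, and with fewer links it would have a cutvertex.
--
-- Conversely, let G be a wheel-free HC-obstruction without induced 3PC. If D is a path whose ends
-- are attached to x and y respectively, G − D is 2-connected and its Hamiltonian cycle contains the
-- edge x y, then inserting D makes G Hamiltonian. The edge x y is forced into the cycle by a cut
-- that can otherwise be crossed at a single vertex only.
--
-- First, G has no induced prism, even one whose paths may be single edges. Consider one with a
-- path as long as possible. A path of the prism is a single edge k l without ear, or we have found
-- a 3PC. Then k and l have degree three and G − k is 2-connected. The Hamiltonian cycle of G − k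
-- contains the edge between the other two vertices of the triangle of k, where k can be inserted:
-- the only obstacle is a path off the prism that creates a prism with a longer path.
--
-- Without prisms, a component D of what an induced cycle C leaves of G attaches within an edge
-- x y of C. Choose C and D with D as small as possible. Then D is a path, as otherwise x y together
-- with a path through D is a cycle with a smaller component. So D can be inserted in the edge x y.
module Submission where

open import Data.Bool using (true; false)
open import Data.Nat using (ℕ; zero; suc; _≤_; _<_; _+_; z≤n; s≤s)
open import Data.Nat.Properties using
  (≤-refl; ≤-trans; ≤-reflexive; n≤1+n; ≤-pred; <⇒≱; m≤n+m; m≤m+n; +-suc; +-monoˡ-≤; +-comm;
   +-identityʳ; 1+n≰n; <-irrefl) renaming (suc-injective to ℕ-suc-injective)
open import Data.Fin using (Fin; zero; suc; fromℕ; inject₁; toℕ)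
open import Data.Fin.Properties using
  (_≟_; suc-injective; toℕ-injective; toℕ-inject₁; toℕ-fromℕ; toℕ≤pred[n]; any?; all?; injective⇒≤)
open import Data.Fin.Subset using (Subset; Nonempty; ⊤; ∣_∣; _-_; ⁅_⁆) renaming (_∈_ to _∈ₛ_)
open import Data.Fin.Subset.Properties using
  (p⊂q⇒∣p∣<∣q∣; ∈⊤; ⊆-antisym; ⊆⊤; x∈p⇒∣p-x∣<∣p∣; x∈p∧x≢y⇒x∈p-y; p─q─q≡p─q) renaming (_∈?_ to _∈ₛ?_)
open import Data.Vec as Vec using ([]; _∷_)
open import Data.Vec.Properties using (lookup∘tabulate; []=⇒lookup; lookup⇒[]=)
open import Data.List using (List; []; _∷_; _++_; length; lookup; map; tabulate)
open import Data.List.Properties using (length-++; ∷-injectiveˡ)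
open import Data.List.Membership.Propositional using (_∈_; _∉_; find; lose)
open import Data.List.Membership.Propositional.Properties using
  (∈-lookup; ∈-++⁺ˡ; ∈-++⁺ʳ; ∈-++⁻; ∈-map⁺; ∈-map⁻; ∈-tabulate⁺; ∈-tabulate⁻)
open import Data.List.Relation.Unary.Any as Any using (here; there)
open import Data.List.Relation.Unary.Any.Properties using (lookup-index)
open import Data.List.Relation.Unary.All as All using (All; []; _∷_)
open import Data.Product using (∃; ∃-syntax; _×_; _,_; proj₁; proj₂)
open import Data.Sum using (_⊎_; inj₁; inj₂; map₁; map₂; swap) renaming ([_,_]′ to [_,_])
open import Data.Empty using (⊥; ⊥-elim)
open import Data.Unit using (tt) renaming (⊤ to Unit)
open import Function using (_∘_; id; case_of_)
open import Function.Bundles using (module Inverse)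
open import Function.Construct.Identity using (↔-id)
open import Relation.Nullary using (¬_; Dec; yes; no; contradiction; ¬?; does)
open import Relation.Nullary.Decidable using (_×-dec_; _⊎-dec_; _→-dec_; map′; decidable-stable)
open import Relation.Unary using () renaming (Decidable to Decidable₁)
open import Relation.Binary.PropositionalEquality using (_≡_; _≢_; refl; sym; trans; cong; subst; ≢-sym)
open import Relation.Binary.Construct.Closure.ReflexiveTransitive using (ε; _◅_)
open import Defs

-- The workhorse is local: a vertex off an induced cycle with two nonadjacent neighbours on it
-- yields a wheel if it has a third neighbour there, and a theta otherwise. Most cases amount to
-- finding an induced cycle and a vertex to which this applies. Hence induced paths can be cut,
-- reversed and joined, and induced cycles can be based at any of their vertices.
--
-- Prisms need separate treatment because the paths of a 3PC have length at least two. An induced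
-- prism with a single-edge path is not yet a configuration. It becomes one, with that edge as a
-- chord, once a component outside the prism is attached to both ends of the edge and to nothing
-- else of the prism.
--
-- Extremal choices turn into inductions: on the number of vertices minus the length of a prism
-- path, and on the size of a component. Where a classical proof would argue by contradiction, a
-- search through the finitely many vertices decides whether a counterexample exists.

module Paths (G : Graph) where
  open Graph G public using (order; Vertex; _~_; _~?_) renaming (sym to ~-sym)
  open import Data.List.Membership.DecPropositional (_≟_ {order}) public using (_∈?_)

  -- Walks and induced paths.

  ~⇒≢ : ∀ {u v} → u ~ v → u ≢ v
  ~⇒≢ u~v u≡v = Graph.irrefl G u≡v u~v

  Far : Vertex → Vertex → Set
  Far u v = u ≢ v × ¬ u ~ v

  far-sym : ∀ {u v} → Far u v → Far v u
  far-sym (u≢v , u≁v) = ≢-sym u≢v , u≁v ∘ ~-sym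

  far? : ∀ u v → Dec (Far u v)
  far? u v = ¬? (u ≟ v) ×-dec ¬? (u ~? v)

  near : ∀ {u v} → ¬ Far u v → u ≡ v ⊎ u ~ v
  near {u} {v} ¬far with u ≟ v | u ~? v
  ... | yes u≡v | _       = inj₁ u≡v
  ... | no _    | yes u~v = inj₂ u~v
  ... | no u≢v  | no u≁v  = contradiction (u≢v , u≁v) ¬far

  data Walk (S : Vertex → Set) : Vertex → Vertex → Set where
    stop  : ∀ {u} → S u → Walk S u u
    step  : ∀ {u v w} → S u → u ~ v → Walk S v w → Walk S u w

  module _ {S : Vertex → Set} where

    walk-start : ∀ {u v} → Walk S u v → S u
    walk-start (stop s)      = s
    walk-start (step s _ _) = s

    walk-end : ∀ {u v} → Walk S u v → S v
    walk-end (stop s)      = s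
    walk-end (step _ _ ω) = walk-end ω

    infixr 5 _⊕_
    _⊕_ : ∀ {u v w} → Walk S u v → Walk S v w → Walk S u w
    stop _      ⊕ ω′ = ω′
    step s a ω  ⊕ ω′ = step s a (ω ⊕ ω′)

    walk-edge : ∀ {u v} → S u → S v → u ~ v → Walk S u v
    walk-edge s t a = step s a (stop t)

    walk-rev : ∀ {u v} → Walk S u v → Walk S v u
    walk-rev (stop s)    = stop s
    walk-rev (step s a ω) = walk-rev ω ⊕ walk-edge (walk-start ω) s (~-sym a)

  walk-map : ∀ {S T : Vertex → Set} → (∀ {v} → S v → T v) → ∀ {u v} → Walk S u v → Walk T u v
  walk-map f (stop s)    = stop (f s)
  walk-map f (step s a ω) = step (f s) a (walk-map f ω)

  -- As a predicate, `Walk S u` is the component of `u` in `S`; a walk that starts at `u` never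
  -- leaves it.
  reach : ∀ {S : Vertex → Set} {u v} → Walk S u v → Walk (Walk S u) u v
  reach (stop s)     = stop (stop s)
  reach (step s a ω) = step (stop s) a (walk-map (step s a) (reach ω))

  exit : ∀ {S T : Vertex → Set} → Decidable₁ T → ∀ {u v} → Walk S u v → ¬ T u → T v →
         ∃[ w ] ∃[ z ] Walk (λ p → S p × ¬ T p) u w × w ~ z × T z × S z
  exit T? (stop s) ¬t t = contradiction t ¬t
  exit T? {u} (step {v = v} s a ω) ¬t t with T? v
  ... | yes tv = u , v , stop (s , ¬t) , a , tv , walk-start ω
  ... | no ¬tv with exit T? ω ¬tv t
  ...   | w , z , ω′ , b , tz , sz = w , z , step (s , ¬t) a ω′ , b , tz , sz

  -- The list omits the first vertex, so its length is the number of edges of the path.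
  data Induced : Vertex → List Vertex → Vertex → Set where
    []  : ∀ {x} → Induced x [] x
    _∷_ : ∀ {x y ys z} → x ~ y × All (Far x) ys → Induced y ys z → Induced x (y ∷ ys) z

  record IPath (x y : Vertex) : Set where
    constructor ipath
    field
      {rest}  : List Vertex
      induced : Induced x rest y

  open IPath public

  infix 4 _∈ₚ_ _∉ₚ_
  _∈ₚ_ _∉ₚ_ : ∀ {x y} → Vertex → IPath x y → Set
  _∈ₚ_ {x} v π = v ∈ x ∷ rest π
  v ∉ₚ π = ¬ v ∈ₚ π

  _∈ₚ?_ : ∀ {x y} v (π : IPath x y) → Dec (v ∈ₚ π)
  _∈ₚ?_ {x} v π = v ∈? (x ∷ rest π)

  start∈ : ∀ {x y} (π : IPath x y) → x ∈ₚ π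
  start∈ π = here refl

  induced-end : ∀ {x xs y} → Induced x xs y → y ∈ x ∷ xs
  induced-end []      = here refl
  induced-end (_ ∷ π) = there (induced-end π)

  end∈ : ∀ {x y} (π : IPath x y) → y ∈ₚ π
  end∈ (ipath π) = induced-end π

  induced-∉ : ∀ {x xs y} → Induced x xs y → x ∉ xs
  induced-∉ ((a , _) ∷ π)  (here x≡y) = ~⇒≢ a x≡y
  induced-∉ ((_ , fs) ∷ π) (there m) = proj₁ (All.lookup fs m) refl

  ⟨_⟩ : ∀ x → IPath x x
  ⟨ x ⟩ = ipath []

  join-induced : ∀ {x xs y w ws z} → Induced x xs y → y ~ w → Induced w ws z →
         (∀ {p q} → p ∈ x ∷ xs → q ∈ w ∷ ws → (p ≡ y × q ≡ w) ⊎ Far p q) →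
         Induced x (xs ++ w ∷ ws) z
  join-induced {y = y} {w = w} {ws = ws} [] y~w ρ cross = (y~w , All.tabulate far) ∷ ρ
    where
    far : ∀ {q} → q ∈ ws → Far y q
    far q∈ with cross (here refl) (there q∈)
    ... | inj₁ (_ , refl) = contradiction q∈ (induced-∉ ρ)
    ... | inj₂ f          = f
  join-induced {x} {x₁ ∷ xs} {y} {w} {ws} ((x~x₁ , fs) ∷ π) y~w ρ cross =
    (x~x₁ , All.tabulate far) ∷ join-induced π y~w ρ (cross ∘ there)
    where
    far : ∀ {q} → q ∈ xs ++ w ∷ ws → Far x q
    far q∈ with ∈-++⁻ xs q∈
    ... | inj₁ m = All.lookup fs m
    ... | inj₂ m with cross (here refl) m
    ...   | inj₁ (refl , _) = contradiction (induced-end π) (induced-∉ ((x~x₁ , fs) ∷ π))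
    ...   | inj₂ f          = f

  record Joined {x y w z} (π : IPath x y) (ρ : IPath w z) : Set where
    field
      path : IPath x z
      from : ∀ {v} → v ∈ₚ path → v ∈ₚ π ⊎ v ∈ₚ ρ
      left : ∀ {v} → v ∈ₚ π → v ∈ₚ path
      right : ∀ {v} → v ∈ₚ ρ → v ∈ₚ path
      size : length (rest path) ≡ length (rest π) + suc (length (rest ρ))

  abstract
    join : ∀ {x y w z} (π : IPath x y) → y ~ w → (ρ : IPath w z) →
           (∀ {p q} → p ∈ₚ π → q ∈ₚ ρ → (p ≡ y × q ≡ w) ⊎ Far p q) → Joined π ρ
    join {x} π a ρ cross = record
      { path = ipath (join-induced (induced π) a (induced ρ) cross)
      ; from = ∈-++⁻ (x ∷ rest π) ; left = ∈-++⁺ˡ ; right = ∈-++⁺ʳ (x ∷ rest π)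
      ; size = length-++ (rest π) }

  record Reversed {x y} (π : IPath x y) : Set where
    field
      path : IPath y x
      to   : ∀ {v} → v ∈ₚ π → v ∈ₚ path
      from : ∀ {v} → v ∈ₚ path → v ∈ₚ π
      size : length (rest path) ≡ length (rest π)

  abstract
    reversed : ∀ {x y} (π : IPath x y) → Reversed π
    reversed (ipath []) = record { path = ipath [] ; to = id ; from = id ; size = refl }
    reversed {x} (ipath {y₁ ∷ ys} ((x~y , fs) ∷ π)) with reversed (ipath π)
    ... | r = record
      { path = J.path
      ; to   = λ { (here refl) → J.right (here refl) ; (there m) → J.left (R.to m) }
      ; from = λ m → case J.from m of λ { (inj₁ k) → there (R.from k) ; (inj₂ (here refl)) → here refl }
      ; size = trans J.size (trans (+-comm _ 1) (cong suc R.size))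
      }
      where
      module R = Reversed r
      cross : ∀ {p q} → p ∈ₚ R.path → q ∈ₚ ⟨ x ⟩ → (p ≡ y₁ × q ≡ x) ⊎ Far p q
      cross p∈ (here refl) with R.from p∈
      ... | here refl = inj₁ (refl , refl)
      ... | there m   = inj₂ (far-sym (All.lookup fs m))
      module J = Joined (join R.path (~-sym x~y) ⟨ x ⟩ cross)

  record Split {x y} (π : IPath x y) (p : Vertex) : Set where
    field
      pre   : IPath x p
      suf   : IPath p y
      pre⊆  : ∀ {v} → v ∈ₚ pre → v ∈ₚ π
      suf⊆  : ∀ {v} → v ∈ₚ suf → v ∈ₚ π
      cover : ∀ {v} → v ∈ₚ π → v ∈ₚ pre ⊎ v ∈ₚ suf
      cross : ∀ {u v} → u ∈ₚ pre → v ∈ₚ suf → u ≡ p ⊎ v ≡ p ⊎ Far u v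

  extend-split : ∀ {x y ys z p} (a : x ~ y × All (Far x) ys) (π : Induced y ys z) →
                 Split (ipath π) p → Split (ipath (a ∷ π)) p
  extend-split {x} {y} {ys} {p = p} (x~y , fs) π s = record
    { pre   = ipath ((x~y , All.tabulate (λ m → far-pre m)) ∷ induced pre)
    ; suf   = suf
    ; pre⊆  = λ { (here e) → here e ; (there m) → there (pre⊆ m) }
    ; suf⊆  = there ∘ suf⊆
    ; cover = λ { (here e) → inj₁ (here e) ; (there m) → map₁ there (cover m) }
    ; cross = λ { (here refl) m → cross′ m ; (there l) m → cross l m }
    }
    where
    open Split s
    far-pre : ∀ {v} → v ∈ rest pre → Far x v
    far-pre {v} m with pre⊆ (there m)
    ... | here refl = contradiction m (induced-∉ (induced pre))
    ... | there l   = All.lookup fs l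
    cross′ : ∀ {v} → v ∈ₚ suf → x ≡ p ⊎ v ≡ p ⊎ Far x v
    cross′ {v} m with suf⊆ m
    ... | there l = inj₂ (inj₂ (All.lookup fs l))
    ... | here refl with cross (here refl) m
    ...   | inj₁ e = inj₂ (inj₁ e)
    ...   | inj₂ (inj₁ e) = inj₂ (inj₁ e)
    ...   | inj₂ (inj₂ f) = contradiction refl (proj₁ f)

  split-start : ∀ {x y} (π : IPath x y) → Split π x
  split-start {x} π = record
    { pre = ⟨ x ⟩ ; suf = π ; pre⊆ = λ { (here e) → here e } ; suf⊆ = id ; cover = inj₂
    ; cross = λ { (here e) _ → inj₁ e } }

  abstract
    split : ∀ {x y p} (π : IPath x y) → p ∈ₚ π → Split π p
    split π (here refl) = split-start π
    split (ipath (a ∷ π)) (there m) = extend-split a π (split (ipath π) m)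

  flip-split : ∀ {x y p} {π : IPath x y} → Split (Reversed.path (reversed π)) p → Split π p
  flip-split {π = π} s = record
    { pre   = S.path
    ; suf   = P.path
    ; pre⊆  = R.from ∘ suf⊆ ∘ S.from
    ; suf⊆  = R.from ∘ pre⊆ ∘ P.from
    ; cover = λ m → case cover (R.to m) of λ { (inj₁ k) → inj₂ (P.to k) ; (inj₂ k) → inj₁ (S.to k) }
    ; cross = λ k l → case cross (P.from l) (S.from k) of λ
        { (inj₁ e) → inj₂ (inj₁ e) ; (inj₂ (inj₁ e)) → inj₁ e ; (inj₂ (inj₂ f)) → inj₂ (inj₂ (far-sym f)) }
    }
    where
    open Split s
    module R = Reversed (reversed π)
    module P = Reversed (reversed pre)
    module S = Reversed (reversed suf)

  record LastCut {x y} (π : IPath x y) (T : Vertex → Set) : Set where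
    field
      {p}   : Vertex
      p∈    : p ∈ₚ π
      Tp    : T p
      cut   : Split π p
      only  : ∀ {v} → v ∈ₚ Split.suf cut → T v → v ≡ p

  extend-cut : ∀ {T : Vertex → Set} {x y ys z} (a : x ~ y × All (Far x) ys) (π : Induced y ys z) →
               LastCut (ipath π) T → LastCut (ipath (a ∷ π)) T
  extend-cut a π c = record
    { p∈ = there p∈ ; Tp = Tp ; cut = extend-split a π cut ; only = only }
    where open LastCut c

  last-cut′ : ∀ {T : Vertex → Set} → Decidable₁ T → ∀ {x xs y p} (π : Induced x xs y) →
              p ∈ x ∷ xs → T p → LastCut (ipath π) T
  last-cut′ T? [] (here refl) Tp =
    record { p∈ = here refl ; Tp = Tp ; cut = split-start _ ; only = λ { (here e) _ → e } }
  last-cut′ T? {xs = xs} (a ∷ π) p∈ Tp with Any.any? T? xs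
  ... | yes t = let (v , m , Tv) = find t in extend-cut a π (last-cut′ T? π m Tv)
  ... | no ¬t with p∈
  ...   | there m   = contradiction (lose m Tp) ¬t
  ...   | here refl = record { p∈ = here refl ; Tp = Tp ; cut = split-start _
                             ; only = λ { (here e) _ → e ; (there m) t → contradiction (lose m t) ¬t } }

  abstract
    last-cut : ∀ {T : Vertex → Set} → Decidable₁ T → ∀ {x y p} (π : IPath x y) → p ∈ₚ π → T p → LastCut π T
    last-cut T? π = last-cut′ T? (induced π)

  record FirstCut {x y} (π : IPath x y) (T : Vertex → Set) : Set where
    field
      {p}   : Vertex
      p∈    : p ∈ₚ π
      Tp    : T p
      cut   : Split π p
      only  : ∀ {v} → v ∈ₚ Split.pre cut → T v → v ≡ p

  abstract
    first-cut : ∀ {T : Vertex → Set} → Decidable₁ T → ∀ {x y p} (π : IPath x y) → p ∈ₚ π → T p → FirstCut π T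
    first-cut T? π m Tp = record
      { p∈ = R.from p∈ ; Tp = Tq ; cut = flip-split cut
      ; only = λ l t → only (Reversed.from (reversed (Split.suf cut)) l) t }
      where
      module R = Reversed (reversed π)
      open LastCut (last-cut T? R.path (R.to m) Tp) renaming (Tp to Tq)

  ipath-walk : ∀ {x y} (π : IPath x y) → Walk (_∈ₚ π) x y
  ipath-walk (ipath [])            = stop (here refl)
  ipath-walk (ipath ((a , _) ∷ π)) = step (here refl) a (walk-map there (ipath-walk (ipath π)))

  along : ∀ {x y} (π : IPath x y) {S : Vertex → Set} → (∀ {v} → v ∈ₚ π → S v) → Walk S x y
  along π f = walk-map f (ipath-walk π)

  record PathIn (S : Vertex → Set) (x y : Vertex) : Set where
    field
      path : IPath x y
      sub  : ∀ {v} → v ∈ₚ path → S v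

  abstract
    -- Shorten the rest of the walk, then go from `u` straight to the last vertex of that path which
    -- equals `u` or is adjacent to it.
    shorten : ∀ {S : Vertex → Set} {u v} → Walk S u v → PathIn S u v
    shorten (stop s) = record { path = ⟨ _ ⟩ ; sub = λ { (here refl) → s } }
    shorten {S} {u} {t} (step {v = w} s a ω) with shorten ω
    ... | record { path = π ; sub = sub } = prepend (near Tp)
      where
      open LastCut (last-cut {T = λ p → ¬ Far u p} (λ p → ¬? (far? u p)) π (start∈ π) (λ (_ , ≁) → ≁ a))
      open Split cut
      prepend : u ≡ p ⊎ u ~ p → PathIn S u t
      prepend (inj₁ u≡p)  = subst (λ q → PathIn S q t) (sym u≡p) (record { path = suf ; sub = sub ∘ suf⊆ })
      prepend (inj₂ u~p)  = record
        { path = ipath ((u~p , All.tabulate far) ∷ induced suf)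
        ; sub  = λ { (here refl) → s ; (there m) → sub (suf⊆ m) } }
        where
        far : ∀ {v} → v ∈ rest suf → Far u v
        far {v} m with far? u v
        ... | yes f = f
        ... | no ¬f = contradiction (subst (_∈ rest suf) (only (there m) ¬f) m) (induced-∉ (induced suf))

  -- `A` and `B` may overlap, so the path may be a single vertex.
  record Connector (S A B : Vertex → Set) : Set where
    field
      {c d} : Vertex
      path  : IPath c d
      sub   : ∀ {v} → v ∈ₚ path → S v
      Ac    : A c
      Bd    : B d
      onlyA : ∀ {v} → v ∈ₚ path → A v → v ≡ c
      onlyB : ∀ {v} → v ∈ₚ path → B v → v ≡ d

  -- Of an induced path from `A` to `B`, keep what follows its last vertex in `A`, and of that the
  -- part up to the first vertex in `B`.
  connector : ∀ {S A B : Vertex → Set} → Decidable₁ A → Decidable₁ B →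
              ∀ {u v} → Walk S u v → A u → B v → Connector S A B
  connector A? B? ω Au Bv = record
    { path = S₂.pre ; sub = sub ∘ S₁.suf⊆ ∘ S₂.pre⊆ ; Ac = L.Tp ; Bd = F.Tp
    ; onlyA = λ m → L.only (S₂.pre⊆ m) ; onlyB = F.only }
    where
    open PathIn (shorten ω)
    module L = LastCut (last-cut A? path (start∈ path) Au)
    module S₁ = Split L.cut
    module F = FirstCut (first-cut B? S₁.suf (end∈ S₁.suf) Bv)
    module S₂ = Split F.cut

  -- For distinct `a` and `b` outside `S`, this is the interior of a path of length at least two
  -- from `a` to `b` whose only possible chord is the edge `a b`.
  Ear : (S : Vertex → Set) (a b : Vertex) → Set
  Ear S a b = Connector S (a ~_) (_~ b)

  ear : ∀ {S : Vertex → Set} {a b u v} → Walk S u v → a ~ u → v ~ b → Ear S a b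
  ear {a = a} {b} = connector (a ~?_) (_~? b)

  bounded? : ∀ k {P : List Vertex → Set} → (∀ xs → Dec (P xs)) → Dec (∃ λ xs → length xs ≤ k × P xs)
  bounded? zero    P? = map′ (λ p → [] , z≤n , p) (λ { ([] , _ , p) → p }) (P? [])
  bounded? (suc k) P? with P? [] | any? (λ x → bounded? k (P? ∘ (x ∷_)))
  ... | yes p | _ = yes ([] , z≤n , p)
  ... | no ¬p | yes (x , xs , l , p) = yes (x ∷ xs , s≤s l , p)
  ... | no ¬p | no ¬q = no λ { ([] , _ , p) → ¬p p ; (x ∷ xs , s≤s l , p) → ¬q (x , xs , l , p) }

  induced? : ∀ x xs y → Dec (Induced x xs y)
  induced? x [] y = map′ (λ { refl → [] }) (λ { [] → refl }) (x ≟ y)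
  induced? x (w ∷ ws) y = map′ (λ (a , π) → a ∷ π) (λ { (a ∷ π) → a , π })
    ((x ~? w ×-dec All.all? (far? x) ws) ×-dec induced? w ws y)

  induced-injective : ∀ {x xs y} → Induced x xs y → ∀ {i j} → lookup (x ∷ xs) i ≡ lookup (x ∷ xs) j → i ≡ j
  induced-injective π {zero} {zero} e = refl
  induced-injective {xs = xs} π {zero} {suc j} e = contradiction (subst (_∈ xs) (sym e) (∈-lookup j)) (induced-∉ π)
  induced-injective {xs = xs} π {suc i} {zero} e = contradiction (subst (_∈ xs) e (∈-lookup i)) (induced-∉ π)
  induced-injective (_ ∷ π) {suc i} {suc j} e = cong suc (induced-injective π e)

  -- A walk shortens to an induced path. Its vertices are distinct, so it is found among the lists
  -- of at most `order` vertices.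
  walk? : ∀ {S : Vertex → Set} → Decidable₁ S → ∀ u v → Dec (Walk S u v)
  walk? {S} S? u v = map′ there′ back (bounded? order (λ xs → induced? u xs v ×-dec All.all? S? (u ∷ xs)))
    where
    there′ : (∃ λ xs → length xs ≤ order × Induced u xs v × All S (u ∷ xs)) → Walk S u v
    there′ (_ , _ , π , all) = along (ipath π) (All.lookup all)
    back : Walk S u v → ∃ λ xs → length xs ≤ order × Induced u xs v × All S (u ∷ xs)
    back ω = rest path , ≤-trans (n≤1+n _) (injective⇒≤ (induced-injective (induced path))) , induced path , All.tabulate sub
      where open PathIn (shorten ω)

-- Case distinctions on three indices.

pattern 0F = zero
pattern 1F = suc zero
pattern 2F = suc (suc zero)

fin3 : {P : Fin 3 → Set} → P 0F → P 1F → P 2F → ∀ i → P i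
fin3 a b c 0F = a
fin3 a b c 1F = b
fin3 a b c 2F = c

distinct3 : {R : Fin 3 → Fin 3 → Set} → (∀ i j → R i j → R j i) → R 0F 1F → R 0F 2F → R 1F 2F →
            ∀ i j → i ≢ j → R i j
distinct3 s a b c 0F 0F i≢j = contradiction refl i≢j
distinct3 s a b c 0F 1F _ = a
distinct3 s a b c 0F 2F _ = b
distinct3 s a b c 1F 0F _ = s 0F 1F a
distinct3 s a b c 1F 1F i≢j = contradiction refl i≢j
distinct3 s a b c 1F 2F _ = c
distinct3 s a b c 2F 0F _ = s 0F 2F b
distinct3 s a b c 2F 1F _ = s 1F 2F c
distinct3 s a b c 2F 2F i≢j = contradiction refl i≢j

third : ∀ {i j : Fin 3} → i ≢ j → ∃[ t ] t ≢ i × t ≢ j × (∀ s → s ≡ i ⊎ s ≡ j ⊎ s ≡ t)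
third {0F} {0F} i≢j = contradiction refl i≢j
third {0F} {1F} _ = 2F , (λ ()) , (λ ()) , fin3 (inj₁ refl) (inj₂ (inj₁ refl)) (inj₂ (inj₂ refl))
third {0F} {2F} _ = 1F , (λ ()) , (λ ()) , fin3 (inj₁ refl) (inj₂ (inj₂ refl)) (inj₂ (inj₁ refl))
third {1F} {0F} _ = 2F , (λ ()) , (λ ()) , fin3 (inj₂ (inj₁ refl)) (inj₁ refl) (inj₂ (inj₂ refl))
third {1F} {1F} i≢j = contradiction refl i≢j
third {1F} {2F} _ = 0F , (λ ()) , (λ ()) , fin3 (inj₂ (inj₂ refl)) (inj₁ refl) (inj₂ (inj₁ refl))
third {2F} {0F} _ = 1F , (λ ()) , (λ ()) , fin3 (inj₂ (inj₁ refl)) (inj₂ (inj₂ refl)) (inj₁ refl)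
third {2F} {1F} _ = 0F , (λ ()) , (λ ()) , fin3 (inj₂ (inj₂ refl)) (inj₂ (inj₁ refl)) (inj₁ refl)
third {2F} {2F} i≢j = contradiction refl i≢j

other : (i : Fin 3) → ∃[ j ] j ≢ i
other 0F = 1F , λ ()
other 1F = 0F , λ ()
other 2F = 0F , λ ()

Const : {A : Set} → (Fin 3 → A) → Set
Const f = ∀ i j → f i ≡ f j

-- Three-path configurations and induced cycles.

module Configurations (G : Graph) where
  open Paths G public

  -- A theta, pyramid or prism, with or without chords: k and l are each constant (the ends of
  -- a theta, the apex of a pyramid) or a triangle, and the chords are the adjacencies k i ~ l i.
  record Config : Set where
    field
      k l c d : Fin 3 → Vertex
      path    : ∀ i → IPath (c i) (d i)
      k~c     : ∀ i → k i ~ c i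
      d~l     : ∀ i → d i ~ l i
      only-k  : ∀ i {v} → v ∈ₚ path i → k i ~ v → v ≡ c i
      only-l  : ∀ i {v} → v ∈ₚ path i → v ~ l i → v ≡ d i
      apart   : ∀ i j → i ≢ j → ∀ u v → u ∈ₚ path i → v ∈ₚ path j → Far u v
      k∉      : ∀ i j → k i ∉ₚ path j
      l∉      : ∀ i j → l i ∉ₚ path j
      k≢l     : ∀ i j → k i ≢ l j
      left    : Const k ⊎ (∀ i j → i ≢ j → k i ~ k j × (∀ v → v ∈ₚ path j → ¬ k i ~ v))
      right   : Const l ⊎ (∀ i j → i ≢ j → l i ~ l j × (∀ v → v ∈ₚ path j → ¬ v ~ l i))
      cross   : ∀ i j → k i ~ l j → i ≡ j ⊎ Const k ⊎ Const l

  -- The separation conditions concern regions `S i` that contain the ears, because the ears come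
  -- from shortened walks and are not known explicitly.
  fromEars : {S : Fin 3 → Vertex → Set} (k l : Fin 3 → Vertex) (ears : ∀ i → Ear (S i) (k i) (l i)) →
    (∀ i j → i ≢ j → ∀ u v → S i u → S j v → Far u v) →
    (∀ i j → ¬ S j (k i)) → (∀ i j → ¬ S j (l i)) → (∀ i j → k i ≢ l j) →
    Const k ⊎ (∀ i j → i ≢ j → k i ~ k j × (∀ v → S j v → ¬ k i ~ v)) →
    Const l ⊎ (∀ i j → i ≢ j → l i ~ l j × (∀ v → S j v → ¬ v ~ l i)) →
    (∀ i j → k i ~ l j → i ≡ j ⊎ Const k ⊎ Const l) → Config
  fromEars k l ears apart k∉ l∉ k≢l left right cross = record
    { k = k ; l = l ; path = path
    ; k~c = Connector.Ac ∘ ears ; d~l = Connector.Bd ∘ ears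
    ; only-k = λ i → Connector.onlyA (ears i) ; only-l = λ i → Connector.onlyB (ears i)
    ; apart = λ i j i≢j u v m n → apart i j i≢j u v (sub i m) (sub j n)
    ; k∉ = λ i j → k∉ i j ∘ sub j ; l∉ = λ i j → l∉ i j ∘ sub j ; k≢l = k≢l
    ; left = map₂ (λ f i j i≢j → proj₁ (f i j i≢j) , λ v → proj₂ (f i j i≢j) v ∘ sub j) left
    ; right = map₂ (λ f i j i≢j → proj₁ (f i j i≢j) , λ v → proj₂ (f i j i≢j) v ∘ sub j) right
    ; cross = cross }
    where
    path = λ i → Connector.path (ears i)
    sub = λ i {v} → Connector.sub (ears i) {v}

  ∈∉⇒≢ : ∀ {u v} {xs : List Vertex} → v ∈ xs → u ∉ xs → v ≢ u
  ∈∉⇒≢ m ¬m refl = ¬m m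

  record Uncons {x y} (π : IPath x y) : Set where
    field
      {b}   : Vertex
      tail  : IPath b y
      x~b   : x ~ b
      from  : ∀ {v} → v ∈ₚ π → v ≡ x ⊎ v ∈ₚ tail
      sub   : ∀ {v} → v ∈ₚ tail → v ∈ₚ π
      fresh : ∀ {v} → v ∈ₚ tail → v ≢ x
      only  : ∀ {v} → v ∈ₚ tail → x ~ v → v ≡ b
      size  : length (rest π) ≡ suc (length (rest tail))

  uncons : ∀ {x y} (π : IPath x y) → x ≢ y → Uncons π
  uncons (ipath []) x≢y = contradiction refl x≢y
  uncons (ipath (a ∷ π)) x≢y = record
    { tail = ipath π ; x~b = proj₁ a
    ; from = λ { (here e) → inj₁ e ; (there m) → inj₂ m }
    ; sub = there
    ; fresh = λ { m refl → induced-∉ (a ∷ π) m }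
    ; only = λ { (here e) _ → e ; (there m) x~v → contradiction x~v (proj₂ (All.lookup (proj₂ a) m)) }
    ; size = refl }

  record Unsnoc {x y} (π : IPath x y) : Set where
    field
      {b}   : Vertex
      init  : IPath x b
      b~y   : b ~ y
      from  : ∀ {v} → v ∈ₚ π → v ≡ y ⊎ v ∈ₚ init
      sub   : ∀ {v} → v ∈ₚ init → v ∈ₚ π
      fresh : ∀ {v} → v ∈ₚ init → v ≢ y
      only  : ∀ {v} → v ∈ₚ init → v ~ y → v ≡ b
      size  : length (rest π) ≡ suc (length (rest init))

  unsnoc : ∀ {x y} (π : IPath x y) → x ≢ y → Unsnoc π
  unsnoc π x≢y = record
    { init = I.path ; b~y = ~-sym x~b
    ; from = map₂ I.to ∘ from ∘ R.to ; sub = R.from ∘ sub ∘ I.from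
    ; fresh = fresh ∘ I.from ; only = λ m a → only (I.from m) (~-sym a)
    ; size = trans (sym R.size) (trans size (cong suc (sym I.size))) }
    where
    module R = Reversed (reversed π)
    open Uncons (uncons R.path (≢-sym x≢y))
    module I = Reversed (reversed tail)

  -- An induced cycle, as a vertex u and the path formed by its other vertices.
  record Cyc (u : Vertex) : Set where
    field
      {a z} : Vertex
      arc   : IPath a z
      u~a   : u ~ a
      z~u   : z ~ u
      a≢z   : a ≢ z
      only  : ∀ {v} → v ∈ₚ arc → u ~ v → v ≡ a ⊎ v ≡ z
      u∉    : u ∉ₚ arc

  open Cyc using (arc) public

  infix 4 _∈ₒ_
  _∈ₒ_ : ∀ {u} → Vertex → Cyc u → Set
  _∈ₒ_ {u} v C = v ≡ u ⊎ v ∈ₚ arc C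

  _∈ₒ?_ : ∀ {u} v (C : Cyc u) → Dec (v ∈ₒ C)
  _∈ₒ?_ {u} v C = v ≟ u ⊎-dec v ∈ₚ? arc C

  -- Any presentation of the same vertex set qualifies, in particular the reversed cycle with the
  -- same base.
  record Rotation {u} (C : Cyc u) (p : Vertex) : Set where
    field
      cyc  : Cyc p
      to   : ∀ {v} → v ∈ₒ C → v ∈ₒ cyc
      from : ∀ {v} → v ∈ₒ cyc → v ∈ₒ C

  reverse-cyc : ∀ {u} → (C : Cyc u) → Rotation C u
  reverse-cyc C = record
    { cyc = record { arc = R.path ; u~a = ~-sym z~u ; z~u = ~-sym u~a ; a≢z = ≢-sym a≢z
                   ; only = λ m → swap ∘ only (R.from m) ; u∉ = u∉ ∘ R.from }
    ; to = map₂ R.to ; from = map₂ R.from }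
    where
    open Cyc C hiding (arc)
    module R = Reversed (reversed (arc C))

  rotate-first : ∀ {u} (C : Cyc u) → Rotation C (Cyc.a C)
  rotate-first {u} C = record
    { cyc = record
      { arc = J.path ; u~a = x~b ; z~u = u~a ; a≢z = ∈∉⇒≢ (sub (here refl)) u∉
      ; only = λ m a~v → case J.from m of λ { (inj₁ n) → inj₁ (U.only n a~v) ; (inj₂ (here e)) → inj₂ e }
      ; u∉ = λ m → case J.from m of λ { (inj₁ n) → fresh n refl ; (inj₂ (here refl)) → u∉ (here refl) } }
    ; to = λ { (inj₁ refl) → inj₂ (J.right (here refl)) ; (inj₂ m) → map₂ J.left (U.from m) }
    ; from = λ { (inj₁ refl) → inj₂ (here refl)
               ; (inj₂ m) → case J.from m of λ { (inj₁ n) → inj₂ (sub n) ; (inj₂ (here e)) → inj₁ e } } }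
    where
    open Cyc C hiding (arc)
    module U = Uncons (uncons (arc C) a≢z)
    open U using (tail; x~b; sub; fresh)
    cross : ∀ {p q} → p ∈ₚ tail → q ∈ₚ ⟨ u ⟩ → (p ≡ z × q ≡ u) ⊎ Far p q
    cross {p} m (here refl) with u ~? p
    ... | no u≁p = inj₂ ((λ { refl → u∉ (sub m) }) , u≁p ∘ ~-sym)
    ... | yes u~p with only (sub m) u~p
    ...   | inj₁ refl = contradiction refl (fresh m)
    ...   | inj₂ e    = inj₁ (e , refl)
    module J = Joined (join tail z~u ⟨ u ⟩ cross)

  _⊙_ : ∀ {u p q} {C : Cyc u} (ρ : Rotation C p) → Rotation (Rotation.cyc ρ) q → Rotation C q
  ρ ⊙ σ = record { cyc = Rotation.cyc σ ; to = Rotation.to σ ∘ Rotation.to ρ ; from = Rotation.from ρ ∘ Rotation.from σ }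

  split-both : ∀ {x y p} {π : IPath x y} → Split π p → Split (Reversed.path (reversed π)) p
  split-both {π = π} s = record
    { pre = S.path ; suf = P.path ; pre⊆ = R.to ∘ suf⊆ ∘ S.from ; suf⊆ = R.to ∘ pre⊆ ∘ P.from
    ; cover = λ m → case cover (R.from m) of λ { (inj₁ k) → inj₂ (P.to k) ; (inj₂ k) → inj₁ (S.to k) }
    ; cross = λ k l → case cross (P.from l) (S.from k) of λ
        { (inj₁ e) → inj₂ (inj₁ e) ; (inj₂ (inj₁ e)) → inj₁ e ; (inj₂ (inj₂ f)) → inj₂ (inj₂ (far-sym f)) } }
    where
    open Split s
    module R = Reversed (reversed π)
    module P = Reversed (reversed pre)
    module S = Reversed (reversed suf)

  split-meet : ∀ {x y p v} {π : IPath x y} (s : Split π p) → v ∈ₚ Split.pre s → v ∈ₚ Split.suf s → v ≡ p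
  split-meet s m n with Split.cross s m n
  ... | inj₁ e = e
  ... | inj₂ (inj₁ e) = e
  ... | inj₂ (inj₂ f) = contradiction refl (proj₁ f)

  abstract
    rotate : ∀ {u p} (C : Cyc u) → p ∈ₒ C → Rotation C p
    rotate {u} C (inj₁ refl) = record { cyc = C ; to = id ; from = id }
    rotate {u} {p} C (inj₂ p∈) with p ≟ Cyc.a C | p ≟ Cyc.z C
    ... | yes refl | _        = rotate-first C
    ... | no _     | yes refl = reverse-cyc C ⊙ rotate-first _
    -- From `p` the new arc runs through the rest of the old one, then `u`, then the part before
    -- `p`.
    ... | no p≢a   | no p≢z   = record
      { cyc = record
        { arc = J₂.path ; u~a = U.x~b ; z~u = I.b~y
        ; a≢z = λ e → U.fresh (here refl) (split-meet s (I.sub (subst (_∈ₚ I.init) (sym e) (end∈ I.init))) (U.sub (here refl)))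
        ; only = λ m a → case J₂.from m of λ
            { (inj₁ n) → case J₁.from n of λ
                { (inj₁ t) → inj₁ (U.only t a)
                ; (inj₂ (here refl)) → case only p∈ (~-sym a) of λ { (inj₁ e) → contradiction e p≢a ; (inj₂ e) → contradiction e p≢z } }
            ; (inj₂ n) → inj₂ (I.only n (~-sym a)) }
        ; u∉ = λ m → case J₂.from m of λ
            { (inj₁ n) → case J₁.from n of λ { (inj₁ t) → U.fresh t refl ; (inj₂ (here refl)) → u∉ p∈ }
            ; (inj₂ n) → I.fresh n refl } }
      ; to = λ { (inj₁ refl) → inj₂ (J₂.left (J₁.right (here refl)))
               ; (inj₂ m) → case cover m of λ
                   { (inj₁ n) → map₂ J₂.right (I.from n) ; (inj₂ n) → map₂ (J₂.left ∘ J₁.left) (U.from n) } }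
      ; from = λ { (inj₁ refl) → inj₂ p∈
                 ; (inj₂ m) → case J₂.from m of λ
                   { (inj₁ n) → case J₁.from n of λ { (inj₁ t) → inj₂ (suf⊆ (U.sub t)) ; (inj₂ (here e)) → inj₁ e }
                   ; (inj₂ n) → inj₂ (pre⊆ (I.sub n)) } } }
      where
      open Cyc C hiding (arc)
      s : Split (arc C) p
      s = split (arc C) p∈
      open Split s
      module I = Unsnoc (unsnoc pre (≢-sym p≢a))
      module U = Uncons (uncons suf p≢z)
      cross₁ : ∀ {v w} → v ∈ₚ U.tail → w ∈ₚ ⟨ u ⟩ → (v ≡ z × w ≡ u) ⊎ Far v w
      cross₁ {v} m (here refl) with u ~? v
      ... | no u≁v = inj₂ ((λ { refl → u∉ (suf⊆ (U.sub m)) }) , u≁v ∘ ~-sym)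
      ... | yes u~v with only (suf⊆ (U.sub m)) u~v
      ...   | inj₁ refl = contradiction (split-meet s (here refl) (U.sub m)) (U.fresh m)
      ...   | inj₂ e    = inj₁ (e , refl)
      module J₁ = Joined (join U.tail z~u ⟨ u ⟩ cross₁)
      cross₂ : ∀ {v w} → v ∈ₚ J₁.path → w ∈ₚ I.init → (v ≡ u × w ≡ a) ⊎ Far v w
      cross₂ {v} {w} m n with J₁.from m
      ... | inj₁ t with cross (I.sub n) (U.sub t)
      ...   | inj₁ e = contradiction e (I.fresh n)
      ...   | inj₂ (inj₁ e) = contradiction e (U.fresh t)
      ...   | inj₂ (inj₂ f) = inj₂ (far-sym f)
      cross₂ {v} {w} m n | inj₂ (here refl) with u ~? w
      ... | no u≁w = inj₂ ((λ { refl → u∉ (pre⊆ (I.sub n)) }) , u≁w)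
      ... | yes u~w with only (pre⊆ (I.sub n)) u~w
      ...   | inj₁ e = inj₁ (refl , e)
      ...   | inj₂ refl = contradiction (split-meet s (I.sub n) (end∈ suf)) (I.fresh n)
      module J₂ = Joined (join J₁.path u~a I.init cross₂)

  rest-pos : ∀ {x y} (π : IPath x y) → x ≢ y → 1 ≤ length (rest π)
  rest-pos (ipath []) x≢y = contradiction refl x≢y
  rest-pos (ipath (_ ∷ _)) _ = s≤s z≤n

  loop : ∀ {x y v} (π : IPath x y) → v ∈ₚ π → v ≢ x → x ≢ y
  loop (ipath [])      (here e)  v≢x = contradiction e v≢x
  loop (ipath (a ∷ π)) _ _ refl = induced-∉ (a ∷ π) (induced-end π)

  -- The two pieces of `π` on either side of its edge `x y`.
  record Gap {a b} (π : IPath a b) (x y : Vertex) : Set where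
    field
      α     : IPath a x
      β     : IPath y b
      x~y   : x ~ y
      α⊆    : ∀ {v} → v ∈ₚ α → v ∈ₚ π
      β⊆    : ∀ {v} → v ∈ₚ β → v ∈ₚ π
      across : ∀ {p q} → p ∈ₚ α → q ∈ₚ β → (p ≡ x × q ≡ y) ⊎ Far p q

    apart : ∀ {v} → v ∈ₚ α → v ∉ₚ β
    apart m n with across m n
    ... | inj₁ (refl , e) = ~⇒≢ x~y e
    ... | inj₂ f = proj₁ f refl

  loop-end : ∀ {x y v} (π : IPath x y) → v ∈ₚ π → v ≢ y → x ≢ y
  loop-end (ipath [])      (here e) v≢y = contradiction e v≢y
  loop-end (ipath (a ∷ π)) _ _ refl = induced-∉ (a ∷ π) (induced-end π)

  gap : ∀ {a b} (π : IPath a b) {x y} → x ∈ₚ π → y ∈ₚ π → x ~ y → Gap π x y ⊎ Gap π y x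
  gap π {x} {y} x∈ y∈ x~y = [ before , after ] (cover y∈)
    where
    open Split (split π x∈) renaming (cross to cross′)
    after : y ∈ₚ suf → Gap π x y ⊎ Gap π y x
    after y∈suf = inj₁ (subst (Gap π x) b≡y record
      { α = pre ; β = U.tail ; x~y = U.x~b ; α⊆ = pre⊆ ; β⊆ = suf⊆ ∘ U.sub
      ; across = λ p∈ q∈ → case cross′ p∈ (U.sub q∈) of λ
          { (inj₁ refl) → case U.b ≟ _ of λ
              { (yes e) → inj₁ (refl , sym e)
              ; (no ne) → inj₂ (≢-sym (U.fresh q∈) , λ a → ne (sym (U.only q∈ a))) }
          ; (inj₂ (inj₁ e)) → contradiction e (U.fresh q∈)
          ; (inj₂ (inj₂ f)) → inj₂ f } })
      where
      module U = Uncons (uncons suf (loop suf y∈suf (≢-sym (~⇒≢ x~y))))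
      b≡y : U.b ≡ y
      b≡y = [ (λ e → contradiction (sym e) (~⇒≢ x~y)) , (λ n → sym (U.only n x~y)) ] (U.from y∈suf)
    before : y ∈ₚ pre → Gap π x y ⊎ Gap π y x
    before y∈pre = inj₂ (subst (λ z → Gap π z x) b≡y record
      { α = U.init ; β = suf ; x~y = U.b~y ; α⊆ = pre⊆ ∘ U.sub ; β⊆ = suf⊆
      ; across = λ p∈ q∈ → case cross′ (U.sub p∈) q∈ of λ
          { (inj₁ e) → contradiction e (U.fresh p∈)
          ; (inj₂ (inj₁ refl)) → case U.b ≟ _ of λ
              { (yes e) → inj₁ (sym e , refl)
              ; (no ne) → inj₂ (U.fresh p∈ , λ a → ne (sym (U.only p∈ a))) }
          ; (inj₂ (inj₂ f)) → inj₂ f } })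
      where
      module U = Unsnoc (unsnoc pre (loop-end pre y∈pre (≢-sym (~⇒≢ x~y))))
      b≡y : U.b ≡ y
      b≡y = [ (λ e → contradiction (sym e) (~⇒≢ x~y)) , (λ n → sym (U.only n (~-sym x~y))) ] (U.from y∈pre)

-- Spanning paths, Hamiltonian cycles and cuts.

module Spanning (G : Graph) where
  open Configurations G public

  -- Paths that may have chords, as Hamiltonian cycles require.
  data Linked : Vertex → List Vertex → Vertex → Set where
    []  : ∀ {x} → Linked x [] x
    _∷_ : ∀ {x y ys z} → x ~ y × x ∉ y ∷ ys → Linked y ys z → Linked x (y ∷ ys) z

  linked-end : ∀ {x xs y} → Linked x xs y → y ∈ x ∷ xs
  linked-end []      = here refl
  linked-end (_ ∷ π) = there (linked-end π)

  linked-loop : ∀ {x xs} → Linked x xs x → xs ≡ []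
  linked-loop []             = refl
  linked-loop ((_ , x∉) ∷ π) = contradiction (linked-end π) x∉

  join-linked : ∀ {x xs y w ws z} → Linked x xs y → y ~ w → Linked w ws z →
                (∀ {p} → p ∈ x ∷ xs → p ∉ w ∷ ws) → Linked x (xs ++ w ∷ ws) z
  join-linked [] y~w ρ disjoint = (y~w , disjoint (here refl)) ∷ ρ
  join-linked {x} {y ∷ ys} ((a , x∉) ∷ π) y~w ρ disjoint =
    (a , [ x∉ , disjoint (here refl) ] ∘ ∈-++⁻ (y ∷ ys)) ∷ join-linked π y~w ρ (disjoint ∘ there)

  record ReverseLinked (x : Vertex) (xs : List Vertex) (y : Vertex) : Set where
    field
      {ys}   : List Vertex
      linked : Linked y ys x
      to     : ∀ {v} → v ∈ x ∷ xs → v ∈ y ∷ ys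
      from   : ∀ {v} → v ∈ y ∷ ys → v ∈ x ∷ xs

  reverse-linked : ∀ {x xs y} → Linked x xs y → ReverseLinked x xs y
  reverse-linked [] = record { linked = [] ; to = id ; from = id }
  reverse-linked {x} {_ ∷ _} {y} ((a , x∉) ∷ π) = record
    { linked = join-linked R.linked (~-sym a) [] (λ { m (here refl) → x∉ (R.from m) })
    ; to     = λ { (here refl) → ∈-++⁺ʳ (y ∷ R.ys) (here refl) ; (there m) → ∈-++⁺ˡ (R.to m) }
    ; from   = λ m → case ∈-++⁻ (y ∷ R.ys) m of λ { (inj₁ n) → there (R.from n) ; (inj₂ (here e)) → here e } }
    where module R = ReverseLinked (reverse-linked π)

  record SplitLinked (x : Vertex) (xs : List Vertex) (y u : Vertex) : Set where
    field
      {p}      : Vertex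
      {as bs}  : List Vertex
      pre      : Linked x as p
      p~u      : p ~ u
      suf      : Linked u bs y
      eq       : xs ≡ as ++ u ∷ bs
      disjoint : ∀ {v} → v ∈ x ∷ as → v ∉ u ∷ bs

    cover : ∀ {v} → v ∈ x ∷ xs → v ∈ x ∷ as ⊎ v ∈ u ∷ bs
    cover m = ∈-++⁻ (x ∷ as) (subst (λ l → _ ∈ x ∷ l) eq m)

    pre⊆ : ∀ {v} → v ∈ x ∷ as → v ∈ x ∷ xs
    pre⊆ m = subst (λ l → _ ∈ x ∷ l) (sym eq) (∈-++⁺ˡ m)

    suf⊆ : ∀ {v} → v ∈ u ∷ bs → v ∈ x ∷ xs
    suf⊆ m = subst (λ l → _ ∈ x ∷ l) (sym eq) (∈-++⁺ʳ (x ∷ as) m)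

  split-linked : ∀ {x xs y u} → Linked x xs y → u ∈ xs → SplitLinked x xs y u
  split-linked ((a , x∉) ∷ π) (here refl) =
    record { pre = [] ; p~u = a ; suf = π ; eq = refl ; disjoint = λ { (here refl) → x∉ } }
  split-linked {x} ((a , x∉) ∷ π) (there m) = record
    { pre = (a , x∉ ∘ S.pre⊆) ∷ S.pre ; p~u = S.p~u ; suf = S.suf ; eq = cong (_ ∷_) S.eq
    ; disjoint = λ { (here refl) → x∉ ∘ S.suf⊆ ; (there n) → S.disjoint n } }
    where module S = SplitLinked (split-linked π m)

  record Span (A : Vertex → Set) (u v : Vertex) : Set where
    field
      {list}   : List Vertex
      linked   : Linked u list v
      sound    : ∀ {w} → w ∈ u ∷ list → A w
      complete : ∀ {w} → A w → w ∈ u ∷ list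

  span-reverse : ∀ {A u v} → Span A u v → Span A v u
  span-reverse s = record { linked = R.linked ; sound = sound ∘ R.from ; complete = R.to ∘ complete }
    where
    open Span s
    module R = ReverseLinked (reverse-linked linked)

  span-cong : ∀ {A B : Vertex → Set} {u v} → (∀ {w} → A w → B w) → (∀ {w} → B w → A w) → Span A u v → Span B u v
  span-cong f g s = record { linked = linked ; sound = f ∘ sound ; complete = complete ∘ g }
    where open Span s

  span-join : ∀ {A B : Vertex → Set} {u v w x} → Span A u v → v ~ w → Span B w x → (∀ {p} → A p → ¬ B p) →
              Span (λ p → A p ⊎ B p) u x
  span-join {u = u} s v~w t disjoint = record
    { linked = join-linked S.linked v~w T.linked (λ m n → disjoint (S.sound m) (T.sound n))
    ; sound = [ inj₁ ∘ S.sound , inj₂ ∘ T.sound ] ∘ ∈-++⁻ (u ∷ S.list)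
    ; complete = [ ∈-++⁺ˡ ∘ S.complete , ∈-++⁺ʳ (u ∷ S.list) ∘ T.complete ] }
    where
    module S = Span s
    module T = Span t

  span-single : ∀ v → Span (_≡ v) v v
  span-single v = record { linked = [] ; sound = λ { (here e) → e } ; complete = here }

  induced-linked : ∀ {x xs y} → Induced x xs y → Linked x xs y
  induced-linked []      = []
  induced-linked (a ∷ π) = (proj₁ a , induced-∉ (a ∷ π)) ∷ induced-linked π

  span-path : ∀ {x y} (π : IPath x y) → Span (_∈ₚ π) x y
  span-path π = record { linked = induced-linked (induced π) ; sound = id ; complete = id }

  Three : (Vertex → Set) → Set
  Three S = ∃[ a ] ∃[ b ] ∃[ c ] S a × S b × S c × a ≢ b × a ≢ c × b ≢ c

  -- A spanning path of two vertices would be closed up by its own edge; `three` rules this out.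
  record Ham (S : Vertex → Set) : Set where
    field
      three : Three S
      {u v} : Vertex
      span  : Span S u v
      v~u   : v ~ u

  record Rotated (S : Vertex → Set) (u : Vertex) : Set where
    field
      {v}  : Vertex
      span : Span S u v
      v~u  : v ~ u

  rotate-ham : ∀ {S u} → Ham S → S u → Rotated S u
  rotate-ham {u = u} h s with Span.complete (Ham.span h) s
  ... | here refl = record { span = Ham.span h ; v~u = Ham.v~u h }
  ... | there m   = record
    { span = record
      { linked = join-linked suf (Ham.v~u h) pre (λ k l → disjoint l k)
      ; sound = λ n → [ sound ∘ suf⊆ , sound ∘ pre⊆ ] (∈-++⁻ (u ∷ bs) n)
      ; complete = λ t → [ ∈-++⁺ʳ (u ∷ bs) , ∈-++⁺ˡ ] (cover (complete t)) }
    ; v~u = p~u }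
    where
    open Span (Ham.span h)
    open SplitLinked (split-linked linked m)

  -- If a set X avoiding k can be left only towards m, or from x to k, then a closed path leaves X
  -- at least twice but passes m once, so it contains the edge between x and k.
  cut-edge : {B : Set} (X : Vertex → Set) → ∀ {k zs t} → Linked k zs t → t ~ k → ¬ X k →
             ∀ {x m} → x ∈ zs → X x → m ≢ k →
             (∀ {p q} → X p → p ~ q → q ∈ k ∷ zs → X q ⊎ q ≡ m ⊎ (p ≡ x × q ≡ k) ⊎ B) →
             (∃[ bs ] zs ≡ x ∷ bs) ⊎ t ≡ x ⊎ B
  cut-edge {B} X {k} {zs} {t} π t~k k∉X {x} {m} x∈ x∈X m≢k leave = combine (scan₁ forward fw⊆) (scan₁ backward bw⊆)
    where
    open SplitLinked (split-linked π x∈)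
    module R = ReverseLinked (reverse-linked pre)

    scan : ∀ {p ys} → Linked p ys k → X p → x ∉ p ∷ ys → (∀ {q} → q ∈ ys → q ∈ k ∷ zs) → m ∈ ys ⊎ B
    scan [] p∈X _ _ = contradiction p∈X k∉X
    scan ((a , _) ∷ π) p∈X x∉ ⊆ with leave p∈X a (⊆ (here refl))
    ... | inj₁ q∈X = map₁ there (scan π q∈X (x∉ ∘ there) (⊆ ∘ there))
    ... | inj₂ (inj₁ e) = inj₁ (here (sym e))
    ... | inj₂ (inj₂ (inj₁ (e , _))) = contradiction (here (sym e)) x∉
    ... | inj₂ (inj₂ (inj₂ b)) = inj₂ b

    scan₁ : ∀ {ys} → Linked x ys k → (∀ {q} → q ∈ ys → q ∈ k ∷ zs) → m ∈ ys ⊎ (∃[ bs ] ys ≡ k ∷ bs) ⊎ B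
    scan₁ [] _ = contradiction x∈X k∉X
    scan₁ ((a , x∉) ∷ π) ⊆ with leave x∈X a (⊆ (here refl))
    ... | inj₁ q∈X = [ inj₁ ∘ there , inj₂ ∘ inj₂ ] (scan π q∈X x∉ (⊆ ∘ there))
    ... | inj₂ (inj₁ e) = inj₁ (here (sym e))
    ... | inj₂ (inj₂ (inj₁ (_ , refl))) = inj₂ (inj₁ (_ , refl))
    ... | inj₂ (inj₂ (inj₂ b)) = inj₂ (inj₂ b)

    forward : Linked x (bs ++ k ∷ []) k
    forward = join-linked suf t~k [] (λ { n (here refl) → disjoint (here refl) n })
    fw⊆ : ∀ {q} → q ∈ bs ++ k ∷ [] → q ∈ k ∷ zs
    fw⊆ n = [ suf⊆ ∘ there , (λ { (here e) → here e }) ] (∈-++⁻ bs n)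
    backward : Linked x (p ∷ R.ys) k
    backward = (~-sym p~u , λ n → disjoint (R.from n) (here refl)) ∷ R.linked
    bw⊆ : ∀ {q} → q ∈ p ∷ R.ys → q ∈ k ∷ zs
    bw⊆ = pre⊆ ∘ R.from

    combine : m ∈ bs ++ k ∷ [] ⊎ (∃[ cs ] bs ++ k ∷ [] ≡ k ∷ cs) ⊎ B →
              m ∈ p ∷ R.ys ⊎ (∃[ cs ] p ∷ R.ys ≡ k ∷ cs) ⊎ B → (∃[ bs ] zs ≡ x ∷ bs) ⊎ t ≡ x ⊎ B
    combine (inj₂ (inj₂ b)) _ = inj₂ (inj₂ b)
    combine _ (inj₂ (inj₂ b)) = inj₂ (inj₂ b)
    combine _ (inj₂ (inj₁ (_ , e))) =
      inj₁ (bs , trans eq (cong (_++ x ∷ bs) (linked-loop (subst (Linked k as) (∷-injectiveˡ e) pre))))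
    combine (inj₂ (inj₁ (cs , e))) _ = inj₂ (inj₁ (last suf (λ n → disjoint (here refl) n) e))
      where
      last : ∀ {bs} → Linked x bs t → k ∉ x ∷ bs → bs ++ k ∷ [] ≡ k ∷ cs → t ≡ x
      last [] _ _ = refl
      last (_ ∷ _) k∉ refl = contradiction (there (here refl)) k∉
    combine (inj₁ n) (inj₁ l) with ∈-++⁻ bs n
    ... | inj₁ n′ = contradiction (there n′) (disjoint (R.from l))
    ... | inj₂ (here e) = contradiction e m≢k

  -- The cycle is rotated to start at `k`, so the edge forced by `cut-edge` is its first step or its
  -- closing edge; leaving it out gives the spanning path. `B` collects the exits from `X` that end
  -- the search in another way.
  cut-span : ∀ {B : Set} {S : Vertex → Set} → Ham S → (X : Vertex → Set) → ∀ {k x m} → S k → S x →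
             ¬ X k → X x → m ≢ k →
             (∀ {p q} → X p → p ~ q → S q → X q ⊎ q ≡ m ⊎ (p ≡ x × q ≡ k) ⊎ B) → Span S k x ⊎ B
  cut-span {S = S} h X {k} {x} k∈ x∈ k∉X x∈X m≢k leave
    with cut-edge X linked v~u k∉X x∈list x∈X m≢k (λ p a q → leave p a (sound q))
    where
    open Rotated (rotate-ham h k∈)
    open Span span
    x∈list : x ∈ list
    x∈list with complete x∈
    ... | here refl = contradiction x∈X k∉X
    ... | there m   = m
  ... | inj₁ (bs , e) = inj₁ (turn (rotate-ham h k∈) e)
    where
    -- If the forced edge is the first step, go round the other way: from `x` through the list to
    -- its end, over the closing edge to `k`, and reverse.
    turn : ∀ {bs} (r : Rotated S k) → Span.list (Rotated.span r) ≡ x ∷ bs → Span S k x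
    turn {bs} record { span = record { linked = (a , k∉) ∷ π ; sound = sound ; complete = complete } ; v~u = v~u } refl =
      span-reverse record
        { linked = join-linked π v~u [] (λ { m (here refl) → k∉ m })
        ; sound = λ m → [ sound ∘ there , (λ { (here e) → sound (here e) }) ] (∈-++⁻ _ m)
        ; complete = λ s → case complete s of λ { (here e) → ∈-++⁺ʳ (x ∷ bs) (here e) ; (there m) → ∈-++⁺ˡ m } }
  ... | inj₂ (inj₁ e) = inj₁ (subst (Span S k) e (Rotated.span (rotate-ham h k∈)))
  ... | inj₂ (inj₂ b) = inj₂ b

  infixl 6 _∖_
  _∖_ : (Vertex → Set) → Vertex → Vertex → Set
  (S ∖ w) v = S v × v ≢ w

  -- That `S` itself is connected follows by deleting a vertex other than the two to be joined.
  TwoConnected : (Vertex → Set) → Set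
  TwoConnected S = Three S × (∀ w {u v} → (S ∖ w) u → (S ∖ w) v → Walk (S ∖ w) u v)

  confined : ∀ {S X : Vertex → Set} → (∀ {p q} → X p → p ~ q → S q → X q) → ∀ {u v} → Walk S u v → X u → X v
  confined closed (stop _) x = x
  confined closed (step _ a ω) x = confined closed ω (closed x a (walk-start ω))

-- Bad is what a contradiction with the hypotheses amounts to: either an absurdity or a
-- configuration spanning G. Deriving it in place of ⊥ keeps the search constructive.
record Setting (G : Graph) : Set₁ where
  open Spanning G
  field
    Bad       : Set
    wheel     : ∀ {u} (C : Cyc u) {h} → ¬ h ∈ₒ C →
                ∀ {p q r} → p ∈ₒ C → q ∈ₒ C → r ∈ₒ C → p ≢ q → p ≢ r → q ≢ r →
                h ~ p → h ~ q → h ~ r → Bad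
    found     : Config → Bad
    connected : TwoConnected (λ _ → Unit)
    minimal   : ∀ {S} → Decidable₁ S → TwoConnected S → (∃ λ v → ¬ S v) → Ham S
    spanning  : Ham (λ _ → Unit) → Bad

-- Vertices and tails attached to an induced cycle.

module Search (G : Graph) (setting : Setting G) where
  open Spanning G public
  open Setting setting public

  theta : ∀ {a b} (S : Fin 3 → Vertex → Set) → a ≢ b → (∀ i → Ear (S i) a b) →
          (∀ i j → i ≢ j → ∀ u v → S i u → S j v → Far u v) →
          (∀ i → ¬ S i a) → (∀ i → ¬ S i b) → Bad
  theta {a} {b} S a≢b e apart a∉ b∉ = found (fromEars (λ _ → a) (λ _ → b) e apart
    (λ _ → a∉) (λ _ → b∉) (λ _ _ → a≢b) (inj₁ λ _ _ → refl) (inj₁ λ _ _ → refl) (λ _ _ _ → inj₂ (inj₁ λ _ _ → refl)))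

  apart3 : {S : Fin 3 → Vertex → Set} →
           (∀ u v → S 0F u → S 1F v → Far u v) → (∀ u v → S 0F u → S 2F v → Far u v) →
           (∀ u v → S 1F u → S 2F v → Far u v) → ∀ i j → i ≢ j → ∀ u v → S i u → S j v → Far u v
  apart3 {S} = distinct3 {λ i j → ∀ u v → S i u → S j v → Far u v} (λ i j f u v s t → far-sym (f v u t s))

  triangle3 : {k : Fin 3 → Vertex} {S : Fin 3 → Vertex → Set} →
    (let R = λ i j → k i ~ k j × (∀ v → S j v → ¬ k i ~ v) × (∀ v → S i v → ¬ k j ~ v)) →
    R 0F 1F → R 0F 2F → R 1F 2F → ∀ i j → i ≢ j → k i ~ k j × (∀ v → S j v → ¬ k i ~ v)
  triangle3 {k} {S} a b c i j i≢j =
    let (e , f , _) = distinct3 {λ i j → k i ~ k j × (∀ v → S j v → ¬ k i ~ v) × (∀ v → S i v → ¬ k j ~ v)}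
                        (λ { _ _ (e , f , g) → ~-sym e , g , f }) a b c i j i≢j in e , f

  off-far : ∀ {u} {C : Cyc u} {h v} → ¬ h ∈ₒ C → v ∈ₒ C → ¬ h ~ v → Far h v
  off-far h∉ m h≁v = (λ { refl → h∉ m }) , h≁v

  private
    chord-theta : ∀ {p} (C : Cyc p) {h q} → ¬ h ∈ₒ C → q ∈ₚ arc C → ¬ p ~ q → h ~ p → h ~ q →
                  (∀ {z} → z ∈ₚ arc C → h ~ z → z ≡ q) → Bad
    chord-theta {p} C {h} {q} h∉ q∈ p≁q h~p h~q unique =
      theta S (≢-sym (∈∉⇒≢ q∈ u∉))
        (fin3 (ear (stop refl) (~-sym h~p) h~q)
              (ear (along I.init id) u~a I.b~y)
              (ear (walk-rev (along U.tail id)) (~-sym z~u) (~-sym U.x~b)))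
        (apart3 {S} (λ { _ v refl m → off (pre⊆ (I.sub m)) (I.fresh m) })
                    (λ { _ v refl m → off (suf⊆ (U.sub m)) (U.fresh m) })
                    (λ u v m n → case cross (I.sub m) (U.sub n) of λ
                       { (inj₁ e) → contradiction e (I.fresh m)
                       ; (inj₂ (inj₁ e)) → contradiction e (U.fresh n)
                       ; (inj₂ (inj₂ f)) → f }))
        (fin3 (λ { refl → h∉ (inj₁ refl) }) (u∉ ∘ pre⊆ ∘ I.sub) (u∉ ∘ suf⊆ ∘ U.sub))
        (fin3 (λ { refl → h∉ (inj₂ q∈) }) (λ m → I.fresh m refl) (λ m → U.fresh m refl))
      where
      open Cyc C hiding (arc)
      open Split (split (arc C) q∈)
      a≢q : a ≢ q
      a≢q refl = p≁q u~a
      q≢z : q ≢ z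
      q≢z refl = p≁q (~-sym z~u)
      module I = Unsnoc (unsnoc pre a≢q)
      module U = Uncons (uncons suf q≢z)
      S : Fin 3 → Vertex → Set
      S 0F v = v ≡ h
      S 1F v = v ∈ₚ I.init
      S 2F v = v ∈ₚ U.tail
      off : ∀ {v} → v ∈ₚ arc C → v ≢ q → Far h v
      off m v≢q = off-far {C = C} h∉ (inj₂ m) (v≢q ∘ unique m)

  -- A third neighbour makes `h` the hub of a wheel. Otherwise `h` and the two arcs of `C` between
  -- `p` and `q` form a theta.
  two-neighbours′ : ∀ {p} (C : Cyc p) {h q} → ¬ h ∈ₒ C → q ∈ₚ arc C → ¬ p ~ q → h ~ p → h ~ q → Bad
  two-neighbours′ C {h} {q} h∉ q∈ p≁q h~p h~q
    with any? (λ z → (z ∈ₚ? arc C) ×-dec (h ~? z) ×-dec ¬? (z ≟ q))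
  ... | yes (z , z∈ , h~z , z≢q) = wheel C h∉ (inj₁ refl) (inj₂ q∈) (inj₂ z∈)
          (≢-sym (∈∉⇒≢ q∈ (Cyc.u∉ C))) (≢-sym (∈∉⇒≢ z∈ (Cyc.u∉ C))) (≢-sym z≢q) h~p h~q h~z
  ... | no ¬z = chord-theta C h∉ q∈ p≁q h~p h~q
          (λ {z} z∈ h~z → decidable-stable (z ≟ q) (λ z≢q → ¬z (z , z∈ , h~z , z≢q)))

  two-neighbours : ∀ {u} (C : Cyc u) {h p q} → ¬ h ∈ₒ C → p ∈ₒ C → q ∈ₒ C → Far p q → h ~ p → h ~ q → Bad
  two-neighbours C h∉ p∈ q∈ (p≢q , p≁q) with rotate C p∈
  ... | ρ with Rotation.to ρ q∈
  ...   | inj₁ e = contradiction (sym e) p≢q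
  ...   | inj₂ m = two-neighbours′ (Rotation.cyc ρ) (h∉ ∘ Rotation.from ρ) m p≁q

  -- A path that leaves `C` at `u` and can come back to the rest of `C` from its last vertex only.
  record Tail {u} (C : Cyc u) : Set where
    field
      {r s} : Vertex
      path  : IPath r s
      off   : ∀ {v} → v ∈ₚ path → ¬ v ∈ₒ C
      u~r   : u ~ r
      onlyu : ∀ {v} → v ∈ₚ path → u ~ v → v ≡ r
      onlys : ∀ {v w} → v ∈ₚ path → w ∈ₚ arc C → v ~ w → v ≡ s

  module _ {u : Vertex} (C : Cyc u) (T : Tail C) where
    open Cyc C hiding (arc)
    open Tail T

    -- The cycle through u, the tail and σ has the two nonadjacent neighbours u and s of h.
    hub : r ≢ s → ∀ {x y} (σ : IPath x y) → (∀ {v} → v ∈ₚ σ → v ∈ₚ arc C) → s ~ x →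
          (∀ {v} → v ∈ₚ σ → s ~ v → v ≡ x) → y ~ u → (∀ {v} → v ∈ₚ σ → u ~ v → v ≡ y) →
          ∀ {h} → h ∈ₚ arc C → h ∉ₚ σ → h ~ u → h ~ s → Bad
    hub r≢s {x} {y} σ σ⊆ s~x only-x y~u only-y {h} h∈ h∉σ h~u h~s =
      two-neighbours C′ h∉ (inj₁ refl) (inj₂ (J.left (end∈ path)))
        ((λ { refl → off (end∈ path) (inj₁ refl) }) , λ a → r≢s (sym (onlyu (end∈ path) a))) h~u h~s
      where
      cross : ∀ {v w} → v ∈ₚ path → w ∈ₚ σ → (v ≡ s × w ≡ x) ⊎ Far v w
      cross {v} {w} m n with v ~? w
      ... | no v≁w = inj₂ (off-far {C = C} (off m) (inj₂ (σ⊆ n)) v≁w)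
      ... | yes v~w with onlys m (σ⊆ n) v~w
      ...   | refl = inj₁ (refl , only-x n v~w)
      module J = Joined (join path s~x σ cross)
      C′ : Cyc u
      C′ = record
        { arc = J.path ; u~a = u~r ; z~u = y~u ; a≢z = λ { refl → off (start∈ path) (inj₂ (σ⊆ (end∈ σ))) }
        ; only = λ m a → case J.from m of λ { (inj₁ n) → inj₁ (onlyu n a) ; (inj₂ n) → inj₂ (only-y n a) }
        ; u∉ = λ m → case J.from m of λ { (inj₁ n) → off n (inj₁ refl) ; (inj₂ n) → u∉ (σ⊆ n) } }
      h∉ : ¬ h ∈ₒ C′
      h∉ (inj₁ e) = ~⇒≢ h~u e
      h∉ (inj₂ m) with J.from m
      ... | inj₁ n = off n (inj₂ h∈)
      ... | inj₂ n = h∉σ n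

    -- If `u` sees neither of the two consecutive neighbours `p` and `p′` of `s`, the triangle
    -- `s p p′` and its three paths to `u` form a pyramid. Otherwise one of `p`, `p′` sees both `u`
    -- and `s` while lying off the cycle through `u`, the tail and the other one, and `hub` applies.
    ordered : r ≢ s → ∀ {p} (sp : Split (arc C) p) → p ∈ₚ arc C → (U : Uncons (Split.suf sp)) →
              s ~ p → s ~ Uncons.b U → (∀ {w} → w ∈ₚ arc C → s ~ w → w ≡ p ⊎ w ≡ Uncons.b U) → Bad
    ordered r≢s {p} sp p∈ U s~p s~p′ unique = go (p ~? u) (p′ ~? u)
      where
      open Split sp
      module U = Uncons U
      p′ = U.b
      p~p′ = U.x~b
      p′∈ : p′ ∈ₚ suf
      p′∈ = U.sub (here refl)
      tail⊆ : ∀ {v} → v ∈ₚ U.tail → v ∈ₚ arc C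
      tail⊆ = suf⊆ ∘ U.sub
      a∉tail : ∀ {v} → v ∈ₚ U.tail → v ≢ a
      a∉tail m refl = U.fresh m (split-meet sp (start∈ pre) (U.sub m))
      z∉pre : ∀ {v} → v ∈ₚ pre → v ≢ z
      z∉pre m refl = U.fresh (end∈ U.tail) (split-meet sp m (end∈ suf))
      module P = Reversed (reversed pre)

      go : Dec (p ~ u) → Dec (p′ ~ u) → Bad
      go (yes p~u) _ = hub r≢s U.tail tail⊆ s~p′
        (λ m s~v → [ (λ e → contradiction e (U.fresh m)) , id ] (unique (tail⊆ m) s~v)) z~u
        (λ m u~v → [ (λ e → contradiction e (a∉tail m)) , id ] (only (tail⊆ m) u~v))
        p∈ (λ m → U.fresh m refl) p~u (~-sym s~p)
      go (no _) (yes p′~u) = hub r≢s P.path (pre⊆ ∘ P.from) s~p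
        (λ m s~v → [ id , (λ { refl → contradiction (split-meet sp (P.from m) p′∈) (U.fresh (start∈ U.tail)) }) ] (unique (pre⊆ (P.from m)) s~v))
        (~-sym u~a) (λ m u~v → [ id , (λ e → contradiction e (z∉pre (P.from m))) ] (only (pre⊆ (P.from m)) u~v))
        (suf⊆ p′∈) (λ m → contradiction (split-meet sp (P.from m) p′∈) (U.fresh (start∈ U.tail))) p′~u (~-sym s~p′)
      go (no p≁u) (no p′≁u) = found (fromEars k (λ _ → u) ears
        (apart3 {S} (λ v w m n → R-far m (pre⊆ (I.sub n)) (I.fresh n) (λ { refl → U.fresh (start∈ U.tail) (split-meet sp (I.sub n) p′∈) }))
                    (λ v w m n → R-far m (tail⊆ (T.sub n)) (U.fresh (T.sub n)) (T.fresh n))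
                    (λ v w m n → pre-tail m (T.sub n)))
        k∉ (λ _ → fin3 (λ m → off (R.sub m) (inj₁ refl)) (u∉ ∘ pre⊆ ∘ I.sub) (u∉ ∘ tail⊆ ∘ T.sub))
        (λ i j → k≢u i) (inj₂ (triangle3 {k} {S}
          (s~p , (λ v m a → [ I.fresh m , (λ { refl → U.fresh (start∈ U.tail) (split-meet sp (I.sub m) p′∈) }) ] (unique (pre⊆ (I.sub m)) a))
               , (λ v m a → R.fresh m (onlys (R.sub m) p∈ (~-sym a))))
          (s~p′ , (λ v m a → [ U.fresh (T.sub m) , T.fresh m ] (unique (tail⊆ (T.sub m)) a))
                , (λ v m a → R.fresh m (onlys (R.sub m) (tail⊆ (here refl)) (~-sym a))))
          (p~p′ , (λ v m a → T.fresh m (U.only (T.sub m) a))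
                , (λ v m a → proj₂ (pre-tail m (here refl)) (~-sym a)))
          ))
        (inj₁ λ _ _ → refl) (λ _ _ _ → inj₂ (inj₂ λ _ _ → refl)))
        where
        module R = Unsnoc (unsnoc path r≢s)
        a≢p : a ≢ p
        a≢p refl = p≁u (~-sym u~a)
        p′≢z : p′ ≢ z
        p′≢z refl = p′≁u z~u
        module I = Unsnoc (unsnoc pre a≢p)
        module T = Uncons (uncons U.tail p′≢z)
        k : Fin 3 → Vertex
        k = fin3 s p p′
        S : Fin 3 → Vertex → Set
        S 0F v = v ∈ₚ R.init
        S 1F v = v ∈ₚ I.init
        S 2F v = v ∈ₚ T.tail
        ears : ∀ i → Ear (S i) (k i) u
        ears = fin3 (ear (walk-rev (along R.init id)) (~-sym R.b~y) (~-sym u~r))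
                    (ear (walk-rev (along I.init id)) (~-sym I.b~y) (~-sym u~a))
                    (ear (along T.tail id) T.x~b z~u)
        R-far : ∀ {v w} → v ∈ₚ R.init → w ∈ₚ arc C → w ≢ p → w ≢ p′ → Far v w
        R-far m n ≢p ≢p′ = off-far {C = C} (off (R.sub m)) (inj₂ n) λ a → R.fresh m (onlys (R.sub m) n a)
        pre-tail : ∀ {v w} → v ∈ₚ I.init → w ∈ₚ U.tail → Far v w
        pre-tail m n with cross (I.sub m) (U.sub n)
        ... | inj₁ e = contradiction e (I.fresh m)
        ... | inj₂ (inj₁ e) = contradiction e (U.fresh n)
        ... | inj₂ (inj₂ f) = f
        k≢u : ∀ i → k i ≢ u
        k≢u = fin3 (λ { refl → off (end∈ path) (inj₁ refl) }) (λ { refl → u∉ p∈ }) (λ { refl → u∉ (suf⊆ p′∈) })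
        k∉ : ∀ i j → ¬ S j (k i)
        k∉ 0F 0F m = R.fresh m refl
        k∉ 0F 1F m = off (end∈ path) (inj₂ (pre⊆ (I.sub m)))
        k∉ 0F 2F m = off (end∈ path) (inj₂ (tail⊆ (T.sub m)))
        k∉ 1F 0F m = off (R.sub m) (inj₂ p∈)
        k∉ 1F 1F m = I.fresh m refl
        k∉ 1F 2F m = U.fresh (T.sub m) refl
        k∉ 2F 0F m = off (R.sub m) (inj₂ (tail⊆ (here refl)))
        k∉ 2F 1F m = proj₁ (pre-tail m (here refl)) refl
        k∉ 2F 2F m = T.fresh m refl

    ordered′ : r ≢ s → ∀ {p p′} (sp : Split (arc C) p) → p ∈ₚ arc C → p′ ∈ₚ Split.suf sp → p ~ p′ →
               s ~ p → s ~ p′ → (∀ {w} → w ∈ₚ arc C → s ~ w → w ≡ p ⊎ w ≡ p′) → Bad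
    ordered′ r≢s sp p∈ p′∈ p~p′ s~p s~p′ unique =
      ordered r≢s sp p∈ U s~p (subst (s ~_) p′≡b s~p′) (λ m a → map₂ (λ e → trans e p′≡b) (unique m a))
      where
      U = uncons (Split.suf sp) (loop (Split.suf sp) p′∈ (≢-sym (~⇒≢ p~p′)))
      p′≡b : _ ≡ Uncons.b U
      p′≡b = Uncons.only U ([ (λ e → contradiction (sym e) (~⇒≢ p~p′)) , id ] (Uncons.from U p′∈)) p~p′

  reverse-tail : ∀ {u} {C : Cyc u} → Tail C → Tail (Rotation.cyc (reverse-cyc C))
  reverse-tail {C = C} T = record
    { path = path ; off = λ m → off m ∘ Rotation.from ρ ; u~r = u~r ; onlyu = onlyu
    ; onlys = λ m → onlys m ∘ Reversed.from (reversed (arc C)) }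
    where
    open Tail T
    ρ = reverse-cyc C

  module _ {u : Vertex} (C : Cyc u) (T : Tail C) where
    open Cyc C hiding (arc)
    open Tail T

    -- A tail of one vertex is a hub seeing `u`, `p` and `p′`. For a longer tail, nonadjacent
    -- neighbours or a third one are excluded as for any vertex off `C`, which leaves two
    -- consecutive neighbours; reversing `C` puts them in order.
    tail-two : ∀ {p p′} → p ∈ₚ arc C → p′ ∈ₚ arc C → p ≢ p′ → s ~ p → s ~ p′ → Bad
    tail-two {p} {p′} p∈ p′∈ p≢p′ s~p s~p′ with r ≟ s
    ... | yes refl = wheel C (off (end∈ path)) (inj₁ refl) (inj₂ p∈) (inj₂ p′∈)
                       (≢-sym (∈∉⇒≢ p∈ u∉)) (≢-sym (∈∉⇒≢ p′∈ u∉)) p≢p′ (~-sym u~r) s~p s~p′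
    ... | no r≢s with p ~? p′
    ...   | no p≁p′ = two-neighbours C (off (end∈ path)) (inj₂ p∈) (inj₂ p′∈) (p≢p′ , p≁p′) s~p s~p′
    ...   | yes p~p′ with any? (λ w → (w ∈ₚ? arc C) ×-dec (s ~? w) ×-dec ¬? (w ≟ p) ×-dec ¬? (w ≟ p′))
    ...     | yes (w , w∈ , s~w , ≢p , ≢p′) = wheel C (off (end∈ path)) (inj₂ p∈) (inj₂ p′∈) (inj₂ w∈)
                       p≢p′ (≢-sym ≢p) (≢-sym ≢p′) s~p s~p′ s~w
    ...     | no ¬w = [ (λ m → ordered′ (Rotation.cyc (reverse-cyc C)) (reverse-tail T) r≢s (split-both (split (arc C) p∈))
                           (R.to p∈) (Reversed.to (reversed (Split.pre (split (arc C) p∈))) m) p~p′ s~p s~p′ (unique ∘ R.from))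
                      , (λ m → ordered′ C T r≢s (split (arc C) p∈) p∈ m p~p′ s~p s~p′ unique)
                      ] (Split.cover (split (arc C) p∈) p′∈)
      where
      module R = Reversed (reversed (arc C))
      unique : ∀ {w} → w ∈ₚ arc C → s ~ w → w ≡ p ⊎ w ≡ p′
      unique {w} w∈ s~w with w ≟ p | w ≟ p′
      ... | yes e | _ = inj₁ e
      ... | no _  | yes e = inj₂ e
      ... | no e  | no e′ = contradiction (w , w∈ , s~w , e , e′) ¬w

    -- If `p` is the only neighbour of `s` on the arc, the tail and the two arcs between `u` and `p`
    -- form a theta; a second neighbour is a case of `tail-two`.
    tail-far : ∀ {p} → p ∈ₚ arc C → s ~ p → ¬ u ~ p → Bad
    tail-far {p} p∈ s~p u≁p with any? (λ w → (w ∈ₚ? arc C) ×-dec (s ~? w) ×-dec ¬? (w ≟ p))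
    ... | yes (w , w∈ , s~w , w≢p) = tail-two w∈ p∈ w≢p s~w s~p
    ... | no ¬w = theta S (≢-sym (∈∉⇒≢ p∈ u∉))
        (fin3 (ear (along path id) u~r s~p)
              (ear (along I.init id) u~a I.b~y)
              (ear (walk-rev (along U.tail id)) (~-sym z~u) (~-sym U.x~b)))
        (apart3 {S} (λ v w m n → R-far m (pre⊆ (I.sub n)) (I.fresh n))
                    (λ v w m n → R-far m (suf⊆ (U.sub n)) (U.fresh n))
                    (λ v w m n → case cross (I.sub m) (U.sub n) of λ
                       { (inj₁ e) → contradiction e (I.fresh m)
                       ; (inj₂ (inj₁ e)) → contradiction e (U.fresh n)
                       ; (inj₂ (inj₂ f)) → f }))
        (fin3 (λ m → off m (inj₁ refl)) (u∉ ∘ pre⊆ ∘ I.sub) (u∉ ∘ suf⊆ ∘ U.sub))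
        (fin3 (λ m → off m (inj₂ p∈)) (λ m → I.fresh m refl) (λ m → U.fresh m refl))
      where
      open Split (split (arc C) p∈)
      a≢p : a ≢ p
      a≢p refl = u≁p u~a
      p≢z : p ≢ z
      p≢z refl = u≁p (~-sym z~u)
      module I = Unsnoc (unsnoc pre a≢p)
      module U = Uncons (uncons suf p≢z)
      S : Fin 3 → Vertex → Set
      S 0F v = v ∈ₚ path
      S 1F v = v ∈ₚ I.init
      S 2F v = v ∈ₚ U.tail
      R-far : ∀ {v w} → v ∈ₚ path → w ∈ₚ arc C → w ≢ p → Far v w
      R-far m n w≢p = off-far {C = C} (off m) (inj₂ n) λ a →
        ¬w (_ , n , subst (_~ _) (onlys m n a) a , w≢p)

-- Induced prisms and outside paths attached to a corner.

module Prisms (G : Graph) (setting : Setting G) where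
  open Search G setting public

  -- In contrast to `Config`, the paths include their ends and may be single edges; being induced,
  -- they have no chords.
  record InducedPrism : Set where
    field
      k l   : Fin 3 → Vertex
      path  : ∀ i → IPath (k i) (l i)
      k≢l   : ∀ i → k i ≢ l i
      kk    : ∀ {i j} → i ≢ j → k i ~ k j
      ll    : ∀ {i j} → i ≢ j → l i ~ l j
      cross : ∀ {i j} → i ≢ j → ∀ {p q} → p ∈ₚ path i → q ∈ₚ path j →
              (p ≡ k i × q ≡ k j) ⊎ (p ≡ l i × q ≡ l j) ⊎ Far p q

    k∈ : ∀ i → k i ∈ₚ path i
    k∈ i = start∈ (path i)

    l∈ : ∀ i → l i ∈ₚ path i
    l∈ i = end∈ (path i)

    disjoint : ∀ {i j v} → i ≢ j → v ∈ₚ path i → v ∉ₚ path j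
    disjoint i≢j m n with cross i≢j m n
    ... | inj₁ (refl , e) = ~⇒≢ (kk i≢j) e
    ... | inj₂ (inj₁ (refl , e)) = ~⇒≢ (ll i≢j) e
    ... | inj₂ (inj₂ f) = proj₁ f refl

    k-far : ∀ {i j q} → i ≢ j → q ∈ₚ path j → q ≢ k j → Far (k i) q
    k-far {i} i≢j m q≢k with cross i≢j (k∈ i) m
    ... | inj₁ (_ , e) = contradiction e q≢k
    ... | inj₂ (inj₁ (e , _)) = contradiction e (k≢l i)
    ... | inj₂ (inj₂ f) = f

    kk≢ : ∀ {i j} → i ≢ j → k i ≢ k j
    kk≢ = ~⇒≢ ∘ kk

    next : ∀ i → Uncons (path i)
    next i = uncons (path i) (k≢l i)

    m : Fin 3 → Vertex
    m i = Uncons.b (next i)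

    m∈ : ∀ i → m i ∈ₚ path i
    m∈ i = Uncons.sub (next i) (here refl)

  infix 4 _∈π_
  _∈π_ : Vertex → InducedPrism → Set
  v ∈π Q = ∃[ i ] v ∈ₚ InducedPrism.path Q i

  ∈π? : ∀ Q v → Dec (v ∈π Q)
  ∈π? Q v = any? (λ i → v ∈ₚ? InducedPrism.path Q i)

  flip : InducedPrism → InducedPrism
  flip Q = record
    { k = l ; l = k ; path = λ i → Reversed.path (reversed (path i)) ; k≢l = λ i → ≢-sym (k≢l i) ; kk = ll ; ll = kk
    ; cross = λ {i} {j} i≢j p∈ q∈ → case cross i≢j (Reversed.from (reversed (path i)) p∈) (Reversed.from (reversed (path j)) q∈) of
        λ { (inj₁ e) → inj₂ (inj₁ e) ; (inj₂ (inj₁ e)) → inj₁ e ; (inj₂ (inj₂ f)) → inj₂ (inj₂ f) } }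
    where open InducedPrism Q

  flip-to : ∀ Q {v} → v ∈π Q → v ∈π flip Q
  flip-to Q (i , m) = i , Reversed.to (reversed (InducedPrism.path Q i)) m

  flip-from : ∀ Q {v} → v ∈π flip Q → v ∈π Q
  flip-from Q (i , m) = i , Reversed.from (reversed (InducedPrism.path Q i)) m

  module CycleOf (Q : InducedPrism) {i j : Fin 3} (i≢j : i ≢ j) where
    open InducedPrism Q
    private
      module N = Uncons (next i)
      module R = Reversed (reversed (path j))
      cross′ : ∀ {p q} → p ∈ₚ N.tail → q ∈ₚ R.path → (p ≡ l i × q ≡ l j) ⊎ Far p q
      cross′ p∈ q∈ with cross i≢j (N.sub p∈) (R.from q∈)
      ... | inj₁ (e , _) = contradiction e (N.fresh p∈)
      ... | inj₂ x       = x
      module J = Joined (join N.tail (ll i≢j) R.path cross′)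

    cyc : Cyc (k i)
    cyc = record
      { arc = J.path ; u~a = N.x~b ; z~u = kk (≢-sym i≢j)
      ; a≢z = λ e → disjoint i≢j (m∈ i) (subst (_∈ₚ path j) (sym e) (k∈ j))
      ; only = λ p∈ a → case J.from p∈ of λ
          { (inj₁ n) → inj₁ (N.only n a)
          ; (inj₂ n) → case cross i≢j (k∈ i) (R.from n) of λ
              { (inj₁ (_ , e)) → inj₂ e
              ; (inj₂ (inj₁ (e , _))) → contradiction e (k≢l i)
              ; (inj₂ (inj₂ f)) → contradiction a (proj₂ f) } }
      ; u∉ = λ p∈ → [ (λ n → N.fresh n refl) , (λ n → disjoint i≢j (k∈ i) (R.from n)) ] (J.from p∈) }

    onˡ : ∀ {v} → v ∈ₚ path i → v ∈ₒ cyc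
    onˡ v∈ = map₂ J.left (N.from v∈)

    arcˡ : ∀ {v} → v ∈ₚ path i → v ≢ k i → v ∈ₚ arc cyc
    arcˡ v∈ v≢k = [ (λ e → contradiction e v≢k) , J.left ] (N.from v∈)

    arcʳ : ∀ {v} → v ∈ₚ path j → v ∈ₚ arc cyc
    arcʳ = J.right ∘ R.to

    onʳ : ∀ {v} → v ∈ₚ path j → v ∈ₒ cyc
    onʳ = inj₂ ∘ arcʳ

    on⁻ : ∀ {v} → v ∈ₒ cyc → v ∈ₚ path i ⊎ v ∈ₚ path j
    on⁻ (inj₁ refl) = inj₁ (k∈ i)
    on⁻ (inj₂ p∈) = [ inj₁ ∘ N.sub , inj₂ ∘ R.from ] (J.from p∈)

    on⊆ : ∀ {v} → v ∈ₒ cyc → v ∈π Q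
    on⊆ v∈ = [ i ,_ , j ,_ ] (on⁻ v∈)

  -- The triangle counts as an induced cycle too, so the facts on tails apply to it.
  module TriangleOf (Q : InducedPrism) {i j t : Fin 3} (i≢j : i ≢ j) (t≢i : t ≢ i) (t≢j : t ≢ j) where
    open InducedPrism Q

    tri : Cyc (k i)
    tri = record
      { arc = ipath ((kk (≢-sym t≢j) , []) ∷ []) ; u~a = kk i≢j ; z~u = kk t≢i ; a≢z = kk≢ (≢-sym t≢j)
      ; only = λ { (here e) _ → inj₁ e ; (there (here e)) _ → inj₂ e }
      ; u∉ = λ { (here e) → kk≢ i≢j e ; (there (here e)) → kk≢ (≢-sym t≢i) e } }

    tri⊆ : ∀ {v} → v ∈ₒ tri → v ∈π Q
    tri⊆ (inj₁ refl) = i , k∈ i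
    tri⊆ (inj₂ (here refl)) = j , k∈ j
    tri⊆ (inj₂ (there (here refl))) = t , k∈ t

  -- This is a tail at `k i` for all cycles of the prism through `k i` at once.
  record Attachment (Q : InducedPrism) (i : Fin 3) : Set where
    open InducedPrism Q
    field
      {r s}  : Vertex
      walk   : IPath r s
      off    : ∀ {v} → v ∈ₚ walk → ¬ v ∈π Q
      k~r    : k i ~ r
      onlyk  : ∀ {v} → v ∈ₚ walk → k i ~ v → v ≡ r
      onlys  : ∀ {v w} → v ∈ₚ walk → w ∈π Q → w ≢ k i → v ~ w → v ≡ s

  tailOf : ∀ {Q i} → Attachment Q i → (C : Cyc (InducedPrism.k Q i)) → (∀ {v} → v ∈ₒ C → v ∈π Q) → Tail C
  tailOf A C ⊆ = record
    { path = walk ; off = λ m → off m ∘ ⊆ ; u~r = k~r ; onlyu = onlyk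
    ; onlys = λ m n → onlys m (⊆ (inj₂ n)) (∈∉⇒≢ n (Cyc.u∉ C)) }
    where open Attachment A

  module _ {Q : InducedPrism} {i : Fin 3} (A : Attachment Q i) where
    open InducedPrism Q
    open Attachment A

    attachment-two : ∀ {j t} → i ≢ j → t ≢ i → t ≢ j → s ~ k j → s ~ k t → Bad
    attachment-two i≢j t≢i t≢j a b =
      tail-two tri (tailOf A tri tri⊆) (here refl) (there (here refl)) (kk≢ (≢-sym t≢j)) a b
      where open TriangleOf Q i≢j t≢i t≢j

    module _ (m∉ : ∀ {v} → v ∈ₚ walk → ¬ v ~ m i) where

      -- `x` and `k i` lie on a common cycle of the prism and are not adjacent: on path `i` because
      -- `k i` sees only `m i` there, which the walk does not see. So `tail-far` applies.
      attachment-far : ∀ {x j} → x ∈ₚ path j → x ≢ k i → x ≢ k j → s ~ x → Bad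
      attachment-far {x} {j} x∈ x≢ki x≢kj s~x with j ≟ i
      ... | yes refl = tail-far cyc (tailOf A cyc on⊆) (arcˡ x∈ x≢ki) s~x (λ a → m∉ (end∈ walk)
                         (subst (s ~_) (Uncons.only (next i) ([ (λ e → contradiction e x≢ki) , id ] (Uncons.from (next i) x∈)) a) s~x))
        where open CycleOf Q (≢-sym (proj₂ (other i)))
      ... | no j≢i = tail-far cyc (tailOf A cyc on⊆) (arcʳ x∈) s~x (proj₂ (k-far (≢-sym j≢i) x∈ x≢kj))
        where open CycleOf Q (≢-sym j≢i)

      -- By `attachment-far`, only corners of the triangle remain as neighbours of `s`. Two of them
      -- besides `k i` are excluded by the triangle itself. With `k j` alone, the walk, the third
      -- corner and the way round through `l i` and `l j` form a theta whose chord is the edge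
      -- `k i k j`.
      attachment-bad : ∀ {x} → x ∈π Q → x ≢ k i → s ~ x → Bad
      attachment-bad {x} (j , x∈) x≢ki s~x with x ≟ k j
      ... | no x≢kj = attachment-far x∈ x≢ki x≢kj s~x
      ... | yes refl with third {i} {j} (λ { refl → x≢ki refl })
      ...   | t , t≢i , t≢j , _ with any? (λ w → ∈π? Q w ×-dec (s ~? w) ×-dec ¬? (w ≟ k i) ×-dec ¬? (w ≟ k j))
      ...     | yes (w , (o , w∈) , s~w , w≢ki , w≢kj) with w ≟ k o
      ...       | no w≢ko = attachment-far w∈ w≢ki w≢ko s~w
      ...       | yes refl = attachment-two (λ { refl → x≢ki refl }) (λ { refl → w≢ki refl }) (λ { refl → w≢kj refl }) s~x s~w
      attachment-bad {x} (j , x∈) x≢ki s~x | yes refl | t , t≢i , t≢j , _ | no ¬w =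
        theta S (≢-sym x≢ki)
          (fin3 (ear (along walk id) k~r s~x)
                (ear (stop refl) (kk (≢-sym t≢i)) (kk t≢j))
                (ear (along J.path id) I.x~b (~-sym L.x~b)))
          (apart3 {S} (λ { v _ n refl → R-far n (t , k∈ t) (kk≢ t≢i) (kk≢ t≢j) })
                      (λ v w n o → [ (λ o′ → R-far n (i , I.sub o′) (I.fresh o′) (λ { refl → disjoint i≢j (I.sub o′) (k∈ j) }))
                                   , (λ o′ → R-far n (j , L.sub (LR.from o′)) (λ { refl → disjoint i≢j (k∈ i) (L.sub (LR.from o′)) }) (L.fresh (LR.from o′)))
                                   ] (J.from o))
                      (λ { _ v refl n → [ (λ o → k-far t≢i (I.sub o) (I.fresh o))
                                        , (λ o → k-far t≢j (L.sub (LR.from o)) (L.fresh (LR.from o))) ] (J.from n) }))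
          (fin3 (λ n → off n (i , k∈ i)) (kk≢ (≢-sym t≢i))
                (λ n → [ (λ o → I.fresh o refl) , (λ o → disjoint i≢j (k∈ i) (L.sub (LR.from o))) ] (J.from n)))
          (fin3 (λ n → off n (j , k∈ j)) (kk≢ (≢-sym t≢j))
                (λ n → [ (λ o → disjoint i≢j (I.sub o) (k∈ j)) , (λ o → L.fresh (LR.from o) refl) ] (J.from n)))
        where
        i≢j : i ≢ j
        i≢j refl = x≢ki refl
        module I = Uncons (next i)
        module L = Uncons (next j)
        module LR = Reversed (reversed L.tail)
        cross′ : ∀ {p q} → p ∈ₚ I.tail → q ∈ₚ LR.path → (p ≡ l i × q ≡ l j) ⊎ Far p q
        cross′ p∈ q∈ with cross i≢j (I.sub p∈) (L.sub (LR.from q∈))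
        ... | inj₁ (e , _) = contradiction e (I.fresh p∈)
        ... | inj₂ y       = y
        module J = Joined (join I.tail (ll i≢j) LR.path cross′)
        S : Fin 3 → Vertex → Set
        S 0F v = v ∈ₚ walk
        S 1F v = v ≡ k t
        S 2F v = v ∈ₚ J.path
        R-far : ∀ {v w} → v ∈ₚ walk → w ∈π Q → w ≢ k i → w ≢ k j → Far v w
        R-far {v} {w} n w∈ ≢i ≢j = (λ { refl → off n w∈ }) , λ a → ¬w (w , w∈ , subst (_~ w) (onlys n w∈ ≢i a) a , ≢i , ≢j)

-- Prisms with a path that is a single edge.

module ThinPrisms (G : Graph) (setting : Setting G) where
  open Prisms G setting public

  thin-path : ∀ {x y} (π : IPath x y) → x ~ y → ∀ {v} → v ∈ₚ π → v ≡ x ⊎ v ≡ y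
  thin-path (ipath []) _ (here e) = inj₁ e
  thin-path (ipath (_ ∷ [])) _ (here e) = inj₁ e
  thin-path (ipath (_ ∷ [])) _ (there (here e)) = inj₂ e
  thin-path (ipath ((_ , fs) ∷ _ ∷ π)) a = contradiction a (proj₂ (All.lookup fs (induced-end π)))

  -- The outside path starts at a common neighbour of `k t` and `l t`, a case that `Attachment` does
  -- not cover.
  record EdgeBridge (Q : InducedPrism) (t : Fin 3) : Set where
    open InducedPrism Q
    field
      {c d} : Vertex
      walk  : IPath c d
      off   : ∀ {v} → v ∈ₚ walk → ¬ v ∈π Q
      c~k   : c ~ k t
      c~l   : c ~ l t
      onlyk : ∀ {v} → v ∈ₚ walk → v ~ k t → v ≡ c
      onlyl : ∀ {v} → v ∈ₚ walk → v ~ l t → v ≡ c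
      onlyd : ∀ {v w} → v ∈ₚ walk → w ∈π Q → w ≢ k t → w ≢ l t → v ~ w → v ≡ d
      c≢d   : c ≢ d

  flip-bridge : ∀ {Q t} → EdgeBridge Q t → EdgeBridge (flip Q) t
  flip-bridge {Q} B = record
    { walk = walk ; off = λ m → off m ∘ flip-from Q ; c~k = c~l ; c~l = c~k ; onlyk = onlyl ; onlyl = onlyk
    ; onlyd = λ m n p q → onlyd m (flip-from Q n) q p ; c≢d = c≢d }
    where open EdgeBridge B

  module _ {Q : InducedPrism} {t : Fin 3} (B : EdgeBridge Q t) where
    open InducedPrism Q
    open EdgeBridge B

    -- k t sees both c and k j on the cycle l t, c … d, x … k j, k o … l o.
    bridge-hub : k t ~ l t → ∀ {j o} → j ≢ t → o ≢ t → j ≢ o → (∀ {w} → w ∈ₚ path o → ¬ d ~ w) →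
                 (F : FirstCut (path j) (d ~_)) → FirstCut.p F ≢ l j → Bad
    bridge-hub thin {j} {o} j≢t o≢t j≢o d≁o F x≢l =
      two-neighbours C h∉ (inj₂ (J₂.left (J₁.left (start∈ walk)))) (inj₂ (J₂.left (J₁.right (end∈ P.path))))
        ((λ { refl → off (start∈ walk) (j , k∈ j) }) , λ a → c≢d (onlyd (start∈ walk) (j , k∈ j) (kk≢ j≢t) (λ e → disjoint j≢t (k∈ j) (subst (_∈ₚ path t) (sym e) (l∈ t))) a))
        (~-sym c~k) (kk (≢-sym j≢t))
      where
      open FirstCut F renaming (p to x; Tp to d~x)
      open Split cut hiding (cross)
      module P = Reversed (reversed pre)
      away : ∀ {s v} → s ≢ t → v ∈ₚ path s → ∀ {w} → w ∈ₚ path t → v ≢ w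
      away s≢t m n refl = disjoint s≢t m n
      l∉pre : l j ∉ₚ pre
      l∉pre m = x≢l (sym (split-meet cut m (end∈ suf)))
      cross₁ : ∀ {v w} → v ∈ₚ walk → w ∈ₚ P.path → (v ≡ d × w ≡ x) ⊎ Far v w
      cross₁ {v} {w} m n with v ~? w
      ... | no v≁w = inj₂ ((λ { refl → off m (j , pre⊆ (P.from n)) }) , v≁w)
      ... | yes v~w with onlyd m (j , pre⊆ (P.from n)) (away j≢t (pre⊆ (P.from n)) (k∈ t)) (away j≢t (pre⊆ (P.from n)) (l∈ t)) v~w
      ...   | refl = inj₁ (refl , only (P.from n) v~w)
      module J₁ = Joined (join walk d~x P.path cross₁)
      cross₂ : ∀ {v w} → v ∈ₚ J₁.path → w ∈ₚ path o → (v ≡ k j × w ≡ k o) ⊎ Far v w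
      cross₂ {v} {w} m n with J₁.from m
      ... | inj₁ m′ = inj₂ ((λ { refl → off m′ (o , n) }) , λ a →
              d≁o n (subst (_~ w) (onlyd m′ (o , n) (away o≢t n (k∈ t)) (away o≢t n (l∈ t)) a) a))
      ... | inj₂ m′ with cross j≢o (pre⊆ (P.from m′)) n
      ...   | inj₁ e = inj₁ e
      ...   | inj₂ (inj₁ (refl , _)) = contradiction (P.from m′) l∉pre
      ...   | inj₂ (inj₂ f) = inj₂ f
      module J₂ = Joined (join J₁.path (kk j≢o) (path o) cross₂)
      C : Cyc (l t)
      C = record
        { arc = J₂.path ; u~a = ~-sym c~l ; z~u = ll o≢t ; a≢z = λ { refl → off (start∈ walk) (o , l∈ o) }
        ; only = λ m a → case J₂.from m of λ
            { (inj₁ n) → case J₁.from n of λ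
                { (inj₁ n′) → inj₁ (onlyl n′ (~-sym a))
                ; (inj₂ n′) → case cross (≢-sym j≢t) (l∈ t) (pre⊆ (P.from n′)) of λ
                    { (inj₁ (e , _)) → contradiction (sym e) (k≢l t)
                    ; (inj₂ (inj₁ (_ , refl))) → contradiction (P.from n′) l∉pre
                    ; (inj₂ (inj₂ f)) → contradiction a (proj₂ f) } }
            ; (inj₂ n) → case cross (≢-sym o≢t) (l∈ t) n of λ
                { (inj₁ (e , _)) → contradiction (sym e) (k≢l t)
                ; (inj₂ (inj₁ (_ , e))) → inj₂ e
                ; (inj₂ (inj₂ f)) → contradiction a (proj₂ f) } }
        ; u∉ = λ m → case J₂.from m of λ
            { (inj₁ n) → [ (λ n′ → off n′ (t , l∈ t)) , (λ n′ → disjoint j≢t (pre⊆ (P.from n′)) (l∈ t)) ] (J₁.from n)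
            ; (inj₂ n) → disjoint o≢t n (l∈ t) } }
      h∉ : ¬ k t ∈ₒ C
      h∉ (inj₁ e) = k≢l t e
      h∉ (inj₂ m) with J₂.from m
      ... | inj₂ n = disjoint o≢t n (k∈ t)
      ... | inj₁ n with J₁.from n
      ...   | inj₁ n′ = off n′ (t , k∈ t)
      ...   | inj₂ n′ = disjoint j≢t (pre⊆ (P.from n′)) (k∈ t)

    bridge-corner : ∀ {j o} → j ≢ t → o ≢ t → j ≢ o → d ~ k j → d ~ k o → Bad
    bridge-corner {j} {o} j≢t o≢t j≢o = tail-two tri (record
      { path = walk ; off = λ m → off m ∘ tri⊆ ; u~r = ~-sym c~k ; onlyu = λ m → onlyk m ∘ ~-sym
      ; onlys = λ { m (here refl) → at j≢t m ; m (there (here refl)) → at o≢t m } })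
      (here refl) (there (here refl)) (kk≢ j≢o)
      where
      open TriangleOf Q (≢-sym j≢t) o≢t (≢-sym j≢o)
      at : ∀ {s} → s ≢ t → ∀ {v} → v ∈ₚ walk → v ~ k s → v ≡ d
      at {s} s≢t m = onlyd m (s , k∈ s) (kk≢ s≢t) (λ e → disjoint s≢t (k∈ s) (subst (_∈ₚ path t) (sym e) (l∈ t)))

  Beyond : InducedPrism → Fin 3 → Vertex → Set
  Beyond Q t v = ∃[ z ] z ∈π Q × z ≢ InducedPrism.k Q t × z ≢ InducedPrism.l Q t × v ~ z

  beyond? : ∀ Q t v → Dec (Beyond Q t v)
  beyond? Q t v = any? (λ z → ∈π? Q z ×-dec ¬? (z ≟ InducedPrism.k Q t) ×-dec ¬? (z ≟ InducedPrism.l Q t) ×-dec (v ~? z))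

  Off : InducedPrism → Vertex → Set
  Off Q v = ¬ v ∈π Q

  off? : ∀ Q v → Dec (Off Q v)
  off? Q v = ¬? (∈π? Q v)

  module _ {Q : InducedPrism} {t : Fin 3} (B : EdgeBridge Q t) where
    open InducedPrism Q
    open EdgeBridge B

    -- If `d` sees two paths, it has nonadjacent neighbours on their common cycle or sees two
    -- corners of one triangle. If it sees path `j` only, `bridge-hub` applies, unless the first
    -- neighbour of `d` on it is `l j`; then it applies with the two triangles exchanged.
    bridge-bad : k t ~ l t → ∀ {z} → z ∈π Q → z ≢ k t → z ≢ l t → d ~ z → Bad
    bridge-bad thin {z} (j , z∈) z≢k z≢l d~z = go
      where
      j≢t : j ≢ t
      j≢t refl = [ z≢k , z≢l ] (thin-path (path t) thin z∈)
      o = proj₁ (third j≢t)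
      o≢j = proj₁ (proj₂ (third j≢t))
      o≢t = proj₁ (proj₂ (proj₂ (third j≢t)))

      off-o : (∀ {w} → w ∈ₚ path o → ¬ d ~ w) → Bad
      off-o d≁o with first-cut (d ~?_) (path j) z∈ d~z
      ... | F with FirstCut.p F ≟ l j
      ...   | no x≢l = bridge-hub B thin j≢t o≢t (≢-sym o≢j) d≁o F x≢l
      ...   | yes x≡l with subst (d ~_) x≡l (FirstCut.Tp F)
      ...     | d~l with first-cut (d ~?_) (InducedPrism.path (flip Q) j) (start∈ (InducedPrism.path (flip Q) j)) d~l
      ...       | F′ = bridge-hub (flip-bridge B) (~-sym thin) j≢t o≢t (≢-sym o≢j)
                        (d≁o ∘ Reversed.from (reversed (path o))) F′
                        (λ e → k≢l j (sym (trans (FirstCut.only F′ (start∈ (Split.pre (FirstCut.cut F′))) d~l) e)))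

      go : Bad
      go with any? (λ w → (w ∈ₚ? path o) ×-dec (d ~? w))
      ... | no ¬w = off-o (λ m a → ¬w (_ , m , a))
      ... | yes (w , w∈ , d~w) with cross (≢-sym o≢j) z∈ w∈
      ...   | inj₁ (refl , refl) = bridge-corner B j≢t o≢t (≢-sym o≢j) d~z d~w
      ...   | inj₂ (inj₁ (refl , refl)) = bridge-corner (flip-bridge B) j≢t o≢t (≢-sym o≢j) d~z d~w
      ...   | inj₂ (inj₂ f) = two-neighbours cyc (off (end∈ walk) ∘ on⊆) (onˡ z∈) (onʳ w∈) f d~z d~w
        where open CycleOf Q (≢-sym o≢j)

  -- The component of `w` off the prism is attached to more than the ends of path `t`. A component
  -- next to `k t` without escape will serve as an ear of path `t`.
  Escape : InducedPrism → Fin 3 → Vertex → Set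
  Escape Q t w = ∃[ w′ ] Walk (Off Q) w w′ × Beyond Q t w′

  escape? : ∀ Q t w → Dec (Escape Q t w)
  escape? Q t w = any? λ w′ → walk? (off? Q) w w′ ×-dec beyond? Q t w′

  thin-next : ∀ Q {t} → let open InducedPrism Q in k t ~ l t → m t ≡ l t
  thin-next Q {t} thin = [ (λ e → contradiction e (Uncons.fresh (next t) (here refl))) , id ] (thin-path (path t) thin (m∈ t))
    where open InducedPrism Q

  thin-one : ∀ Q {t} → let open InducedPrism Q in k t ~ l t →
             (R : Connector (Off Q) (λ v → v ~ k t ⊎ v ~ l t) (Beyond Q t)) →
             Connector.c R ~ k t → ¬ Connector.c R ~ l t → Bad
  thin-one Q {t} thin R c~k c≁l = let (z , z∈ , z≢k , _ , d~z) = Bd in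
    attachment-bad {Q = Q}
      (record { walk = path′ ; off = sub ; k~r = ~-sym c~k ; onlyk = λ n a → onlyA n (inj₁ (~-sym a))
              ; onlys = λ {v} {w} n w∈ w≢k a → case w ≟ l t of λ
                  { (yes refl) → contradiction (subst (_~ l t) (onlyA n (inj₂ a)) a) c≁l
                  ; (no w≢l)   → onlyB n (w , w∈ , w≢k , w≢l , a) } })
      (λ n a → let a′ = subst (_ ~_) (thin-next Q thin) a in c≁l (subst (_~ l t) (onlyA n (inj₂ a′)) a′))
      z∈ z≢k d~z
    where
    open InducedPrism Q
    open Connector R renaming (path to path′)

  -- If the first vertex of the connector sees one end of the thin path only, the connector is an
  -- attachment there. If it sees both, the connector is an edge bridge, or a single vertex and then
  -- the hub of a wheel.
  thin-attach : ∀ Q {t} → let open InducedPrism Q in k t ~ l t →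
                Connector (Off Q) (λ v → v ~ k t ⊎ v ~ l t) (Beyond Q t) → Bad
  thin-attach Q {t} thin R = go (Connector.c R ~? InducedPrism.k Q t) (Connector.c R ~? InducedPrism.l Q t)
    where
    open InducedPrism Q
    open Connector R renaming (path to path′)
    beyond-flip : ∀ {v} → Beyond Q t v → Beyond (flip Q) t v
    beyond-flip (z , z∈ , a , b , c) = z , flip-to Q z∈ , b , a , c
    beyond-unflip : ∀ {v} → Beyond (flip Q) t v → Beyond Q t v
    beyond-unflip (z , z∈ , a , b , c) = z , flip-from Q z∈ , b , a , c
    go : Dec (c ~ k t) → Dec (c ~ l t) → Bad
    go (no c≁k) (no c≁l) = contradiction Ac ([ c≁k , c≁l ])
    go (yes c~k) (no c≁l) = thin-one Q thin R c~k c≁l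
    go (no c≁k) (yes c~l) = thin-one (flip Q) (~-sym thin)
      (record { path = path′ ; sub = λ n → sub n ∘ flip-from Q ; Ac = swap Ac ; Bd = beyond-flip Bd
              ; onlyA = λ n → onlyA n ∘ swap ; onlyB = λ n → onlyB n ∘ beyond-unflip }) c~l c≁k
    go (yes c~k) (yes c~l) with c ≟ d | Bd
    ... | no c≢d | z , z∈ , z≢k , z≢l , d~z =
      bridge-bad {Q} (record { walk = path′ ; off = sub ; c~k = c~k ; c~l = c~l ; onlyk = λ n → onlyA n ∘ inj₁ ; onlyl = λ n → onlyA n ∘ inj₂
                         ; onlyd = λ n w∈ ≢k ≢l a → onlyB n (_ , w∈ , ≢k , ≢l , a) ; c≢d = c≢d }) thin z∈ z≢k z≢l d~z
    ... | yes refl | z , (j , z∈) , z≢k , z≢l , d~z =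
      wheel cyc (sub (end∈ path′) ∘ on⊆) (onˡ (k∈ t)) (onˡ (l∈ t)) (onʳ z∈) (k≢l t) (≢-sym z≢k) (≢-sym z≢l) c~k c~l d~z
      where
      t≢j : t ≢ j
      t≢j refl = [ z≢k , z≢l ] (thin-path (path t) thin z∈)
      open CycleOf Q t≢j

  module _ (Q : InducedPrism) {t : Fin 3} (thin : InducedPrism.k Q t ~ InducedPrism.l Q t)
           (escape : ∀ {w} → Off Q w → InducedPrism.k Q t ~ w → Escape Q t w) where
    open InducedPrism Q

    private
      escape′ : ∀ {w} → Off Q w → w ~ l t → Escape Q t w
      -- Without `l t` there still is a walk from `w` to `k t`. It enters the prism beyond the thin
      -- edge, or at `k t`; then the last vertex before is a neighbour of `k t`, whose escape is
      -- given.
      escape′ {w} w∉ w~l with exit (∈π? Q) (proj₂ connected (l t) (tt , λ { refl → w∉ (t , l∈ t) }) (tt , k≢l t)) w∉ (t , k∈ t)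
      ... | w′ , z , ω , a , z∈ , _ , z≢l with z ≟ k t
      ...   | no z≢k = w′ , walk-map proj₂ ω , z , z∈ , z≢k , z≢l , a
      ...   | yes refl = let (w″ , ω′ , b) = escape (proj₂ (walk-end ω)) (~-sym a) in w″ , walk-map proj₂ ω ⊕ ω′ , b

      no-neighbour : ∀ {w} → Off Q w → w ~ k t ⊎ w ~ l t → Bad
      no-neighbour {w} w∉ a with [ escape w∉ ∘ ~-sym , escape′ w∉ ] a
      ... | w′ , ω , b = thin-attach Q thin (connector (λ v → (v ~? k t) ⊎-dec (v ~? l t)) (beyond? Q t) ω a b)

    thin-closed-k : ∀ {w} → k t ~ w → w ∈π Q ⊎ Bad
    thin-closed-k {w} a with ∈π? Q w
    ... | yes w∈ = inj₁ w∈
    ... | no w∉  = inj₂ (no-neighbour w∉ (inj₁ (~-sym a)))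

    thin-closed-l : ∀ {w} → l t ~ w → w ∈π Q ⊎ Bad
    thin-closed-l {w} a with ∈π? Q w
    ... | yes w∈ = inj₁ w∈
    ... | no w∉  = inj₂ (no-neighbour w∉ (inj₂ (~-sym a)))

  path-connected : ∀ {x y} (π : IPath x y) {u v} → u ∈ₚ π → v ∈ₚ π → Walk (_∈ₚ π) u v
  path-connected π u∈ v∈ = walk-rev (fromStart u∈) ⊕ fromStart v∈
    where
    fromStart : ∀ {v} → v ∈ₚ π → Walk (_∈ₚ π) _ v
    fromStart v∈ = along pre pre⊆
      where open Split (split π v∈)

  cycle-minus : ∀ {u} (C : Cyc u) w {x y} → x ∈ₒ C → y ∈ₒ C → x ≢ w → y ≢ w → Walk (λ v → v ∈ₒ C × v ≢ w) x y
  cycle-minus {u} C w x∈ y∈ x≢w y≢w with w ∈ₒ? C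
  ... | yes w∈ with rotate C w∈
  ...   | ρ with Rotation.to ρ x∈ | Rotation.to ρ y∈
  ...     | inj₁ e | _      = contradiction e x≢w
  ...     | _      | inj₁ e = contradiction e y≢w
  ...     | inj₂ m | inj₂ n = walk-map (λ o → Rotation.from ρ (inj₂ o) , ∈∉⇒≢ o (Cyc.u∉ (Rotation.cyc ρ)))
                                (path-connected (arc (Rotation.cyc ρ)) m n)
  cycle-minus {u} C w x∈ y∈ x≢w y≢w | no w∉ = walk-map (λ o → o , λ { refl → w∉ o }) (walk-rev (fromU x∈) ⊕ fromU y∈)
    where
    fromU : ∀ {v} → v ∈ₒ C → Walk (_∈ₒ C) u v
    fromU (inj₁ refl) = stop (inj₁ refl)
    fromU (inj₂ m) = step (inj₁ refl) (Cyc.u~a C) (walk-map inj₂ (path-connected (arc C) (start∈ (arc C)) m))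

  -- All neighbours of `v` lie in `Q`, so a walk that heads for `Q` from outside and avoids `w`
  -- meets `Q` before it can meet `v`. Hence joining the vertices of `Q` is enough.
  delete : ∀ {Q : Vertex → Set} → Decidable₁ Q → ∀ v → (∀ {w} → v ~ w → Q w) → Three (_≢ v) →
           (∀ w → ∃[ q ] Q q × q ≢ v × q ≢ w) →
           (∀ w {x y} → Q x → x ≢ v → x ≢ w → Q y → y ≢ v → y ≢ w → Walk (λ p → p ≢ v × p ≢ w) x y) →
           TwoConnected (_≢ v)
  delete {Q} Q? v N⊆ three base conn = three , λ w (x≢v , x≢w) (y≢v , y≢w) →
    let (q , Qq , q≢v , q≢w) = base w
        to : ∀ {x} → x ≢ v → x ≢ w → Walk (λ p → p ≢ v × p ≢ w) x q
        to {x} x≢v x≢w = case Q? x of λ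
          { (yes Qx) → conn w Qx x≢v x≢w Qq q≢v q≢w
          ; (no ¬Qx) → case exit {T = λ p → Q p ⊎ p ≡ v} (λ p → Q? p ⊎-dec p ≟ v) (proj₂ connected w (tt , x≢w) (tt , q≢w))
                              ([ ¬Qx , x≢v ]) (inj₁ Qq) of λ
              { (x′ , z , ω , a , inj₂ refl , _) → contradiction (inj₁ (N⊆ (~-sym a))) (proj₂ (walk-end ω))
              ; (x′ , z , ω , a , inj₁ Qz , _ , z≢w) → case z ≟ v of λ
                  { (yes refl) → contradiction (inj₁ (N⊆ (~-sym a))) (proj₂ (walk-end ω))
                  ; (no z≢v) → walk-map (λ ((_ , ≢w) , ¬T) → (λ e → ¬T (inj₂ e)) , ≢w) ω
                      ⊕ step ((λ e → proj₂ (walk-end ω) (inj₂ e)) , proj₂ (proj₁ (walk-end ω))) a (conn w Qz z≢v z≢w Qq q≢v q≢w) } } }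
    in to x≢v x≢w ⊕ walk-rev (to y≢v y≢w)

-- Inserting an end of a thin path into a Hamiltonian cycle.

module ThinStep (G : Graph) (setting : Setting G) where
  open ThinPrisms G setting

  module _ (Q : InducedPrism) where
    open InducedPrism Q

    module _ {t c d : Fin 3} (c≢t : c ≢ t) (d≢t : d ≢ t) (c≢d : c ≢ d) (thin : k t ~ l t)
      (closed-k : ∀ {w} → k t ~ w → w ∈π Q) (closed-l : ∀ {w} → l t ~ w → w ∈π Q)
      -- The induction hypothesis, measured by path `d`: the prism built below keeps path `d` whole
      -- and takes path `c` apart.
      (longer : ∀ Q′ i → length (rest (path d)) < length (rest (InducedPrism.path Q′ i)) → Bad) where

      private
        module C = CycleOf Q c≢d

      covers : ∀ {i} → i ≢ t → i ≡ c ⊎ i ≡ d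
      covers {i} i≢t with third c≢d
      ... | s , s≢c , s≢d , all with all t | all i
      ...   | inj₁ e | _ = contradiction (sym e) c≢t
      ...   | inj₂ (inj₁ e) | _ = contradiction (sym e) d≢t
      ...   | inj₂ (inj₂ refl) | inj₁ e = inj₁ e
      ...   | inj₂ (inj₂ refl) | inj₂ (inj₁ e) = inj₂ e
      ...   | inj₂ (inj₂ refl) | inj₂ (inj₂ e) = contradiction e i≢t

      off-t : ∀ {i v} → i ≢ t → v ∈ₚ path i → v ≢ k t × v ≢ l t
      off-t i≢t m = (λ { refl → disjoint i≢t m (k∈ t) }) , (λ { refl → disjoint i≢t m (l∈ t) })

      locate : ∀ {v} → v ∈π Q → (v ≡ k t ⊎ v ≡ l t) ⊎ v ∈ₒ C.cyc
      locate (i , m) with i ≟ t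
      ... | yes refl = inj₁ (thin-path (path t) thin m)
      ... | no i≢t with covers i≢t
      ...   | inj₁ refl = inj₂ (C.onˡ m)
      ...   | inj₂ refl = inj₂ (C.onʳ m)

      cyc-off-t : ∀ {v} → v ∈ₒ C.cyc → v ≢ k t × v ≢ l t
      cyc-off-t = [ off-t c≢t , off-t d≢t ] ∘ C.on⁻

      -- Without `k t` the prism is the cycle of the paths `c` and `d` together with `l t`, which
      -- has two neighbours on it.
      two-connected : TwoConnected (_≢ k t)
      two-connected = delete (∈π? Q) (k t) closed-k
        (k c , k d , l t , kk≢ c≢t , kk≢ d≢t , ≢-sym (k≢l t) , kk≢ c≢d , proj₂ (off-t c≢t (k∈ c)) , proj₂ (off-t d≢t (k∈ d)))
        base conn
        where
        base : ∀ w → ∃[ q ] q ∈π Q × q ≢ k t × q ≢ w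
        base w with k c ≟ w
        ... | no k≢w   = k c , (c , k∈ c) , kk≢ c≢t , k≢w
        ... | yes refl = k d , (d , k∈ d) , kk≢ d≢t , kk≢ (≢-sym c≢d)
        onto : ∀ w {x} → x ∈π Q → x ≢ k t → x ≢ w → ∃[ x′ ] Walk (λ p → p ≢ k t × p ≢ w) x x′ × x′ ∈ₒ C.cyc × x′ ≢ w
        onto w x∈ x≢k x≢w with locate x∈
        ... | inj₁ (inj₁ e) = contradiction e x≢k
        ... | inj₂ x∈C = _ , stop (x≢k , x≢w) , x∈C , x≢w
        ... | inj₁ (inj₂ refl) with l c ≟ w
        ...   | no l≢w   = l c , walk-edge (x≢k , x≢w) (proj₁ (off-t c≢t (l∈ c)) , l≢w) (ll (≢-sym c≢t)) , C.onˡ (l∈ c) , l≢w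
        ...   | yes refl = l d , walk-edge (x≢k , x≢w) (proj₁ (off-t d≢t (l∈ d)) , l≢l) (ll (≢-sym d≢t)) , C.onʳ (l∈ d) , l≢l
          where l≢l = ~⇒≢ (ll (≢-sym c≢d))
        conn : ∀ w {x y} → x ∈π Q → x ≢ k t → x ≢ w → y ∈π Q → y ≢ k t → y ≢ w → Walk (λ p → p ≢ k t × p ≢ w) x y
        conn w x∈ x≢k x≢w y∈ y≢k y≢w with onto w x∈ x≢k x≢w | onto w y∈ y≢k y≢w
        ... | x′ , ω , x′∈ , x′≢w | y′ , ω′ , y′∈ , y′≢w =
          ω ⊕ walk-map (λ (o , ≢w) → proj₁ (cyc-off-t o) , ≢w) (cycle-minus C.cyc w x′∈ y′∈ x′≢w y′≢w) ⊕ walk-rev ω′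

      module N = Uncons (next c)

      -- Such a vertex would let the side of `k c` be left elsewhere than at `m c`; `leaving-bad`
      -- excludes this.
      Leaving : Vertex → Set
      Leaving v = ∃[ z ] z ∈π Q × z ≢ k c × z ≢ m c × v ~ z

      leaving? : ∀ v → Dec (Leaving v)
      leaving? v = any? (λ z → ∈π? Q z ×-dec ¬? (z ≟ k c) ×-dec ¬? (z ≟ m c) ×-dec (v ~? z))

      -- The walk and the part m … x of path c join the triangles k c, m, r and y, x, s, and the third
      -- path between them runs through the whole of path d.
      module Necklace (R : Connector (Off Q) (k c ~_) Leaving)
        (r~m : Connector.c R ~ m c) (only-m : ∀ {v} → v ∈ₚ Connector.path R → v ~ m c → v ≡ Connector.c R)
        (r≢s : Connector.c R ≢ Connector.d R)
        {x y : Vertex} (gap : Gap (path c) x y) (s~x : Connector.d R ~ x) (s~y : Connector.d R ~ y)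
        (unique : ∀ {w} → w ∈ₒ C.cyc → Connector.d R ~ w → w ≡ x ⊎ w ≡ y)
        (x≢k : x ≢ k c) (x≢m : x ≢ m c) (y≢k : y ≢ k c) where

        private
          module R = Connector R

        open Gap gap
        private
          module A = Uncons (uncons α (≢-sym x≢k))
          b≡m : A.b ≡ m c
          b≡m = N.only ([ (λ e → contradiction e (A.fresh (here refl))) , id ] (N.from (α⊆ (A.sub (here refl))))) A.x~b
          module Bʳ = Reversed (reversed β)

          cross₁ : ∀ {p q} → p ∈ₚ path d → q ∈ₚ Bʳ.path → (p ≡ l d × q ≡ l c) ⊎ Far p q
          cross₁ p∈ q∈ with cross (≢-sym c≢d) p∈ (β⊆ (Bʳ.from q∈))
          ... | inj₁ (_ , refl) = contradiction (Bʳ.from q∈) (apart (start∈ α))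
          ... | inj₂ e = e
          module J₁ = Joined (join (path d) (ll (≢-sym c≢d)) Bʳ.path cross₁)
          cross₂ : ∀ {p q} → p ∈ₚ ⟨ k c ⟩ → q ∈ₚ J₁.path → (p ≡ k c × q ≡ k d) ⊎ Far p q
          cross₂ (here refl) q∈ with J₁.from q∈
          ... | inj₁ n = case cross c≢d (k∈ c) n of λ
                  { (inj₁ e) → inj₁ e ; (inj₂ (inj₁ (e , _))) → contradiction e (k≢l c) ; (inj₂ (inj₂ f)) → inj₂ f }
          ... | inj₂ n = case across (start∈ α) (Bʳ.from n) of λ
                  { (inj₁ (e , _)) → contradiction (sym e) x≢k ; (inj₂ f) → inj₂ f }
          module J₂ = Joined (join ⟨ k c ⟩ (kk c≢d) J₁.path cross₂)

          parts : ∀ {p} → p ∈ₚ J₂.path → p ≡ k c ⊎ p ∈ₚ path d ⊎ p ∈ₚ β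
          parts p∈ with J₂.from p∈
          ... | inj₁ (here e) = inj₁ e
          ... | inj₂ n = inj₂ (map₂ Bʳ.from (J₁.from n))

          touch : ∀ {p q} → p ∈ₒ C.cyc → p ≢ k c → p ≢ m c → q ∈ₚ R.path → ¬ Far p q → q ≡ R.d × (p ≡ x ⊎ p ≡ y)
          touch p∈ p≢k p≢m q∈ ¬far with near ¬far
          ... | inj₁ refl = contradiction (C.on⊆ p∈) (R.sub q∈)
          ... | inj₂ a with R.onlyB q∈ (_ , C.on⊆ p∈ , p≢k , p≢m , ~-sym a)
          ...   | refl = refl , unique p∈ (~-sym a)

          k′ l′ : Fin 3 → Vertex
          k′ = fin3 (k c) A.b R.c
          l′ = fin3 y x R.d
          path′ : ∀ i → IPath (k′ i) (l′ i)
          path′ = fin3 J₂.path A.tail R.path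

          Rel : Fin 3 → Fin 3 → Set
          Rel i j = ∀ {p q} → p ∈ₚ path′ i → q ∈ₚ path′ j → (p ≡ k′ i × q ≡ k′ j) ⊎ (p ≡ l′ i × q ≡ l′ j) ⊎ Far p q

          cross01 : Rel 0F 1F
          cross01 {p} {q} p∈ q∈ with parts p∈
          ... | inj₁ refl with k c ~? q
          ...   | yes a = inj₁ (refl , A.only q∈ a)
          ...   | no ≁  = inj₂ (inj₂ (≢-sym (A.fresh q∈) , ≁))
          cross01 p∈ q∈ | inj₂ (inj₁ n) with cross (≢-sym c≢d) n (α⊆ (A.sub q∈))
          ... | inj₁ (_ , e) = contradiction e (A.fresh q∈)
          ... | inj₂ (inj₁ (_ , refl)) = contradiction (end∈ β) (apart (A.sub q∈))
          ... | inj₂ (inj₂ f) = inj₂ (inj₂ f)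
          cross01 p∈ q∈ | inj₂ (inj₂ n) with across (A.sub q∈) n
          ... | inj₁ (e , e′) = inj₂ (inj₁ (e′ , e))
          ... | inj₂ f = inj₂ (inj₂ (far-sym f))

          cross02 : Rel 0F 2F
          cross02 {p} {q} p∈ q∈ with parts p∈ | far? p q
          ... | _ | yes f = inj₂ (inj₂ f)
          ... | inj₁ refl | no ¬f with near ¬f
          ...   | inj₁ refl = contradiction (c , k∈ c) (R.sub q∈)
          ...   | inj₂ a = inj₁ (refl , R.onlyA q∈ a)
          cross02 p∈ q∈ | inj₂ (inj₁ n) | no ¬f
            with touch (C.onʳ n) (λ { refl → disjoint c≢d (k∈ c) n }) (λ { refl → disjoint c≢d (m∈ c) n }) q∈ ¬f
          ...   | _ , inj₁ refl = contradiction n (disjoint c≢d (α⊆ (end∈ α)))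
          ...   | _ , inj₂ refl = contradiction n (disjoint c≢d (β⊆ (start∈ β)))
          cross02 p∈ q∈ | inj₂ (inj₂ n) | no ¬f
            with touch (C.onˡ (β⊆ n)) (λ { refl → apart (start∈ α) n })
                       (λ e → apart (A.sub (here refl)) (subst (_∈ₚ β) (trans e (sym b≡m)) n)) q∈ ¬f
          ...   | _ , inj₁ refl = contradiction n (apart (end∈ α))
          ...   | e , inj₂ e′ = inj₂ (inj₁ (e′ , e))

          cross12 : Rel 1F 2F
          cross12 {p} {q} p∈ q∈ with p ≟ m c | far? p q
          ... | _ | yes f = inj₂ (inj₂ f)
          ... | yes refl | no ¬f with near ¬f
          ...   | inj₁ refl = contradiction (c , m∈ c) (R.sub q∈)
          ...   | inj₂ a = inj₁ (sym b≡m , only-m q∈ (~-sym a))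
          cross12 p∈ q∈ | no p≢m | no ¬f with touch (C.onˡ (α⊆ (A.sub p∈))) (A.fresh p∈) p≢m q∈ ¬f
          ...   | e , inj₁ e′ = inj₂ (inj₁ (e′ , e))
          ...   | _ , inj₂ refl = contradiction (start∈ β) (apart (A.sub p∈))

          flipped : ∀ i j → Rel i j → Rel j i
          flipped i j f p∈ q∈ with f q∈ p∈
          ... | inj₁ (e , e′) = inj₁ (e′ , e)
          ... | inj₂ (inj₁ (e , e′)) = inj₂ (inj₁ (e′ , e))
          ... | inj₂ (inj₂ g) = inj₂ (inj₂ (far-sym g))

        prism : InducedPrism
        prism = record
          { k = k′ ; l = l′ ; path = path′
          ; k≢l = fin3 (≢-sym y≢k) (λ e → x≢m (trans (sym e) b≡m)) r≢s
          ; kk = λ {i} {j} → distinct3 {λ i j → k′ i ~ k′ j} (λ _ _ → ~-sym) A.x~b R.Ac (subst (_~ R.c) (sym b≡m) (~-sym r~m)) i j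
          ; ll = λ {i} {j} → distinct3 {λ i j → l′ i ~ l′ j} (λ _ _ → ~-sym) (~-sym x~y) (~-sym s~y) (~-sym s~x) i j
          ; cross = λ {i} {j} i≢j {p} {q} → distinct3 {Rel} (λ i j f → flipped i j f) cross01 cross02 cross12 i j i≢j }

        bad : Bad
        bad = longer prism 0F (subst (length (rest (path d)) <_) (sym J₂.size) (s≤s (≤-trans (m≤m+n _ _) (≤-reflexive (sym J₁.size)))))

      module LeavingPath (R : Connector (Off Q) (k c ~_) Leaving) where
        open Connector R renaming (path to walk; c to r; d to s; Ac to k~r; onlyA to onlyk; onlyB to onlyl)

        off-walk : ∀ {v w} → v ∈ₚ walk → w ∈π Q → v ≢ w
        off-walk m n refl = sub m n

        on-cycle : ∀ {z} → z ∈π Q → s ~ z → z ∈ₒ C.cyc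
        on-cycle z∈ a with locate z∈
        ... | inj₂ n = n
        ... | inj₁ (inj₁ refl) = contradiction (closed-k (~-sym a)) (sub (end∈ walk))
        ... | inj₁ (inj₂ refl) = contradiction (closed-l (~-sym a)) (sub (end∈ walk))

        -- m c sees both k c and v on the cycle formed by k c, the walk, and C.cyc from its last neighbour of s.
        skipping : ∀ {z v} → z ∈ₒ C.cyc → z ≢ k c → z ≢ m c → s ~ z → v ∈ₚ walk → v ~ m c → v ≢ r → Bad
        skipping {z} {v} z∈ z≢k z≢m s~z v∈ v~m v≢r =
          two-neighbours C′ m∉ (inj₁ refl) (inj₂ (J.left v∈)) ((λ { refl → sub v∈ (c , k∈ c) }) , v≢r ∘ onlyk v∈)
            (~-sym N.x~b) (~-sym v~m)
          where
          T : Vertex → Set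
          T p = s ~ p × p ≢ m c
          open LastCut (last-cut {T = T} (λ p → s ~? p ×-dec ¬? (p ≟ m c)) (arc C.cyc)
                         ([ (λ e → contradiction e z≢k) , id ] z∈) (s~z , z≢m)) renaming (p to x)
          open Split cut renaming (cross to cut-cross)
          m∉suf : ∀ {w} → w ∈ₚ suf → w ≢ m c
          m∉suf n refl = proj₂ Tp (sym (split-meet cut (start∈ pre) n))
          on : ∀ {w} → w ∈ₚ suf → w ∈π Q
          on n = C.on⊆ (inj₂ (suf⊆ n))
          cross₁ : ∀ {p q} → p ∈ₚ walk → q ∈ₚ suf → (p ≡ s × q ≡ x) ⊎ Far p q
          cross₁ {p} {q} p∈ q∈ with p ~? q
          ... | no p≁q = inj₂ (off-walk p∈ (on q∈) , p≁q)
          ... | yes a with onlyl p∈ (q , on q∈ , ∈∉⇒≢ (suf⊆ q∈) (Cyc.u∉ C.cyc) , m∉suf q∈ , a)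
          ...   | refl = inj₁ (refl , only q∈ (a , m∉suf q∈))
          module J = Joined (join walk (proj₁ Tp) suf cross₁)
          C′ : Cyc (k c)
          C′ = record
            { arc = J.path ; u~a = k~r ; z~u = kk (≢-sym c≢d) ; a≢z = off-walk (start∈ walk) (d , k∈ d)
            ; only = λ n a → case J.from n of λ
                { (inj₁ n′) → inj₁ (onlyk n′ a)
                ; (inj₂ n′) → case Cyc.only C.cyc (suf⊆ n′) a of λ
                    { (inj₁ e) → contradiction e (m∉suf n′) ; (inj₂ e) → inj₂ e } }
            ; u∉ = λ n → [ (λ n′ → sub n′ (c , k∈ c)) , (λ n′ → Cyc.u∉ C.cyc (suf⊆ n′)) ] (J.from n) }
          m∉ : ¬ m c ∈ₒ C′
          m∉ (inj₁ e) = N.fresh (here refl) e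
          m∉ (inj₂ n) = [ (λ n′ → sub n′ (c , m∈ c)) , (λ n′ → m∉suf n′ refl) ] (J.from n)

        module _ (r~m : r ~ m c) (only-m : ∀ {v} → v ∈ₚ walk → v ~ m c → v ≡ r) where

          -- The reversed walk leaves z for the two neighbours k c and m c of its end r.
          pinched : ∀ (C′ : Cyc (k c)) → (∀ {v} → v ∈ₒ C′ → v ∈π Q) → m c ∈ₒ C′ → ∀ {z} → z ∈ₒ C′ →
                    z ≢ k c → z ≢ m c → s ~ z → (∀ {w} → w ∈ₒ C′ → s ~ w → w ≡ z) → Bad
          pinched C′ ⊆ m∈C′ {z} z∈ z≢k z≢m s~z unique =
            tail-two ρ.cyc T (onarc (inj₁ refl) (≢-sym z≢k)) (onarc m∈C′ (≢-sym z≢m)) (~⇒≢ N.x~b) (~-sym k~r) r~m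
            where
            module ρ = Rotation (rotate C′ z∈)
            module W = Reversed (reversed walk)
            onarc : ∀ {v} → v ∈ₒ C′ → v ≢ z → v ∈ₚ arc ρ.cyc
            onarc v∈ v≢z = [ (λ e → contradiction e v≢z) , id ] (ρ.to v∈)
            enters : ∀ {v w} → v ∈ₚ walk → w ∈ₒ C′ → w ≢ z → v ~ w → v ≡ r
            enters {v} {w} v∈ w∈ w≢z a with w ≟ k c | w ≟ m c
            ... | yes refl | _ = onlyk v∈ (~-sym a)
            ... | no _ | yes refl = only-m v∈ a
            ... | no w≢k | no w≢m with onlyl v∈ (w , ⊆ w∈ , w≢k , w≢m , a)
            ...   | refl = contradiction (unique w∈ a) w≢z
            T : Tail ρ.cyc
            T = record
              { path = W.path ; off = λ n n′ → sub (W.from n) (⊆ (ρ.from n′)) ; u~r = ~-sym s~z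
              ; onlyu = λ n a → onlyl (W.from n) (z , ⊆ z∈ , z≢k , z≢m , ~-sym a)
              ; onlys = λ n n′ a → enters (W.from n) (ρ.from (inj₂ n′)) (∈∉⇒≢ n′ (Cyc.u∉ ρ.cyc)) a }

          module TwoEnds (r≢s : r ≢ s) {z y : Vertex} (z≢k : z ≢ k c) (z≢m : z ≢ m c) (s~z : s ~ z)
            (y≢k : y ≢ k c) (y≢m : y ≢ m c) (s~y : s ~ y) (z~y : z ~ y)
            (unique : ∀ {w} → w ∈ₒ C.cyc → s ~ w → w ≡ z ⊎ w ≡ y) where

            -- Let `x` be the first neighbour of `s` on path `d`; it is not `l d`, as `s` has two
            -- neighbours there. The cycle `k t`, `k d` ... `x`, the walk backwards, `m c` ...
            -- `l c`, `l t` avoids `k c`, which sees `r` and `k t` on it.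
            both-d : z ∈ₚ path d → y ∈ₚ path d → Bad
            both-d z∈ y∈ = two-neighbours C′ kc∉ (inj₂ (J₃.left (J₂.left (J₁.right (W.to (start∈ walk)))))) (inj₁ refl)
                ((λ { refl → sub (start∈ walk) (t , k∈ t) }) , λ a → sub (start∈ walk) (closed-k (~-sym a)))
                k~r (kk c≢t)
              where
              open FirstCut (first-cut (s ~?_) (path d) z∈ s~z) renaming (p to x; Tp to s~x)
              open Split cut renaming (cross to cut-cross)
              module W = Reversed (reversed walk)
              l∉pre : l d ∉ₚ pre
              l∉pre n = ~⇒≢ z~y (trans (at z∈ s~z) (sym (at y∈ s~y)))
                where
                at : ∀ {v} → v ∈ₚ path d → s ~ v → v ≡ x
                at v∈ a with cover v∈
                ... | inj₁ o = only o a
                ... | inj₂ o with thin-suf suf (sym (split-meet cut n (end∈ suf))) o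
                  where
                  thin-suf : ∀ {a b v} (π : IPath a b) → a ≡ b → v ∈ₚ π → v ≡ a
                  thin-suf {a} {v = v} π e v∈ with v ≟ a
                  ... | yes e′ = e′
                  ... | no ne = contradiction e (loop π v∈ ne)
                ...   | e = e
              on : ∀ {v} → v ∈ₚ pre → v ∈π Q
              on n = d , pre⊆ n
              cross₁ : ∀ {p q} → p ∈ₚ pre → q ∈ₚ W.path → (p ≡ x × q ≡ s) ⊎ Far p q
              cross₁ {p} {q} p∈ q∈ with p ~? q
              ... | no p≁q = inj₂ (≢-sym (off-walk (W.from q∈) (on p∈)) , p≁q)
              ... | yes a with onlyl (W.from q∈) (p , on p∈ , (λ { refl → disjoint c≢d (k∈ c) (pre⊆ p∈) })
                                                  , (λ { refl → disjoint c≢d (m∈ c) (pre⊆ p∈) }) , ~-sym a)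
              ...   | refl = inj₁ (only p∈ (~-sym a) , refl)
              module J₁ = Joined (join pre (~-sym s~x) W.path cross₁)
              cross₂ : ∀ {p q} → p ∈ₚ J₁.path → q ∈ₚ N.tail → (p ≡ r × q ≡ m c) ⊎ Far p q
              cross₂ {p} {q} p∈ q∈ with J₁.from p∈
              ... | inj₁ n with cross (≢-sym c≢d) (pre⊆ n) (N.sub q∈)
              ...   | inj₁ (_ , e) = contradiction e (N.fresh q∈)
              ...   | inj₂ (inj₁ (refl , _)) = contradiction n l∉pre
              ...   | inj₂ (inj₂ f) = inj₂ f
              cross₂ {p} {q} p∈ q∈ | inj₂ n with p ~? q | q ≟ m c
              ... | no p≁q | _ = inj₂ (off-walk (W.from n) (c , N.sub q∈) , p≁q)
              ... | yes a | yes refl = inj₁ (only-m (W.from n) a , refl)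
              ... | yes a | no q≢m with onlyl (W.from n) (q , (c , N.sub q∈) , N.fresh q∈ , q≢m , a)
              ...   | refl = contradiction (N.sub q∈) ([ (λ { refl → λ o → disjoint c≢d o z∈ }) , (λ { refl → λ o → disjoint c≢d o y∈ }) ]
                               (unique (C.onˡ (N.sub q∈)) a))
              module J₂ = Joined (join J₁.path r~m N.tail cross₂)
              cross₃ : ∀ {p q} → p ∈ₚ J₂.path → q ∈ₚ ⟨ l t ⟩ → (p ≡ l c × q ≡ l t) ⊎ Far p q
              cross₃ {p} p∈ (here refl) with J₂.from p∈
              ... | inj₂ n with cross c≢t (N.sub n) (l∈ t)
              ...   | inj₁ (e , _) = contradiction e (N.fresh n)
              ...   | inj₂ e = e
              cross₃ {p} p∈ (here refl) | inj₁ n with J₁.from n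
              ... | inj₂ n′ = inj₂ (off-walk (W.from n′) (t , l∈ t) , λ a → sub (W.from n′) (closed-l (~-sym a)))
              ... | inj₁ n′ with cross d≢t (pre⊆ n′) (l∈ t)
              ...   | inj₁ (_ , e) = contradiction (sym e) (k≢l t)
              ...   | inj₂ (inj₁ (refl , _)) = contradiction n′ l∉pre
              ...   | inj₂ (inj₂ f) = inj₂ f
              module J₃ = Joined (join J₂.path (ll c≢t) ⟨ l t ⟩ cross₃)
              parts : ∀ {v} → v ∈ₚ J₃.path → v ∈ₚ pre ⊎ v ∈ₚ walk ⊎ v ∈ₚ N.tail ⊎ v ≡ l t
              parts n with J₃.from n
              ... | inj₂ (here e) = inj₂ (inj₂ (inj₂ e))
              ... | inj₁ n₁ with J₂.from n₁
              ...   | inj₂ n₂ = inj₂ (inj₂ (inj₁ n₂))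
              ...   | inj₁ n₂ = map₂ (inj₁ ∘ W.from) (J₁.from n₂)
              kt-only : ∀ {v} → v ∈ₚ J₃.path → k t ~ v → v ≡ k d ⊎ v ≡ l t
              kt-only n a with parts n
              ... | inj₁ o with cross (≢-sym d≢t) (k∈ t) (pre⊆ o)
              ...   | inj₁ (_ , e) = inj₁ e
              ...   | inj₂ (inj₁ (e , _)) = contradiction e (k≢l t)
              ...   | inj₂ (inj₂ f) = contradiction a (proj₂ f)
              kt-only n a | inj₂ (inj₁ o) = contradiction (closed-k a) (sub o)
              kt-only n a | inj₂ (inj₂ (inj₁ o)) = contradiction a (proj₂ (k-far (≢-sym c≢t) (N.sub o) (N.fresh o)))
              kt-only n a | inj₂ (inj₂ (inj₂ e)) = inj₂ e
              C′ : Cyc (k t)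
              C′ = record
                { arc = J₃.path ; u~a = kk (≢-sym d≢t) ; z~u = ~-sym thin
                ; a≢z = λ e → disjoint d≢t (k∈ d) (subst (_∈ₚ path t) (sym e) (l∈ t))
                ; only = kt-only
                ; u∉ = λ n → case parts n of λ
                    { (inj₁ o) → disjoint d≢t (pre⊆ o) (k∈ t)
                    ; (inj₂ (inj₁ o)) → sub o (t , k∈ t)
                    ; (inj₂ (inj₂ (inj₁ o))) → disjoint c≢t (N.sub o) (k∈ t)
                    ; (inj₂ (inj₂ (inj₂ e))) → k≢l t e } }
              kc∉ : ¬ k c ∈ₒ C′
              kc∉ (inj₁ e) = kk≢ c≢t e
              kc∉ (inj₂ n) with parts n
              ... | inj₁ o = disjoint c≢d (k∈ c) (pre⊆ o)
              ... | inj₂ (inj₁ o) = sub o (c , k∈ c)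
              ... | inj₂ (inj₂ (inj₁ o)) = N.fresh o refl
              ... | inj₂ (inj₂ (inj₂ e)) = proj₂ (off-t c≢t (k∈ c)) e

            -- The two adjacent vertices can only be `l c` and `l d`. On the cycle of the paths `c`
            -- and `t`, `s` then sees `l c` alone.
            corner : z ∈ₚ path c → y ∈ₚ path d → Bad
            corner z∈ y∈ with cross c≢d z∈ y∈
            ... | inj₁ (e , _) = contradiction e z≢k
            ... | inj₂ (inj₂ f) = contradiction z~y (proj₂ f)
            ... | inj₂ (inj₁ (refl , refl)) =
              pinched D.cyc D.on⊆ (D.onˡ (m∈ c)) (D.onˡ z∈) z≢k z≢m s~z λ w∈ a →
                [ id , (λ { refl → contradiction w∈ ([ (λ o → disjoint c≢d o y∈) , (λ o → disjoint d≢t y∈ o) ] ∘ D.on⁻) }) ]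
                  (unique (on-cycle (D.on⊆ w∈) a) a)
              where module D = CycleOf Q c≢t

            both-c : z ∈ₚ path c → y ∈ₚ path c → Bad
            both-c z∈ y∈ with gap (path c) z∈ y∈ z~y
            ... | inj₁ g = Necklace.bad R r~m only-m r≢s g s~z s~y unique z≢k z≢m y≢k
            ... | inj₂ g = Necklace.bad R r~m only-m r≢s g s~y s~z (λ w∈ a → swap (unique w∈ a)) y≢k y≢m z≢k

          touching-two : r ≢ s → ∀ {z y} → z ∈ₒ C.cyc → y ∈ₒ C.cyc → z ≢ k c → z ≢ m c → s ~ z → s ~ y → z ~ y →
                         (∀ {w} → w ∈ₒ C.cyc → s ~ w → w ≡ z ⊎ w ≡ y) → Bad
          touching-two r≢s {z} {y} z∈ y∈ z≢k z≢m s~z s~y z~y unique = go (C.on⁻ z∈) (C.on⁻ y∈)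
            where
            y≢k : y ≢ k c
            y≢k refl = r≢s (sym (onlyk (end∈ walk) (~-sym s~y)))
            y≢m : y ≢ m c
            y≢m refl = r≢s (sym (only-m (end∈ walk) s~y))
            go : z ∈ₚ path c ⊎ z ∈ₚ path d → y ∈ₚ path c ⊎ y ∈ₚ path d → Bad
            go (inj₁ a) (inj₁ b) = TwoEnds.both-c r≢s z≢k z≢m s~z y≢k y≢m s~y z~y unique a b
            go (inj₁ a) (inj₂ b) = TwoEnds.corner r≢s z≢k z≢m s~z y≢k y≢m s~y z~y unique a b
            go (inj₂ a) (inj₁ b) = TwoEnds.corner r≢s y≢k y≢m s~y z≢k z≢m s~z (~-sym z~y) (λ w∈ a → swap (unique w∈ a)) b a
            go (inj₂ a) (inj₂ b) = TwoEnds.both-d r≢s z≢k z≢m s~z y≢k y≢m s~y z~y unique a b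

          -- A walk of one vertex is a hub over `k c`, `m c` and `z`. Otherwise the neighbours of
          -- `s` on the cycle decide: a single one is `pinched`, three or two nonadjacent ones are
          -- excluded, and two adjacent ones are left to `touching-two`.
          touching : ∀ {z} → z ∈ₒ C.cyc → z ≢ k c → z ≢ m c → s ~ z → Bad
          touching {z} z∈ z≢k z≢m s~z with r ≟ s
          ... | yes refl = wheel C.cyc (sub (end∈ walk) ∘ C.on⊆) (inj₁ refl) (C.onˡ (m∈ c)) z∈
                             (~⇒≢ N.x~b) (≢-sym z≢k) (≢-sym z≢m) (~-sym k~r) r~m s~z
          ... | no r≢s with any? (λ y → (y ∈ₒ? C.cyc) ×-dec (s ~? y) ×-dec ¬? (y ≟ z))
          ...   | no ¬y = pinched C.cyc C.on⊆ (C.onˡ (m∈ c)) z∈ z≢k z≢m s~z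
                            (λ {w} w∈ a → decidable-stable (w ≟ z) (λ w≢z → ¬y (w , w∈ , a , w≢z)))
          ...   | yes (y , y∈ , s~y , y≢z) with z ~? y
          ...     | no z≁y = two-neighbours C.cyc (sub (end∈ walk) ∘ C.on⊆) z∈ y∈ (≢-sym y≢z , z≁y) s~z s~y
          ...     | yes z~y with any? (λ w → (w ∈ₒ? C.cyc) ×-dec (s ~? w) ×-dec ¬? (w ≟ z) ×-dec ¬? (w ≟ y))
          ...       | yes (w , w∈ , s~w , w≢z , w≢y) =
                        wheel C.cyc (sub (end∈ walk) ∘ C.on⊆) z∈ y∈ w∈ (≢-sym y≢z) (≢-sym w≢z) (≢-sym w≢y) s~z s~y s~w
          ...       | no ¬w = touching-two r≢s z∈ y∈ z≢k z≢m s~z s~y z~y λ {w} w∈ a → case w ≟ z of λ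
                        { (yes e) → inj₁ e
                        ; (no e)  → inj₂ (decidable-stable (w ≟ y) (λ e′ → ¬w (w , w∈ , a , e , e′))) }

        -- The cases are where the walk sees `m c`: from a vertex other than `r`, from `r` only, or
        -- not at all, when it is an attachment at `k c`.
        leaving-bad : Bad
        leaving-bad with Bd | any? (λ v → (v ∈ₚ? walk) ×-dec (v ~? m c) ×-dec ¬? (v ≟ r)) | r ~? m c
        ... | z , z∈ , z≢k , z≢m , s~z | yes (v , v∈ , v~m , v≢r) | _ = skipping (on-cycle z∈ s~z) z≢k z≢m s~z v∈ v~m v≢r
        ... | z , z∈ , z≢k , z≢m , s~z | no ¬v | yes r~m = touching r~m
              (λ {v} n a → decidable-stable (v ≟ r) (λ v≢r → ¬v (v , n , a , v≢r))) (on-cycle z∈ s~z) z≢k z≢m s~z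
        ... | z , z∈ , z≢k , z≢m , s~z | no ¬v | no r≁m = attachment-bad {Q = Q} {c}
              (record { walk = walk ; off = sub ; k~r = k~r ; onlyk = onlyk
                      ; onlys = λ {v} {w} n w∈ w≢k a → case w ≟ m c of λ
                          { (yes refl) → contradiction a (m≁ n) ; (no w≢m) → onlyl n (w , w∈ , w≢k , w≢m , a) } }) m≁ z∈ z≢k s~z
          where
          m≁ : ∀ {v} → v ∈ₚ walk → ¬ v ~ m c
          m≁ {v} n a with v ≟ r
          ... | yes refl = r≁m a
          ... | no v≢r = ¬v (v , n , a , v≢r)

      -- The set for `cut-span`: `k c` and all components off the prism that are attached to it.
      Side : Vertex → Set
      Side v = v ≡ k c ⊎ ∃[ w ] k c ~ w × Walk (Off Q) w v

      side-leave : ∀ {p q} → Side p → p ~ q → q ≢ k t → Side q ⊎ q ≡ m c ⊎ (p ≡ k c × q ≡ k d) ⊎ Bad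
      side-leave {p} {q} (inj₁ refl) a q≢k with ∈π? Q q
      ... | no q∉ = inj₁ (inj₂ (q , a , stop q∉))
      ... | yes (i , q∈) with i ≟ c | i ≟ d
      ...   | yes refl | _ = inj₂ (inj₁ ([ (λ e → contradiction (sym e) (~⇒≢ a)) , (λ n → N.only n a) ] (N.from q∈)))
      ...   | no i≢c | i≟d with q ≟ k i
      ...     | no q≢ki = contradiction a (proj₂ (k-far (≢-sym i≢c) q∈ q≢ki))
      ...     | yes refl with i≟d
      ...       | yes refl = inj₂ (inj₂ (inj₁ (refl , refl)))
      ...       | no i≢d with i ≟ t
      ...         | yes refl = contradiction refl q≢k
      ...         | no i≢t = [ (λ e → contradiction e i≢c) , (λ e → contradiction e i≢d) ] (covers i≢t)
      side-leave {p} {q} (inj₂ (w , k~w , ω)) a q≢k with ∈π? Q q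
      ... | no q∉ = inj₁ (inj₂ (w , k~w , ω ⊕ walk-edge (walk-end ω) q∉ a))
      ... | yes q∈ with q ≟ k c | q ≟ m c
      ...   | yes e | _ = inj₁ (inj₁ e)
      ...   | no _ | yes e = inj₂ (inj₁ e)
      ...   | no q≢k | no q≢m = inj₂ (inj₂ (inj₂ (LeavingPath.leaving-bad
                (connector (k c ~?_) leaving? ω k~w (q , q∈ , q≢k , q≢m , a)))))

      -- By `side-leave`, the side of `k c` in G - `k t` has only `m c` and the edge `k c k d` as
      -- exits. So the Hamiltonian cycle uses this edge, and `k t`, which sees both its ends,
      -- replaces it.
      thin-bad : Bad
      thin-bad = [ insert , id ] (cut-span (minimal (λ v → ¬? (v ≟ k t)) two-connected (k t , λ ¬e → ¬e refl)) Side
                     (kk≢ d≢t) (kk≢ c≢t) kd∉ (inj₁ refl) m≢kd side-leave)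
        where
        kd∉ : ¬ Side (k d)
        kd∉ (inj₁ e) = kk≢ (≢-sym c≢d) e
        kd∉ (inj₂ (_ , _ , ω)) = walk-end ω (d , k∈ d)
        m≢kd : m c ≢ k d
        m≢kd e = disjoint c≢d (m∈ c) (subst (_∈ₚ path d) (sym e) (k∈ d))
        split-eq : ∀ w → w ≢ k t ⊎ w ≡ k t
        split-eq w with w ≟ k t
        ... | yes e = inj₂ e
        ... | no ne = inj₁ ne
        insert : Span (_≢ k t) (k d) (k c) → Bad
        insert σ = spanning record
          { three = k c , k d , k t , tt , tt , tt , kk≢ c≢d , kk≢ c≢t , kk≢ d≢t
          ; span = span-cong (λ _ → tt) (λ {w} _ → split-eq w) (span-join σ (kk c≢t) (span-single (k t)) (λ ≢k e → ≢k e))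
          ; v~u = kk (≢-sym d≢t) }

-- Prisms all of whose paths are long or eared, and the exclusion of every prism.

module PrismFree (G : Graph) (setting : Setting G) where
  open ThinPrisms G setting public

  -- The component of `w` off the prism is attached to no prism vertex other than `k i` and `l i`.
  Eared : InducedPrism → Fin 3 → Set
  Eared Q i = ∃[ w ] Off Q w × InducedPrism.k Q i ~ w × ¬ Escape Q i w

  Thick : InducedPrism → Fin 3 → Set
  Thick Q i = ¬ InducedPrism.k Q i ~ InducedPrism.l Q i ⊎ Eared Q i

  thick? : ∀ Q i → Dec (Thick Q i)
  thick? Q i = ¬? (InducedPrism.k Q i ~? InducedPrism.l Q i)
    ⊎-dec any? (λ w → off? Q w ×-dec (InducedPrism.k Q i ~? w) ×-dec ¬? (escape? Q i w))

  module ThickPrism (Q : InducedPrism) where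
    open InducedPrism Q

    record ThickEar (i : Fin 3) : Set₁ where
      field
        S    : Vertex → Set
        ear′ : Ear S (k i) (l i)
        kind : (∀ {v} → S v → v ∈ₚ path i × v ≢ k i × v ≢ l i)
             ⊎ (∃[ w ] k i ~ w × ¬ Escape Q i w × (∀ {v} → S v → Walk (Off Q) w v))

    -- For an eared path, 2-connectedness supplies the ear: a walk from `w` that avoids `k i` must
    -- enter the prism at `l i`, as the component of `w` has no escape.
    thick-ear : ∀ {i} → Thick Q i → ThickEar i
    thick-ear {i} (inj₁ k≁l) = record
      { S = _∈ₚ I.init ; ear′ = ear (along I.init id) N.x~b I.b~y
      ; kind = inj₁ (λ m → N.sub (I.sub m) , N.fresh (I.sub m) , I.fresh m) }
      where
      module N = Uncons (next i)
      module I = Unsnoc (unsnoc N.tail (λ e → k≁l (subst (k i ~_) e N.x~b)))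
    thick-ear {i} (inj₂ (w , w∉ , k~w , ¬esc))
      with exit (∈π? Q) (proj₂ connected (k i) (tt , λ { refl → w∉ (i , k∈ i) }) (tt , ≢-sym (k≢l i))) w∉ (i , l∈ i)
    ... | w′ , z , ω , a , z∈ , _ , z≢k with z ≟ l i
    ...   | no z≢l = contradiction (w′ , walk-map proj₂ ω , z , z∈ , z≢k , z≢l , a) ¬esc
    ...   | yes refl = record
      { S = Walk (Off Q) w ; ear′ = ear (reach (walk-map proj₂ ω)) k~w a ; kind = inj₂ (w , k~w , ¬esc , id) }

    module _ (thick : ∀ i → Thick Q i) where
      private
        module E i = ThickEar (thick-ear (thick i))

        same-side : ∀ i {u v w} → k i ~ w → ¬ Escape Q i w → Walk (Off Q) w u → u ≡ v ⊎ u ~ v → v ∈π Q → v ≡ k i ⊎ v ≡ l i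
        same-side i _ _ ω (inj₁ refl) v∈ = contradiction v∈ (walk-end ω)
        same-side i {u} {v} _ ¬esc ω (inj₂ a) v∈ with v ≟ k i | v ≟ l i
        ... | yes e | _ = inj₁ e
        ... | no _ | yes e = inj₂ e
        ... | no e | no e′ = contradiction (u , ω , v , v∈ , e , e′ , a) ¬esc

        foreign : ∀ {i j v} → i ≢ j → v ∈ₚ path j → ¬ (v ≡ k i ⊎ v ≡ l i)
        foreign {i} i≢j m (inj₁ refl) = disjoint i≢j (k∈ i) m
        foreign {i} i≢j m (inj₂ refl) = disjoint i≢j (l∈ i) m

        apart : ∀ i j → i ≢ j → ∀ u v → E.S i u → E.S j v → Far u v
        apart i j i≢j u v s s′ with far? u v | E.kind i | E.kind j
        ... | yes f | _ | _ = f
        ... | no ¬f | inj₁ p | inj₁ p′ with cross i≢j (proj₁ (p s)) (proj₁ (p′ s′))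
        ...   | inj₁ (e , _) = contradiction e (proj₁ (proj₂ (p s)))
        ...   | inj₂ (inj₁ (e , _)) = contradiction e (proj₂ (proj₂ (p s)))
        ...   | inj₂ (inj₂ f) = f
        apart i j i≢j u v s s′ | no ¬f | inj₁ p | inj₂ (w , a , ¬esc , q) =
          contradiction (same-side j a ¬esc (q s′) (near (¬f ∘ far-sym)) (i , proj₁ (p s))) (foreign (≢-sym i≢j) (proj₁ (p s)))
        apart i j i≢j u v s s′ | no ¬f | inj₂ (w , a , ¬esc , q) | inj₁ p =
          contradiction (same-side i a ¬esc (q s) (near ¬f) (j , proj₁ (p s′))) (foreign i≢j (proj₁ (p s′)))
        apart i j i≢j u v s s′ | no ¬f | inj₂ (w , a , ¬esc , q) | inj₂ (w′ , a′ , ¬esc′ , q′) =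
          contradiction (same-side i a ¬esc (q s ⊕ link (near ¬f) ⊕ walk-rev (q′ s′)) (inj₂ (~-sym a′)) (j , k∈ j)) (foreign i≢j (k∈ j))
          where
          link : u ≡ v ⊎ u ~ v → Walk (Off Q) u v
          link (inj₁ refl) = stop (walk-end (q s))
          link (inj₂ b) = walk-edge (walk-end (q s)) (walk-end (q′ s′)) b

        end∉ : ∀ {i j} v → v ∈ₚ path i → v ≡ k i ⊎ v ≡ l i → ¬ E.S j v
        end∉ {i} {j} v v∈ e s with E.kind j
        ... | inj₂ (_ , _ , _ , q) = walk-end (q s) (i , v∈)
        ... | inj₁ p with i ≟ j
        ...   | yes refl = [ proj₁ (proj₂ (p s)) , proj₂ (proj₂ (p s)) ] e
        ...   | no i≢j = disjoint i≢j v∈ (proj₁ (p s))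

        end-far : ∀ {i j} → i ≢ j → ∀ {x v} → x ∈ₚ path i → E.S j v → ¬ x ~ v
        end-far {i} {j} i≢j x∈ s a with E.kind j
        ... | inj₂ (_ , b , ¬esc , q) = foreign (≢-sym i≢j) x∈ (same-side j b ¬esc (q s) (inj₂ (~-sym a)) (i , x∈))
        ... | inj₁ p with cross i≢j x∈ (proj₁ (p s))
        ...   | inj₁ (_ , e) = proj₁ (proj₂ (p s)) e
        ...   | inj₂ (inj₁ (_ , e)) = proj₂ (proj₂ (p s)) e
        ...   | inj₂ (inj₂ f) = proj₂ f a

        kl-cross : ∀ i j → k i ~ l j → i ≡ j
        kl-cross i j a with i ≟ j
        ... | yes e = e
        ... | no i≢j with cross i≢j (k∈ i) (l∈ j)
        ...   | inj₁ (_ , e) = contradiction (sym e) (k≢l j)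
        ...   | inj₂ (inj₁ (e , _)) = contradiction e (k≢l i)
        ...   | inj₂ (inj₂ f) = contradiction a (proj₂ f)

        kl-distinct : ∀ i j → k i ≢ l j
        kl-distinct i j e with i ≟ j
        ... | yes refl = k≢l i e
        ... | no i≢j = disjoint i≢j (k∈ i) (subst (_∈ₚ path j) (sym e) (l∈ j))

      thick-bad : Bad
      thick-bad = found (fromEars k l E.ear′ apart
        (λ i j → end∉ (k i) (k∈ i) (inj₁ refl)) (λ i j → end∉ (l i) (l∈ i) (inj₂ refl)) kl-distinct
        (inj₂ λ i j i≢j → kk i≢j , λ v s → end-far i≢j (k∈ i) s)
        (inj₂ λ i j i≢j → ll i≢j , λ v s a → end-far i≢j (l∈ i) s (~-sym a))
        (λ i j a → inj₁ (kl-cross i j a)))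

  -- The constructive way to use an inclusion whose counterexamples lead to `Bad`: search for one,
  -- and continue with the inclusion if there is none.
  sweep : ∀ {A B : Vertex → Set} → Decidable₁ A → Decidable₁ B → (∀ {w} → A w → B w ⊎ Bad) → ((∀ {w} → A w → B w) → Bad) → Bad
  sweep A? B? f cont with any? (λ w → A? w ×-dec ¬? (B? w))
  ... | yes (w , a , ¬b) = [ (λ b → contradiction b ¬b) , id ] (f a)
  ... | no ¬w = cont (λ {w} a → decidable-stable (B? w) (λ ¬b → ¬w (w , a , ¬b)))

  -- For the case that the thin path is itself the one serving as measure: every other path is at
  -- least as long and takes over that role.
  thin-rest : ∀ {x y} (π : IPath x y) → x ~ y → length (rest π) ≤ 1
  thin-rest (ipath []) _ = z≤n
  thin-rest (ipath (_ ∷ [])) _ = s≤s z≤n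
  thin-rest (ipath ((_ , fs) ∷ _ ∷ π)) a = contradiction a (proj₂ (All.lookup fs (induced-end π)))

  -- Induction on how much the path b falls short of the number of vertices.
  prism-bad : ∀ fuel Q b → order ≤ length (rest (InducedPrism.path Q b)) + fuel → Bad
  prism-bad zero Q b bound = contradiction
    (≤-trans (injective⇒≤ (induced-injective (induced (InducedPrism.path Q b)))) (≤-trans bound (≤-reflexive (+-identityʳ _)))) 1+n≰n
  prism-bad (suc fuel) Q b bound with any? (λ i → ¬? (thick? Q i))
  ... | no ¬t = ThickPrism.thick-bad Q (λ i → decidable-stable (thick? Q i) (λ ¬th → ¬t (i , ¬th)))
  ... | yes (t , ¬th) =
    sweep (k t ~?_) (∈π? Q) (thin-closed-k Q thin esc) λ ck →
    sweep (l t ~?_) (∈π? Q) (thin-closed-l Q thin esc) λ cl →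
    choose ck cl
    where
    open InducedPrism Q
    thin : k t ~ l t
    thin = decidable-stable (k t ~? l t) (¬th ∘ inj₁)
    esc : ∀ {w} → Off Q w → k t ~ w → Escape Q t w
    esc {w} w∉ a = decidable-stable (escape? Q t w) (λ ¬e → ¬th (inj₂ (w , w∉ , a , ¬e)))
    longer : ∀ d → length (rest (path b)) ≤ length (rest (path d)) →
             ∀ Q′ i → length (rest (path d)) < length (rest (InducedPrism.path Q′ i)) → Bad
    longer d b≤d Q′ i d<i = prism-bad fuel Q′ i
      (≤-trans bound (≤-trans (≤-reflexive (+-suc _ fuel)) (+-monoˡ-≤ fuel (≤-trans (s≤s b≤d) d<i))))
    choose : (∀ {w} → k t ~ w → w ∈π Q) → (∀ {w} → l t ~ w → w ∈π Q) → Bad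
    choose ck cl with t ≟ b
    ... | no t≢b = let (c , c≢t , c≢b , _) = third t≢b in
      ThinStep.thin-bad G setting Q c≢t (≢-sym t≢b) c≢b thin ck cl (longer b ≤-refl)
    ... | yes refl = let (d , d≢t) = other t ; (c , c≢t , c≢d , _) = third (≢-sym d≢t) in
      ThinStep.thin-bad G setting Q c≢t d≢t c≢d thin ck cl
        (longer d (≤-trans (thin-rest (path t) thin) (rest-pos (path d) (k≢l d))))

  no-prism : InducedPrism → Bad
  no-prism Q = prism-bad order Q 0F (m≤n+m _ _)

-- Paths whose neighbours on an induced cycle spread beyond an edge.

module Components (G : Graph) (setting : Setting G) where
  open PrismFree G setting public

  Sees : ∀ {u x y} → Cyc u → IPath x y → Vertex → Set
  Sees C π p = p ∈ₒ C × ∃[ v ] v ∈ₚ π × v ~ p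

  sees? : ∀ {u x y} (C : Cyc u) (π : IPath x y) p → Dec (Sees C π p)
  sees? C π p = (p ∈ₒ? C) ×-dec any? (λ v → (v ∈ₚ? π) ×-dec (v ~? p))

  -- The neighbours of π on C do not lie within an edge of C.
  Wide : ∀ {u x y} → Cyc u → IPath x y → Set
  Wide C π = (∃[ p ] ∃[ q ] Sees C π p × Sees C π q × Far p q)
           ⊎ (∃[ p ] ∃[ q ] ∃[ r ] Sees C π p × Sees C π q × Sees C π r × p ≢ q × p ≢ r × q ≢ r)

  widen : ∀ {u x y x′ y′} {C : Cyc u} {π : IPath x y} {ρ : IPath x′ y′} → (∀ {p} → Sees C π p → Sees C ρ p) → Wide C π → Wide C ρ
  widen f (inj₁ (p , q , a , b , e)) = inj₁ (p , q , f a , f b , e)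
  widen f (inj₂ (p , q , r , a , b , c , e)) = inj₂ (p , q , r , f a , f b , f c , e)

  private
    -- A vertex h of C sees both its neighbours on C and the path, which close up to a cycle avoiding h.
    mid-rim : ∀ {h} (C : Cyc h) {r s} (R : IPath r s) → (∀ {v} → v ∈ₚ R → ¬ v ∈ₒ C) → r ~ Cyc.a C → s ~ Cyc.z C →
              (∀ {v} → v ∈ₚ R → v ~ Cyc.a C → v ≡ r) → (∀ {v w} → v ∈ₚ R → w ∈ₚ arc C → w ≢ Cyc.a C → v ~ w → v ≡ s × w ≡ Cyc.z C) →
              (∃[ v ] v ∈ₚ R × v ~ h) → Bad
    mid-rim {h} C {r} {s} R off r~a s~z only-a only-z (v , v∈ , v~h) =
      wheel C′ h∉ (inj₁ refl) (inj₂ (J.right (W.to (end∈ U.tail)))) (inj₂ (J.left v∈))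
        a≢z (≢-sym (off≢ v∈ (inj₂ (start∈ (arc C))))) (≢-sym (off≢ v∈ (inj₂ (end∈ (arc C))))) u~a (~-sym z~u) (~-sym v~h)
      where
      open Cyc C hiding (arc)
      module U = Uncons (uncons (arc C) a≢z)
      module W = Reversed (reversed U.tail)
      off≢ : ∀ {v w} → v ∈ₚ R → w ∈ₒ C → v ≢ w
      off≢ m n refl = off m n
      cross : ∀ {p q} → p ∈ₚ R → q ∈ₚ W.path → (p ≡ s × q ≡ z) ⊎ Far p q
      cross {p} {q} m n with p ~? q
      ... | no p≁q = inj₂ (off≢ m (inj₂ (U.sub (W.from n))) , p≁q)
      ... | yes e = inj₁ (only-z m (U.sub (W.from n)) (U.fresh (W.from n)) e)
      module J = Joined (join R s~z W.path cross)
      C′ : Cyc a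
      C′ = record
        { arc = J.path ; u~a = ~-sym r~a ; z~u = ~-sym U.x~b ; a≢z = off≢ (start∈ R) (inj₂ (U.sub (here refl)))
        ; only = λ m e → case J.from m of λ { (inj₁ n) → inj₁ (only-a n (~-sym e)) ; (inj₂ n) → inj₂ (U.only (W.from n) e) }
        ; u∉ = λ m → case J.from m of λ { (inj₁ n) → off n (inj₂ (start∈ (arc C))) ; (inj₂ n) → U.fresh (W.from n) refl } }
      h∉ : ¬ h ∈ₒ C′
      h∉ (inj₁ e) = ~⇒≢ u~a e
      h∉ (inj₂ m) = [ (λ n → off n (inj₁ refl)) , (λ n → u∉ (U.sub (W.from n))) ] (J.from m)

    -- The path joins the edge α z of C to another edge of C, which makes a prism.
    rungs : ∀ {α} (C : Cyc α) {r s} (R : IPath r s) → (∀ {v} → v ∈ₚ R → ¬ v ∈ₒ C) → r ≢ s →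
            r ~ α → r ~ Cyc.z C → ∀ {β₁ β₂} → Gap (arc C) β₁ β₂ → s ~ β₁ → s ~ β₂ → Cyc.z C ≢ β₂ →
            (∀ {v w} → v ∈ₚ R → w ∈ₒ C → v ~ w → (v ≡ r × (w ≡ α ⊎ w ≡ Cyc.z C)) ⊎ (v ≡ s × (w ≡ β₁ ⊎ w ≡ β₂))) → Bad
    rungs {α} C {r} {s} R off r≢s r~α r~z {β₁} {β₂} gp s~β₁ s~β₂ z≢β₂ touch = no-prism record
      { k = k′ ; l = l′ ; path = path′
      ; k≢l = fin3 r≢s (λ { refl → u∉ (g.α⊆ (end∈ g.α)) }) z≢β₂
      ; kk = λ {i} {j} → distinct3 {λ i j → k′ i ~ k′ j} (λ _ _ → ~-sym) r~α r~z (~-sym z~u) i j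
      ; ll = λ {i} {j} → distinct3 {λ i j → l′ i ~ l′ j} (λ _ _ → ~-sym) s~β₁ s~β₂ g.x~y i j
      ; cross = λ {i} {j} i≢j {p} {q} → distinct3 {Rel} flipped cross01 cross02 cross12 i j i≢j }
      where
      open Cyc C hiding (arc)
      module g = Gap gp
      module W = Reversed (reversed g.β)
      cross₁ : ∀ {p q} → p ∈ₚ ⟨ α ⟩ → q ∈ₚ g.α → (p ≡ α × q ≡ a) ⊎ Far p q
      cross₁ {_} {q} (here refl) n with α ~? q
      ... | no ≁ = inj₂ (≢-sym (∈∉⇒≢ (g.α⊆ n) u∉) , ≁)
      ... | yes e with only (g.α⊆ n) e
      ...   | inj₁ e′ = inj₁ (refl , e′)
      ...   | inj₂ refl = contradiction (end∈ g.β) (g.apart n)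
      module J = Joined (join ⟨ α ⟩ u~a g.α cross₁)
      k′ l′ : Fin 3 → Vertex
      k′ = fin3 r α z
      l′ = fin3 s β₁ β₂
      path′ : ∀ i → IPath (k′ i) (l′ i)
      path′ = fin3 R J.path W.path
      Rel : Fin 3 → Fin 3 → Set
      Rel i j = ∀ {p q} → p ∈ₚ path′ i → q ∈ₚ path′ j → (p ≡ k′ i × q ≡ k′ j) ⊎ (p ≡ l′ i × q ≡ l′ j) ⊎ Far p q
      flipped : ∀ i j → Rel i j → Rel j i
      flipped i j f p∈ q∈ with f q∈ p∈
      ... | inj₁ (e , e′) = inj₁ (e′ , e)
      ... | inj₂ (inj₁ (e , e′)) = inj₂ (inj₁ (e′ , e))
      ... | inj₂ (inj₂ h) = inj₂ (inj₂ (far-sym h))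
      on₁ : ∀ {q} → q ∈ₚ J.path → q ≡ α ⊎ q ∈ₚ g.α
      on₁ q∈ with J.from q∈
      ... | inj₁ (here e) = inj₁ e
      ... | inj₂ n = inj₂ n
      not₁ : ∀ {q} → q ∈ₚ J.path → q ∉ₚ g.β
      not₁ q∈ n with on₁ q∈
      ... | inj₁ refl = u∉ (g.β⊆ n)
      ... | inj₂ o = g.apart o n
      C₁ : ∀ {q} → q ∈ₚ J.path → q ∈ₒ C
      C₁ q∈ = map₂ g.α⊆ (on₁ q∈)
      off≢ : ∀ {v w} → v ∈ₚ R → w ∈ₒ C → v ≢ w
      off≢ m n refl = off m n
      cross01 : Rel 0F 1F
      cross01 {p} {q} p∈ q∈ with p ~? q
      ... | no ≁ = inj₂ (inj₂ (off≢ p∈ (C₁ q∈) , ≁))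
      ... | yes e with touch p∈ (C₁ q∈) e
      ...   | inj₁ (e₁ , inj₁ e₂) = inj₁ (e₁ , e₂)
      ...   | inj₁ (_ , inj₂ refl) = contradiction (end∈ g.β) (not₁ q∈)
      ...   | inj₂ (e₁ , inj₁ e₂) = inj₂ (inj₁ (e₁ , e₂))
      ...   | inj₂ (_ , inj₂ refl) = contradiction (start∈ g.β) (not₁ q∈)
      cross02 : Rel 0F 2F
      cross02 {p} {q} p∈ q∈ with p ~? q
      ... | no ≁ = inj₂ (inj₂ (off≢ p∈ (inj₂ (g.β⊆ (W.from q∈))) , ≁))
      ... | yes e with touch p∈ (inj₂ (g.β⊆ (W.from q∈))) e
      ...   | inj₁ (_ , inj₁ refl) = contradiction (g.β⊆ (W.from q∈)) u∉
      ...   | inj₁ (e₁ , inj₂ e₂) = inj₁ (e₁ , e₂)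
      ...   | inj₂ (_ , inj₁ refl) = contradiction (W.from q∈) (g.apart (end∈ g.α))
      ...   | inj₂ (e₁ , inj₂ e₂) = inj₂ (inj₁ (e₁ , e₂))
      cross12 : Rel 1F 2F
      cross12 {p} {q} p∈ q∈ with on₁ p∈
      ... | inj₂ n = inj₂ (g.across n (W.from q∈))
      ... | inj₁ refl with α ~? q
      ...   | no ≁ = inj₂ (inj₂ (≢-sym (∈∉⇒≢ (g.β⊆ (W.from q∈)) u∉) , ≁))
      ...   | yes e with only (g.β⊆ (W.from q∈)) e
      ...     | inj₂ e′ = inj₁ (refl , e′)
      ...     | inj₁ refl = contradiction (W.from q∈) (g.apart (start∈ g.α))

    module Step {u : Vertex} (C : Cyc u) {r s : Vertex} (R : IPath r s) (off : ∀ {v} → v ∈ₚ R → ¬ v ∈ₒ C) (r≢s : r ≢ s)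
      (U : Uncons R) (I : Unsnoc R) (badU : Wide C (Uncons.tail U) → Bad) (badI : Wide C (Unsnoc.init I) → Bad)
      {α β : Vertex} (α∈ : α ∈ₒ C) (β∈ : β ∈ₒ C) (r~α : r ~ α) (s~β : s ~ β)
      (onlyα : ∀ {v} → v ∈ₚ R → v ~ α → v ≡ r) (onlyβ : ∀ {v} → v ∈ₚ R → v ~ β → v ≡ s) where

      private
        module U = Uncons U
        module I = Unsnoc I
        r∈ = start∈ R
        s∈ = end∈ R
        s∈tail = end∈ U.tail
        r∈init = start∈ I.init

      α≢β : α ≢ β
      α≢β refl = r≢s (sym (onlyα s∈ s~β))

      -- The path without `s` sees `α` and `h`. If it is not wide, these are adjacent and it sees
      -- nothing else; likewise for the path without `r` and `β`, `h`. Then `α`, `h`, `β` are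
      -- consecutive on `C` and are all that `R` sees, so `mid-rim` applies.
      middle : ∀ {h} → Sees C I.init h → Sees C U.tail h → Bad
      middle {h} seesI@(h∈ , v , v∈ , v~h) seesU = go (h ~? α) (h ~? β)
        where
        h≢α : h ≢ α
        h≢α refl = let (_ , w , w∈ , a) = seesU in U.fresh w∈ (onlyα (U.sub w∈) a)
        h≢β : h ≢ β
        h≢β refl = I.fresh v∈ (onlyβ (I.sub v∈) v~h)
        stray : ∀ {w} → Sees C R w × w ≢ h × w ≢ α → w ≡ β ⊎ Bad
        stray {w} ((w∈ , x , x∈ , x~w) , w≢h , w≢α) with w ≟ β | I.from x∈
        ... | yes e | _ = inj₁ e
        ... | no w≢β | inj₁ refl = inj₂ (badU (inj₂ (β , h , w , (β∈ , s , s∈tail , s~β) , seesU , (w∈ , s , s∈tail , x~w) , ≢-sym h≢β , ≢-sym w≢β , ≢-sym w≢h)))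
        ... | no w≢β | inj₂ n = inj₂ (badI (inj₂ (α , h , w , (α∈ , r , r∈init , r~α) , seesI , (w∈ , x , n , x~w) , ≢-sym h≢α , ≢-sym w≢α , ≢-sym w≢h)))
        rim : (D : Rotation C h) → Cyc.a (Rotation.cyc D) ≡ α → Cyc.z (Rotation.cyc D) ≡ β → (∀ {w} → Sees C R w × w ≢ h × w ≢ α → w ≡ β) → Bad
        rim D refl refl only-β = mid-rim D.cyc R (λ m → off m ∘ D.from) r~α s~β onlyα
          (λ {x} {w} m n w≢a x~w → let w≡β = only-β ((D.from (inj₂ n) , x , m , x~w) , ∈∉⇒≢ n (Cyc.u∉ D.cyc) , w≢a)
                                   in onlyβ m (subst (x ~_) w≡β x~w) , w≡β) (v , I.sub v∈ , v~h)
          where module D = Rotation D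
        go : Dec (h ~ α) → Dec (h ~ β) → Bad
        go (no h≁α) _ = badI (inj₁ (h , α , seesI , (α∈ , r , r∈init , r~α) , h≢α , h≁α))
        go (yes _) (no h≁β) = badU (inj₁ (h , β , seesU , (β∈ , s , s∈tail , s~β) , h≢β , h≁β))
        go (yes h~α) (yes h~β) = sweep (λ w → sees? C R w ×-dec ¬? (w ≟ h) ×-dec ¬? (w ≟ α)) (_≟ β) stray λ only-β →
            orient (rotate C h∈) only-β
          where
          orient : Rotation C h → (∀ {w} → Sees C R w × w ≢ h × w ≢ α → w ≡ β) → Bad
          orient ρ only-β = pick (Cyc.only ρ.cyc (on α∈ (≢-sym h≢α)) h~α) (Cyc.only ρ.cyc (on β∈ (≢-sym h≢β)) h~β)
            where
            module ρ = Rotation ρ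
            on : ∀ {x} → x ∈ₒ C → x ≢ h → x ∈ₚ arc ρ.cyc
            on x∈ x≢h = [ (λ e → contradiction e x≢h) , id ] (ρ.to x∈)
            pick : α ≡ Cyc.a ρ.cyc ⊎ α ≡ Cyc.z ρ.cyc → β ≡ Cyc.a ρ.cyc ⊎ β ≡ Cyc.z ρ.cyc → Bad
            pick (inj₁ e) (inj₂ e′) = rim ρ (sym e) (sym e′) only-β
            pick (inj₂ e) (inj₁ e′) = rim (ρ ⊙ reverse-cyc ρ.cyc) (sym e) (sym e′) only-β
            pick (inj₁ e) (inj₁ e′) = contradiction (trans e (sym e′)) α≢β
            pick (inj₂ e) (inj₂ e′) = contradiction (trans e (sym e′)) α≢β

      -- An inner vertex of `R` belongs to both shortened paths. Hence only `r` and `s` see `C`, and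
      -- they have no common neighbour on it.
      module Ends (separate : ∀ {h} → Sees C I.init h → ¬ Sees C U.tail h) where

        ends : ∀ {v w} → v ∈ₚ R → w ∈ₒ C → v ~ w → v ≡ r ⊎ v ≡ s
        ends {v} {w} v∈ w∈ v~w with U.from v∈ | I.from v∈
        ... | inj₁ e | _ = inj₁ e
        ... | inj₂ _ | inj₁ e = inj₂ e
        ... | inj₂ m | inj₂ n = contradiction (w∈ , v , m , v~w) (separate (w∈ , v , n , v~w))

        not-both : ∀ {w} → w ∈ₒ C → r ~ w → ¬ s ~ w
        not-both w∈ r~w s~w = separate (w∈ , r , r∈init , r~w) (w∈ , s , s∈tail , s~w)

        private
          on : ∀ {p x} (ρ : Rotation C p) → x ∈ₒ C → x ≢ p → x ∈ₚ arc (Rotation.cyc ρ)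
          on ρ x∈ x≢p = [ (λ e → contradiction e x≢p) , id ] (Rotation.to ρ x∈)

        tailα : (∀ {w} → w ∈ₒ C → r ~ w → w ≡ α) → (ρ : Rotation C α) → Tail (Rotation.cyc ρ)
        tailα oneα ρ = record
          { path = R ; off = λ m → off m ∘ Rotation.from ρ ; u~r = ~-sym r~α ; onlyu = λ m a → onlyα m (~-sym a)
          ; onlys = λ {v} {w} m n a → case ends m (Rotation.from ρ (inj₂ n)) a of λ
              { (inj₂ e) → e
              ; (inj₁ refl) → contradiction (oneα (Rotation.from ρ (inj₂ n)) a) (∈∉⇒≢ n (Cyc.u∉ (Rotation.cyc ρ))) } }

        tailβ : (∀ {w} → w ∈ₒ C → s ~ w → w ≡ β) → (ρ : Rotation C β) → Tail (Rotation.cyc ρ)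
        tailβ oneβ ρ = record
          { path = W.path ; off = λ m → off (W.from m) ∘ Rotation.from ρ ; u~r = ~-sym s~β ; onlyu = λ m a → onlyβ (W.from m) (~-sym a)
          ; onlys = λ {v} {w} m n a → case ends (W.from m) (Rotation.from ρ (inj₂ n)) a of λ
              { (inj₁ e) → e
              ; (inj₂ refl) → contradiction (oneβ (Rotation.from ρ (inj₂ n)) a) (∈∉⇒≢ n (Cyc.u∉ (Rotation.cyc ρ))) } }
          where module W = Reversed (reversed R)

        -- If `α` and `β` are not adjacent, `R` is a tail at `α` whose end sees the far vertex `β`.
        -- If they are adjacent, `R` is not wide.
        both-single : (∀ {w} → w ∈ₒ C → r ~ w → w ≡ α) → (∀ {w} → w ∈ₒ C → s ~ w → w ≡ β) → Wide C R → Bad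
        both-single oneα oneβ wide with α ~? β
        ... | no α≁β = tail-far (Rotation.cyc ρ) (tailα oneα ρ) (on ρ β∈ (≢-sym α≢β)) s~β α≁β
          where ρ = rotate C α∈
        ... | yes α~β = ⊥-elim (narrow wide)
          where
          only : ∀ {w} → Sees C R w → w ≡ α ⊎ w ≡ β
          only (w∈ , v , v∈ , a) with ends v∈ w∈ a
          ... | inj₁ refl = inj₁ (oneα w∈ a)
          ... | inj₂ refl = inj₂ (oneβ w∈ a)
          narrow : ¬ Wide C R
          narrow (inj₁ (p , q , x , y , p≢q , p≁q)) with only x | only y
          ... | inj₁ refl | inj₁ refl = p≢q refl
          ... | inj₁ refl | inj₂ refl = p≁q α~β
          ... | inj₂ refl | inj₁ refl = p≁q (~-sym α~β)
          ... | inj₂ refl | inj₂ refl = p≢q refl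
          narrow (inj₂ (p , q , o , x , y , z , p≢q , p≢o , q≢o)) with only x | only y | only z
          ... | inj₁ refl | inj₁ refl | _ = p≢q refl
          ... | inj₁ refl | inj₂ refl | inj₁ refl = p≢o refl
          ... | inj₁ refl | inj₂ refl | inj₂ refl = q≢o refl
          ... | inj₂ refl | inj₁ refl | inj₁ refl = q≢o refl
          ... | inj₂ refl | inj₁ refl | inj₂ refl = p≢o refl
          ... | inj₂ refl | inj₂ refl | _ = p≢q refl

        module Double {α′ β′ : Vertex} (α′∈ : α′ ∈ₒ C) (r~α′ : r ~ α′) (α′≢α : α′ ≢ α) (β′∈ : β′ ∈ₒ C) (s~β′ : s ~ β′) (β′≢β : β′ ≢ β)
          (α~α′ : α ~ α′) (β~β′ : β ~ β′)
          (twoα : ∀ {w} → (w ∈ₒ C × r ~ w) × w ≢ α → w ≡ α′) (twoβ : ∀ {w} → (w ∈ₒ C × s ~ w) × w ≢ β → w ≡ β′) where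

          -- With `α α′` as closing edge of the cycle, `β β′` is an edge of the arc, traversed in
          -- one of two directions, and `R` joins the two edges to a prism.
          ladder : (ρ : Rotation C α) → Cyc.z (Rotation.cyc ρ) ≡ α′ → Bad
          ladder ρ refl with gap (arc (Rotation.cyc ρ)) (on ρ β∈ (≢-sym α≢β)) (on ρ β′∈ (λ { refl → not-both α∈ r~α s~β′ })) β~β′
          ... | inj₁ g = rungs (Rotation.cyc ρ) R (λ m → off m ∘ Rotation.from ρ) r≢s r~α r~α′ g s~β s~β′
                           (λ { refl → not-both α′∈ r~α′ s~β′ }) touch
            where
            touch : ∀ {v w} → v ∈ₚ R → w ∈ₒ Rotation.cyc ρ → v ~ w → (v ≡ r × (w ≡ α ⊎ w ≡ α′)) ⊎ (v ≡ s × (w ≡ β ⊎ w ≡ β′))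
            touch {v} {w} m n a with ends m (Rotation.from ρ n) a | w ≟ α | w ≟ β
            ... | inj₁ refl | yes e | _ = inj₁ (refl , inj₁ e)
            ... | inj₁ refl | no ne | _ = inj₁ (refl , inj₂ (twoα ((Rotation.from ρ n , a) , ne)))
            ... | inj₂ refl | _ | yes e = inj₂ (refl , inj₁ e)
            ... | inj₂ refl | _ | no ne = inj₂ (refl , inj₂ (twoβ ((Rotation.from ρ n , a) , ne)))
          ... | inj₂ g = rungs (Rotation.cyc ρ) R (λ m → off m ∘ Rotation.from ρ) r≢s r~α r~α′ g s~β′ s~β
                           (λ { refl → not-both α′∈ r~α′ s~β }) touch
            where
            touch : ∀ {v w} → v ∈ₚ R → w ∈ₒ Rotation.cyc ρ → v ~ w → (v ≡ r × (w ≡ α ⊎ w ≡ α′)) ⊎ (v ≡ s × (w ≡ β′ ⊎ w ≡ β))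
            touch {v} {w} m n a with ends m (Rotation.from ρ n) a | w ≟ α | w ≟ β
            ... | inj₁ refl | yes e | _ = inj₁ (refl , inj₁ e)
            ... | inj₁ refl | no ne | _ = inj₁ (refl , inj₂ (twoα ((Rotation.from ρ n , a) , ne)))
            ... | inj₂ refl | _ | yes e = inj₂ (refl , inj₂ e)
            ... | inj₂ refl | _ | no ne = inj₂ (refl , inj₁ (twoβ ((Rotation.from ρ n , a) , ne)))

          double-bad : Bad
          double-bad = [ (λ e → ladder (ρ ⊙ reverse-cyc ρ.cyc) (sym e)) , (λ e → ladder ρ (sym e)) ]
                         (Cyc.only ρ.cyc (on ρ α′∈ α′≢α) α~α′)
            where
            ρ = rotate C α∈
            module ρ = Rotation ρ

        second? : ∀ p x → Dec (∃[ w ] w ∈ₒ C × p ~ w × w ≢ x)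
        second? p x = any? (λ w → (w ∈ₒ? C) ×-dec (p ~? w) ×-dec ¬? (w ≟ x))

        unique : ∀ {p x} → ¬ (∃[ w ] w ∈ₒ C × p ~ w × w ≢ x) → ∀ {w} → w ∈ₒ C → p ~ w → w ≡ x
        unique {x = x} ¬w {w} w∈ a = decidable-stable (w ≟ x) (λ ne → ¬w (w , w∈ , a , ne))

        -- A single neighbour at one end and several at the other are a case of `tail-two`. Several
        -- at both ends must be two adjacent ones each, which leads to a prism.
        ends-bad : Wide C R → Bad
        ends-bad wide = go (second? r α) (second? s β)
          where
          go : Dec (∃[ w ] w ∈ₒ C × r ~ w × w ≢ α) → Dec (∃[ w ] w ∈ₒ C × s ~ w × w ≢ β) → Bad
          go (no ¬α) (no ¬β) = both-single (unique ¬α) (unique ¬β) wide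
          go (no ¬α) (yes (β′ , β′∈ , s~β′ , β′≢β)) = tail-two (Rotation.cyc ρ) (tailα (unique ¬α) ρ)
              (on ρ β∈ (≢-sym α≢β)) (on ρ β′∈ (λ { refl → not-both α∈ r~α s~β′ })) (≢-sym β′≢β) s~β s~β′
            where ρ = rotate C α∈
          go (yes (α′ , α′∈ , r~α′ , α′≢α)) (no ¬β) = tail-two (Rotation.cyc ρ) (tailβ (unique ¬β) ρ)
              (on ρ α∈ α≢β) (on ρ α′∈ (λ { refl → not-both β∈ r~α′ s~β })) (≢-sym α′≢α) r~α r~α′
            where ρ = rotate C β∈
          go (yes (α′ , α′∈ , r~α′ , α′≢α)) (yes (β′ , β′∈ , s~β′ , β′≢β)) = near-ends (α ~? α′) (β ~? β′)
            where
            near-ends : Dec (α ~ α′) → Dec (β ~ β′) → Bad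
            near-ends (no ≁) _ = two-neighbours C (off r∈) α∈ α′∈ (≢-sym α′≢α , ≁) r~α r~α′
            near-ends (yes _) (no ≁) = two-neighbours C (off s∈) β∈ β′∈ (≢-sym β′≢β , ≁) s~β s~β′
            near-ends (yes α~α′) (yes β~β′) =
              sweep (λ w → ((w ∈ₒ? C) ×-dec (r ~? w)) ×-dec ¬? (w ≟ α)) (_≟ α′)
                (λ {w} ((w∈ , a) , ne) → case w ≟ α′ of λ
                  { (yes e) → inj₁ e
                  ; (no ne′) → inj₂ (wheel C (off r∈) α∈ α′∈ w∈ (≢-sym α′≢α) (≢-sym ne) (≢-sym ne′) r~α r~α′ a) }) λ twoα →
              sweep (λ w → ((w ∈ₒ? C) ×-dec (s ~? w)) ×-dec ¬? (w ≟ β)) (_≟ β′)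
                (λ {w} ((w∈ , a) , ne) → case w ≟ β′ of λ
                  { (yes e) → inj₁ e
                  ; (no ne′) → inj₂ (wheel C (off s∈) β∈ β′∈ w∈ (≢-sym β′≢β) (≢-sym ne) (≢-sym ne′) s~β s~β′ a) }) λ twoβ →
              Double.double-bad α′∈ r~α′ α′≢α β′∈ s~β′ β′≢β α~α′ β~β′ twoα twoβ

      step-bad : Wide C R → Bad
      step-bad wide with any? (λ h → sees? C I.init h ×-dec sees? C U.tail h)
      ... | yes (h , a , b) = middle a b
      ... | no ¬h = Ends.ends-bad (λ a b → ¬h (_ , a , b)) wide

  -- Induction on the length. If the path without `r`, or without `s`, sees as much of `C`, it is
  -- shorter and still wide; otherwise `Step` applies. A single vertex falls to `two-neighbours` or
  -- is a hub.
  wide-bad : ∀ n {u} (C : Cyc u) {r s} (R : IPath r s) → length (rest R) ≤ n → (∀ {v} → v ∈ₚ R → ¬ v ∈ₒ C) → Wide C R → Bad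
  wide-bad n C {r} {s} R bound off wide with r ≟ s
  ... | yes refl = single wide
    where
    at : ∀ {v} → v ∈ₚ R → v ≡ r
    at {v} m = decidable-stable (v ≟ r) (λ ne → loop R m ne refl)
    sees : ∀ {p} → Sees C R p → r ~ p
    sees (_ , v , m , a) = subst (_~ _) (at m) a
    single : Wide C R → Bad
    single (inj₁ (p , q , x , y , f)) = two-neighbours C (off (start∈ R)) (proj₁ x) (proj₁ y) f (sees x) (sees y)
    single (inj₂ (p , q , o , x , y , z , e₁ , e₂ , e₃)) =
      wheel C (off (start∈ R)) (proj₁ x) (proj₁ y) (proj₁ z) e₁ e₂ e₃ (sees x) (sees y) (sees z)
  wide-bad zero C R bound off wide | no r≢s = contradiction (≤-trans (rest-pos R r≢s) bound) λ ()
  wide-bad (suc n) C {r} {s} R bound off wide | no r≢s = start (any? (λ α → sees? C R α ×-dec ¬? (sees? C U.tail α)))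
                                                              (any? (λ β → sees? C R β ×-dec ¬? (sees? C I.init β)))
    where
    UR = uncons R r≢s
    IR = unsnoc R r≢s
    module U = Uncons UR
    module I = Unsnoc IR
    badU : Wide C U.tail → Bad
    badU = wide-bad n C U.tail (≤-pred (subst (_≤ suc n) U.size bound)) (off ∘ U.sub)
    badI : Wide C I.init → Bad
    badI = wide-bad n C I.init (≤-pred (subst (_≤ suc n) I.size bound)) (off ∘ I.sub)
    start : Dec _ → Dec _ → Bad
    start (no ¬α) _ = badU (widen {C = C} {R} {U.tail} (λ {p} x → decidable-stable (sees? C U.tail p) (λ ¬s → ¬α (p , x , ¬s))) wide)
    start (yes _) (no ¬β) = badI (widen {C = C} {R} {I.init} (λ {p} x → decidable-stable (sees? C I.init p) (λ ¬s → ¬β (p , x , ¬s))) wide)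
    start (yes (α , (α∈ , v , v∈ , v~α) , ¬tail)) (yes (β , (β∈ , w , w∈ , w~β) , ¬init)) =
      Step.step-bad C R off r≢s UR IR badU badI α∈ β∈ (subst (_~ α) (onlyα v∈ v~α) v~α) (subst (_~ β) (onlyβ w∈ w~β) w~β) onlyα onlyβ wide
      where
      onlyα : ∀ {x} → x ∈ₚ R → x ~ α → x ≡ r
      onlyα {x} m a = [ id , (λ n → contradiction (α∈ , x , n , a) ¬tail) ] (U.from m)
      onlyβ : ∀ {x} → x ∈ₚ R → x ~ β → x ≡ s
      onlyβ {x} m a = [ id , (λ n → contradiction (β∈ , x , n , a) ¬init) ] (I.from m)

-- Decidable predicates as subsets, and their sizes.

module _ {n : ℕ} {P : Fin n → Set} (P? : Decidable₁ P) where

  comprehension : Subset n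
  comprehension = Vec.tabulate (does ∘ P?)

  ∈-comprehension⁺ : ∀ {x} → P x → x ∈ₛ comprehension
  ∈-comprehension⁺ {x} p = lookup⇒[]= x comprehension (trans (lookup∘tabulate (does ∘ P?) x) (holds (P? x)))
    where
    holds : (d : Dec (P x)) → does d ≡ true
    holds (yes _) = refl
    holds (no ¬p) = contradiction p ¬p

  ∈-comprehension⁻ : ∀ {x} → x ∈ₛ comprehension → P x
  ∈-comprehension⁻ {x} m = holds (P? x) (trans (sym (lookup∘tabulate (does ∘ P?) x)) ([]=⇒lookup m))
    where
    holds : (d : Dec (P x)) → does d ≡ true → P x
    holds (yes p) _ = p

count : ∀ {n} {P : Fin n → Set} → Decidable₁ P → ℕ
count P? = ∣ comprehension P? ∣

count-strict : ∀ {n} {P Q : Fin n → Set} (P? : Decidable₁ P) (Q? : Decidable₁ Q) → (∀ {x} → P x → Q x) →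
               ∀ {x} → Q x → ¬ P x → count P? < count Q?
count-strict P? Q? P⊆Q q ¬p = p⊂q⇒∣p∣<∣q∣
  (∈-comprehension⁺ Q? ∘ P⊆Q ∘ ∈-comprehension⁻ P? , _ , ∈-comprehension⁺ Q? q , ¬p ∘ ∈-comprehension⁻ P?)

-- Components off an induced cycle.

module MainArgument (G : Graph) (setting : Setting G) where
  open Components G setting public

  Outside : ∀ {u} → Cyc u → Vertex → Set
  Outside C v = ¬ v ∈ₒ C

  Comp : ∀ {u} → Cyc u → Vertex → Vertex → Set
  Comp C = Walk (Outside C)

  comp? : ∀ {u} (C : Cyc u) d v → Dec (Comp C d v)
  comp? C = walk? (λ v → ¬? (v ∈ₒ? C))

  Attached : ∀ {u} → Cyc u → Vertex → Vertex → Set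
  Attached C d x = x ∈ₒ C × ∃[ v ] Comp C d v × v ~ x

  attached? : ∀ {u} (C : Cyc u) d x → Dec (Attached C d x)
  attached? C d x = (x ∈ₒ? C) ×-dec any? (λ v → comp? C d v ×-dec (v ~? x))

  attached-two : ∀ {u} (C : Cyc u) {d x y} → Attached C d x → Attached C d y → Far x y → Bad
  attached-two C {x = x} {y} (x∈ , v , ω , a) (y∈ , w , ω′ , b) far =
    wide-bad _ C path ≤-refl sub (inj₁ (x , y , (x∈ , v , start∈ path , a) , (y∈ , w , end∈ path , b) , far))
    where open PathIn (shorten (walk-rev ω ⊕ ω′))

  private
    module Clique {u : Vertex} (C : Cyc u) {d x y z : Vertex} (x∈ : x ∈ₒ C) (y∈ : y ∈ₒ C) (z∈ : z ∈ₒ C) (x≢z : x ≢ z) (y≢z : y ≢ z)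
      (x~y : x ~ y) (z~x : z ~ x) (z~y : z ~ y) (R : Connector (Comp C d) (x ~_) (_~ y))
      (x≢y : x ≢ y) where
      open Connector R renaming (c to r; d to s)

      off : ∀ {v} → v ∈ₚ path → ¬ v ∈ₒ C
      off m = walk-end (sub m)

      off≢ : ∀ {v w} → v ∈ₚ path → w ∈ₒ C → v ≢ w
      off≢ m n refl = off m n

      cross : ∀ {p q} → p ∈ₚ path → q ∈ₚ ⟨ y ⟩ → (p ≡ s × q ≡ y) ⊎ Far p q
      cross {p} m (here refl) with p ~? y
      ... | yes a = inj₁ (onlyB m a , refl)
      ... | no ≁ = inj₂ (off≢ m y∈ , ≁)
      module J = Joined (join path Bd ⟨ y ⟩ cross)

      C′ : Cyc x
      C′ = record
        { arc = J.path ; u~a = Ac ; z~u = ~-sym x~y ; a≢z = off≢ (start∈ path) y∈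
        ; only = λ m a → case J.from m of λ { (inj₁ n) → inj₁ (onlyA n a) ; (inj₂ (here e)) → inj₂ e }
        ; u∉ = λ m → case J.from m of λ { (inj₁ n) → off n x∈ ; (inj₂ (here e)) → x≢y e } }

      outside : ∀ {v} → v ≢ x → v ≢ y → v ∉ₚ path → Outside C′ v
      outside ≢x ≢y ∉p (inj₁ e) = ≢x e
      outside ≢x ≢y ∉p (inj₂ m) = case J.from m of λ { (inj₁ n) → ∉p n ; (inj₂ (here e)) → ≢y e }

      -- z and the part of the component outside the path form a path with three neighbours on C′.
      bad : ∀ {w} → Comp C d w → w ~ z → Bad
      bad {w} ω w~z with w ∈ₚ? path
      ... | yes m = wide-bad _ C path ≤-refl off (inj₂ (x , y , z , (x∈ , r , start∈ path , ~-sym Ac) , (y∈ , s , end∈ path , Bd)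
                      , (z∈ , w , m , w~z) , x≢y , x≢z , y≢z))
      ... | no w∉ with exit (_∈ₚ? path) (walk-rev ω ⊕ sub (start∈ path)) w∉ (start∈ path)
      ...   | w′ , v , ω′ , b , v∈ , _ =
              wide-bad _ C′ P.path ≤-refl P.sub (inj₂ (x , y , v
                , (inj₁ refl , z , start∈ P.path , z~x) , (inj₂ (J.right (here refl)) , z , start∈ P.path , z~y)
                , (inj₂ (J.left v∈) , w′ , end∈ P.path , b) , x≢y , ≢-sym (off≢ v∈ x∈) , ≢-sym (off≢ v∈ y∈)))
        where
        detour : Walk (Outside C′) z w′
        detour = step (outside (≢-sym x≢z) (≢-sym y≢z) (λ m → off m z∈)) (~-sym w~z)
          (walk-map (λ (o , ∉p) → outside (λ { refl → o x∈ }) (λ { refl → o y∈ }) ∉p) ω′)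
        module P = PathIn (shorten detour)

  -- By `attached-two`, only pairwise adjacent vertices are left, so `C` is a triangle. No single
  -- induced path in the component need see all three of them; `Clique` therefore also uses a cycle
  -- through `x`, `y` and the component.
  attached-three : ∀ {u} (C : Cyc u) {d x y z} → Attached C d x → Attached C d y → Attached C d z →
                   x ≢ y → x ≢ z → y ≢ z → Bad
  attached-three C {x = x} {y} {z} X@(x∈ , v , ω , a) Y@(y∈ , w , ω′ , b) Z@(z∈ , o , ω″ , c) x≢y x≢z y≢z
    with x ~? y | x ~? z | y ~? z
  ... | no ≁ | _ | _ = attached-two C X Y (x≢y , ≁)
  ... | _ | no ≁ | _ = attached-two C X Z (x≢z , ≁)
  ... | _ | _ | no ≁ = attached-two C Y Z (y≢z , ≁)
  ... | yes x~y | yes x~z | yes y~z =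
    Clique.bad C x∈ y∈ z∈ x≢z y≢z x~y (~-sym x~z) (~-sym y~z)
      (connector (x ~?_) (_~? y) (walk-rev (reach ω) ⊕ reach ω′) (~-sym a) b) x≢y ω″ c

  -- The component is attached exactly to the ends of the closing edge of `C`; `smaller` is the
  -- induction hypothesis for components properly contained in it.
  module Edge {u : Vertex} (C : Cyc u) {d : Vertex}
    (atu : Attached C d u) (atz : Attached C d (Cyc.z C)) (ends : ∀ {x} → Attached C d x → x ≡ u ⊎ x ≡ Cyc.z C)
    (smaller : ∀ {u′} (C′ : Cyc u′) {d′} → ¬ d′ ∈ₒ C′ → (∀ {v} → Comp C′ d′ v → Comp C d v) →
               (∃[ v ] Comp C d v × ¬ Comp C′ d′ v) → Bad) where

    private
      module C = Cyc C
      R : Ear (Comp C d) u C.z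
      R = let (_ , _ , ω , a) = atu ; (_ , _ , ω′ , b) = atz in ear (walk-rev (reach ω) ⊕ reach ω′) (~-sym a) b
      open Connector R renaming (c to r; d to s; Ac to u~r; Bd to s~z)
      z∈ : C.z ∈ₒ C
      z∈ = inj₂ (end∈ (arc C))
      u≢z : u ≢ C.z
      u≢z = ≢-sym (~⇒≢ C.z~u)

      off≢ : ∀ {v w} → v ∈ₚ path → w ∈ₒ C → v ≢ w
      off≢ m n refl = walk-end (sub m) n

      extend : ∀ {p q} → Comp C d p → p ~ q → q ≢ u → q ≢ C.z → Comp C d q
      extend {p} {q} ω a q≢u q≢z with q ∈ₒ? C
      ... | no q∉ = ω ⊕ walk-edge (walk-end ω) q∉ a
      ... | yes q∈ = ⊥-elim ([ q≢u , q≢z ] (ends (q∈ , p , ω , a)))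

      module Shrink where
        cross : ∀ {p q} → p ∈ₚ path → q ∈ₚ ⟨ C.z ⟩ → (p ≡ s × q ≡ C.z) ⊎ Far p q
        cross {p} m (here refl) with p ~? C.z
        ... | yes a = inj₁ (onlyB m a , refl)
        ... | no ≁ = inj₂ (off≢ m z∈ , ≁)
        module J = Joined (join path s~z ⟨ C.z ⟩ cross)

        C′ : Cyc u
        C′ = record
          { arc = J.path ; u~a = u~r ; z~u = C.z~u ; a≢z = off≢ (start∈ path) z∈
          ; only = λ m a → case J.from m of λ { (inj₁ n) → inj₁ (onlyA n a) ; (inj₂ (here e)) → inj₂ e }
          ; u∉ = λ m → case J.from m of λ { (inj₁ n) → walk-end (sub n) (inj₁ refl) ; (inj₂ (here e)) → u≢z e } }

        shrink : ∀ {d′} → Comp C d d′ → d′ ∉ₚ path → Bad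
        shrink {d′} ω ∉p = smaller C′
          (λ { (inj₁ refl) → walk-end ω (inj₁ refl)
             ; (inj₂ m) → case J.from m of λ { (inj₁ n) → ∉p n ; (inj₂ (here refl)) → walk-end ω z∈ } })
          -- The new component stays inside the old one, which is attached only to `u` and `C.z`,
          -- and both lie on the new cycle. The inclusion is proper since `r` is now on the cycle.
          (λ ω′ → confined {X = Comp C d} (λ x a q∉ → extend x a (λ e → q∉ (inj₁ e)) (λ { refl → q∉ (inj₂ (J.right (here refl))) })) ω′ ω)
          (r , sub (start∈ path) , λ ω′ → walk-end ω′ (inj₂ (J.left (start∈ path))))

      module Base (all : ∀ {v} → Comp C d v → v ∈ₚ path) where

        enter : ∀ {p q} → p ∉ₚ path → q ∈ₚ path → p ~ q → p ≡ u ⊎ p ≡ C.z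
        enter {p} {q} p∉ q∈ a with p ≟ u | p ≟ C.z
        ... | yes e | _ = inj₁ e
        ... | no _ | yes e = inj₂ e
        ... | no e | no e′ = contradiction (all (extend (sub q∈) (~-sym a) e e′)) p∉

        C∉ : ∀ {v} → v ∈ₒ C → v ∉ₚ path
        C∉ v∈ m = walk-end (sub m) v∈

        end∉ : ∀ {p} → p ≡ u ⊎ p ≡ C.z → p ∉ₚ path
        end∉ (inj₁ refl) = C∉ (inj₁ refl)
        end∉ (inj₂ refl) = C∉ z∈

        bridge : ∀ {w c p y} → c ≡ u ⊎ c ≡ C.z → p ≡ u ⊎ p ≡ C.z → c ≢ w →
                 Walk (λ v → v ∉ₚ path × v ≢ w) p y → Walk (λ v → v ∉ₚ path × v ≢ w) c y
        bridge (inj₁ refl) (inj₁ refl) _ ω = ω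
        bridge (inj₂ refl) (inj₂ refl) _ ω = ω
        bridge e@(inj₁ refl) (inj₂ refl) c≢w ω = step (end∉ e , c≢w) (~-sym C.z~u) ω
        bridge e@(inj₂ refl) (inj₁ refl) c≢w ω = step (end∉ e , c≢w) C.z~u ω

        -- Excursions of a walk into the path are replaced by the edge u z.
        mutual
          avoid : ∀ {w p y} → Walk (λ v → Unit × v ≢ w) p y → p ∉ₚ path → y ∉ₚ path → Walk (λ v → v ∉ₚ path × v ≢ w) p y
          avoid (stop (_ , ≢w)) p∉ _ = stop (p∉ , ≢w)
          avoid (step {v = q} (_ , ≢w) a ω) p∉ y∉ with q ∈ₚ? path
          ... | no q∉ = step (p∉ , ≢w) a (avoid ω q∉ y∉)
          ... | yes q∈ = avoid-in ω q∈ (enter p∉ q∈ a) ≢w y∉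

          avoid-in : ∀ {w p y c} → Walk (λ v → Unit × v ≢ w) p y → p ∈ₚ path → c ≡ u ⊎ c ≡ C.z → c ≢ w → y ∉ₚ path →
                     Walk (λ v → v ∉ₚ path × v ≢ w) c y
          avoid-in (stop _) p∈ _ _ y∉ = contradiction p∈ y∉
          avoid-in (step {v = q} _ a ω) p∈ e c≢w y∉ with q ∈ₚ? path
          ... | yes q∈ = avoid-in ω q∈ e c≢w y∉
          ... | no q∉ = bridge e (enter q∉ p∈ (~-sym a)) c≢w (avoid ω q∉ y∉)

        two-connected : TwoConnected (_∉ₚ path)
        two-connected = (u , C.a , C.z , C∉ (inj₁ refl) , C∉ (inj₂ (start∈ (arc C))) , C∉ z∈ , ~⇒≢ C.u~a , u≢z , C.a≢z)
          , λ w (x∉ , x≢w) (y∉ , y≢w) → avoid (proj₂ connected w (tt , x≢w) (tt , y≢w)) x∉ y∉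

        -- The set for `cut-span`: `u` and all components attached to it except the one formed by
        -- the path.
        Side : Vertex → Set
        Side v = v ≡ u ⊎ ∃[ w ] u ~ w × w ∉ₚ path × Comp C w v

        -- Two components attached to the edge u z, and the rest of C, make a theta with a chord.
        module TwoEars {w q : Vertex} (u~w : u ~ w) (w∉ : w ∉ₚ path) (ω : Comp C w q) (q~z : q ~ C.z) where

          module I = Unsnoc (unsnoc (arc C) C.a≢z)

          S : Fin 3 → Vertex → Set
          S 0F v = v ∈ₚ path
          S 1F v = Comp C w v
          S 2F v = v ∈ₚ I.init

          comp-far : ∀ {x y} → x ∈ₚ path → Comp C w y → Far x y
          comp-far {x} {y} m ω′ with far? x y
          ... | yes f = f
          ... | no ¬f = contradiction (all (sub m ⊕ link (near ¬f) ⊕ walk-rev ω′)) w∉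
            where
            link : x ≡ y ⊎ x ~ y → Comp C x y
            link (inj₁ refl) = stop (walk-end ω′)
            link (inj₂ a) = walk-edge (walk-end (sub m)) (walk-end ω′) a

          arc-far′ : ∀ {x y} → Comp C d x → y ∈ₚ I.init → ¬ x ~ y
          arc-far′ ω′ n a = [ (λ e → contradiction (subst (_∈ₚ arc C) e (I.sub n)) C.u∉) , I.fresh n ] (ends (inj₂ (I.sub n) , _ , ω′ , a))

          bad : Bad
          bad with any? (λ y → (y ∈ₚ? I.init) ×-dec attached? C w y)
          ... | yes (y , n , at) = attached-three C (inj₁ refl , w , stop (walk-start ω) , ~-sym u~w) (z∈ , q , ω , q~z) at
                  u≢z (≢-sym (∈∉⇒≢ (I.sub n) C.u∉)) (≢-sym (I.fresh n))
          ... | no ¬y = theta S u≢z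
            (fin3 (ear (along path id) u~r s~z) (ear (reach ω) u~w q~z) (ear (along I.init id) C.u~a I.b~y))
            (apart3 {S} (λ x y m ω′ → comp-far m ω′)
                        (λ x y m n → off≢ m (inj₂ (I.sub n)) , λ a → arc-far′ (sub m) n a)
                        (λ x y ω′ n → (λ { refl → walk-end ω′ (inj₂ (I.sub n)) })
                                    , λ a → ¬y (y , n , inj₂ (I.sub n) , x , ω′ , a)))
            (fin3 (λ m → walk-end (sub m) (inj₁ refl)) (λ ω′ → walk-end ω′ (inj₁ refl)) (λ m → C.u∉ (I.sub m)))
            (fin3 (λ m → walk-end (sub m) z∈) (λ ω′ → walk-end ω′ z∈) (λ m → I.fresh m refl))

        -- Such a component may be attached to `C.a` besides `u`. Attachment to `C.z` is excluded by
        -- `TwoEars`, and attachment to any other vertex of the arc by `attached-two`, as that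
        -- vertex is not adjacent to `u`.
        leave : ∀ {p q} → Side p → p ~ q → q ∉ₚ path → Side q ⊎ q ≡ C.a ⊎ (p ≡ u × q ≡ C.z) ⊎ Bad
        leave {p} {q} (inj₁ refl) a q∉ with q ∈ₒ? C
        ... | no q∉C = inj₁ (inj₂ (q , a , q∉ , stop q∉C))
        ... | yes (inj₁ e) = inj₁ (inj₁ e)
        ... | yes (inj₂ m) = inj₂ (map₂ (λ e → inj₁ (refl , e)) (C.only m a))
        leave {p} {q} (inj₂ (w , u~w , w∉ , ω)) a q∉ with q ∈ₒ? C
        ... | no q∉C = inj₁ (inj₂ (w , u~w , w∉ , ω ⊕ walk-edge (walk-end ω) q∉C a))
        ... | yes (inj₁ e) = inj₁ (inj₁ e)
        ... | yes (inj₂ m) with q ≟ C.z | u ~? q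
        ...   | yes refl | _ = inj₂ (inj₂ (inj₂ (TwoEars.bad u~w w∉ ω a)))
        ...   | no q≢z | yes u~q = inj₂ (inj₁ ([ id , (λ e → contradiction e q≢z) ] (C.only m u~q)))
        ...   | no _ | no u≁q = inj₂ (inj₂ (inj₂ (attached-two C
                  (inj₁ refl , w , stop (walk-start ω) , ~-sym u~w) (inj₂ m , p , ω , a) (≢-sym (∈∉⇒≢ m C.u∉) , u≁q))))

        insert : Span (_∉ₚ path) C.z u → Bad
        insert σ = spanning record
          { three = let (a , b , c , _ , _ , _ , ≢s) = proj₁ connected in a , b , c , tt , tt , tt , ≢s
          ; span = span-cong (λ _ → tt) (λ {v} _ → either v) (span-join σ u~r (span-path path) (λ ∉p ∈p → ∉p ∈p))
          ; v~u = s~z }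
          where
          either : ∀ v → v ∉ₚ path ⊎ v ∈ₚ path
          either v with v ∈ₚ? path
          ... | yes m = inj₂ m
          ... | no ¬m = inj₁ ¬m

        base-bad : Bad
        base-bad = [ insert , id ] (cut-span
          (minimal (λ v → ¬? (v ∈ₚ? path)) two-connected (r , λ ∉p → ∉p (start∈ path))) Side
          (C∉ z∈) (C∉ (inj₁ refl)) z∉ (inj₁ refl) C.a≢z leave)
          where
          z∉ : ¬ Side C.z
          z∉ (inj₁ e) = u≢z (sym e)
          z∉ (inj₂ (_ , _ , _ , ω)) = walk-end ω z∈

    edge-bad : Bad
    edge-bad with any? (λ v → comp? C d v ×-dec ¬? (v ∈ₚ? path))
    ... | yes (d′ , ω , ∉p) = Shrink.shrink ω ∉p
    ... | no ¬v = Base.base-bad (λ {v} ω → decidable-stable (v ∈ₚ? path) (λ ∉p → ¬v (v , ω , ∉p)))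

  -- Deleting `p` does not separate `d` from the rest of `C`.
  touches : ∀ {u} (C : Cyc u) {d} → ¬ d ∈ₒ C → ∀ {p} → p ∈ₒ C → ∃[ q ] Attached C d q × q ≢ p
  touches {u} C {d} d∉ {p} p∈ =
    let (t , t∈ , t≢p) = target
        (v , q , ω , a , q∈ , _ , q≢p) = exit (_∈ₒ? C) (proj₂ connected p (tt , λ { refl → d∉ p∈ }) (tt , t≢p)) d∉ t∈
    in q , (q∈ , v , walk-map proj₂ ω , a) , q≢p
    where
    target : ∃[ t ] t ∈ₒ C × t ≢ p
    target with u ≟ p
    ... | no u≢p = u , inj₁ refl , u≢p
    ... | yes refl = Cyc.a C , inj₂ (start∈ (arc C)) , ≢-sym (~⇒≢ (Cyc.u~a C))

  transfer : ∀ {u p} {C : Cyc u} (ρ : Rotation C p) {d x} → Attached C d x → Attached (Rotation.cyc ρ) d x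
  transfer ρ (x∈ , v , ω , a) = Rotation.to ρ x∈ , v , walk-map (λ o → o ∘ Rotation.from ρ) ω , a

  transfer⁻ : ∀ {u p} {C : Cyc u} (ρ : Rotation C p) {d x} → Attached (Rotation.cyc ρ) d x → Attached C d x
  transfer⁻ ρ (x∈ , v , ω , a) = Rotation.from ρ x∈ , v , walk-map (λ o → o ∘ Rotation.to ρ) ω , a

  -- 2-connectedness gives two attached vertices. Unless `Bad` follows, they are adjacent and no
  -- third vertex is attached; a rotation then makes them the ends of the closing edge, as `Edge`
  -- expects.
  component-bad : ∀ fuel {u} (C : Cyc u) d → ¬ d ∈ₒ C → count (comp? C d) < fuel → Bad
  component-bad (suc fuel) {u} C d d∉ bound = attach (proj₁ (proj₂ (touches C d∉ (inj₁ refl))))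
    where
    smaller : ∀ {p} (ρ : Rotation C p) {u′} (C′ : Cyc u′) {d′} → ¬ d′ ∈ₒ C′ →
              (∀ {v} → Comp C′ d′ v → Comp (Rotation.cyc ρ) d v) →
              (∃[ v ] Comp (Rotation.cyc ρ) d v × ¬ Comp C′ d′ v) → Bad
    smaller ρ C′ {d′} d′∉ ⊆ (v , ω , ¬ω) = component-bad fuel C′ d′ d′∉
      (≤-trans (count-strict (comp? C′ d′) (comp? C d) (walk-map (λ o → o ∘ Rotation.to ρ) ∘ ⊆) (walk-map (λ o → o ∘ Rotation.to ρ) ω) ¬ω)
               (≤-pred bound))

    pair : ∀ {p q} → Attached C d p → Attached C d q → p ≢ q → p ~ q → Bad
    pair {p} {q} P Q p≢q p~q = sweep (attached? C d) (λ x → x ≟ p ⊎-dec x ≟ q) narrow λ ends → orient ends (rotate C (proj₁ P))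
      where
      narrow : ∀ {x} → Attached C d x → (x ≡ p ⊎ x ≡ q) ⊎ Bad
      narrow {x} X with x ≟ p | x ≟ q
      ... | yes e | _ = inj₁ (inj₁ e)
      ... | no _ | yes e = inj₁ (inj₂ e)
      ... | no x≢p | no x≢q = inj₂ (attached-three C P Q X p≢q (≢-sym x≢p) (≢-sym x≢q))
      finish : (∀ {x} → Attached C d x → x ≡ p ⊎ x ≡ q) → (ρ : Rotation C p) → q ≡ Cyc.z (Rotation.cyc ρ) → Bad
      finish ends ρ refl = Edge.edge-bad (Rotation.cyc ρ) (transfer ρ P) (transfer ρ Q) (λ X → ends (transfer⁻ ρ X)) (smaller ρ)
      orient : (∀ {x} → Attached C d x → x ≡ p ⊎ x ≡ q) → Rotation C p → Bad
      orient ends ρ = [ (λ e → finish ends (ρ ⊙ reverse-cyc (Rotation.cyc ρ)) e) , (λ e → finish ends ρ e) ]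
        (Cyc.only (Rotation.cyc ρ) ([ (λ e → contradiction (sym e) p≢q) , id ] (Rotation.to ρ (proj₁ Q))) p~q)

    attach : ∀ {p} → Attached C d p → Bad
    attach {p} P with touches C d∉ (proj₁ P)
    ... | q , Q , q≢p with p ~? q
    ...   | yes p~q = pair P Q (≢-sym q≢p) p~q
    ...   | no p≁q = attached-two C P Q (≢-sym q≢p , p≁q)

  cycle-bad : ∀ {u} → Cyc u → Bad
  cycle-bad {u} C with any? (λ d → ¬? (d ∈ₒ? C))
  ... | yes (d , d∉) = component-bad _ C d d∉ ≤-refl
  ... | no ¬d = spanning record
    { three = proj₁ connected
    ; span = span-cong (λ _ → tt) (λ {v} _ → swap (decidable-stable (v ∈ₒ? C) (λ v∉ → ¬d (v , v∉))))
               (span-join (span-path (arc C)) (Cyc.z~u C) (span-single u) (λ m e → Cyc.u∉ C (subst (_∈ₚ arc C) e m)))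
    ; v~u = Cyc.u~a C }

  first-step : ∀ {S : Vertex → Set} {u v} → Walk S u v → u ≢ v → ∃[ x ] u ~ x × S x
  first-step (stop _) u≢v = contradiction refl u≢v
  first-step (step _ a ω) _ = _ , a , walk-start ω

  -- An induced path from `x` to `y` that avoids `v`, cut at its first neighbour of `v` other than
  -- `x`, closes up with `v` to an induced cycle.
  ear-cycle : ∀ {v x y} → v ~ x → v ~ y → x ≢ y → Cyc v
  ear-cycle {v} {x} {y} v~x v~y x≢y = record
    { arc = S.pre ; u~a = v~x ; z~u = ~-sym (proj₁ Tp) ; a≢z = ≢-sym (proj₂ Tp)
    ; only = λ {w} m a → case w ≟ x of λ { (yes e) → inj₁ e ; (no ne) → inj₂ (only m (a , ne)) }
    ; u∉ = λ m → proj₂ (sub (S.pre⊆ m)) refl }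
    where
    open PathIn (shorten (proj₂ connected v (tt , ≢-sym (~⇒≢ v~x)) (tt , ≢-sym (~⇒≢ v~y))))
    open FirstCut (first-cut {T = λ p → v ~ p × p ≢ x} (λ p → (v ~? p) ×-dec ¬? (p ≟ x)) path (end∈ path) (v~y , ≢-sym x≢y))
    module S = Split cut

  contradictory : Bad
  contradictory with proj₁ connected
  -- Two neighbours of `a` arise as first steps of walks, one avoiding `c` and one avoiding the
  -- neighbour already found.
  ... | a , b , c , _ , _ , _ , a≢b , a≢c , b≢c
    with first-step (proj₂ connected c (tt , a≢c) (tt , b≢c)) a≢b
  ...   | x , a~x , _ with other-target
    where
    other-target : ∃[ t ] a ≢ t × t ≢ x
    other-target with b ≟ x
    ... | no b≢x = b , a≢b , b≢x
    ... | yes refl = c , a≢c , ≢-sym b≢c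
  ...     | t , a≢t , t≢x with first-step (proj₂ connected x (tt , ~⇒≢ a~x) (tt , t≢x)) a≢t
  ...       | y , a~y , _ , y≢x = cycle-bad (ear-cycle a~x a~y (≢-sym y≢x))

-- Configurations are 2-connected.

module Obstructions (G : Graph) where
  open Spanning G public

  three-two : ∀ {T : Vertex → Set} → Three T → ∀ {x y} → ¬ (∀ {v} → T v → v ≡ x ⊎ v ≡ y)
  three-two (a , b , c , ta , tb , tc , a≢b , a≢c , b≢c) f with f ta | f tb | f tc
  ... | inj₁ refl | inj₁ refl | _ = a≢b refl
  ... | inj₁ refl | inj₂ refl | inj₁ refl = a≢c refl
  ... | inj₁ refl | inj₂ refl | inj₂ refl = b≢c refl
  ... | inj₂ refl | inj₁ refl | inj₁ refl = b≢c refl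
  ... | inj₂ refl | inj₁ refl | inj₂ refl = a≢c refl
  ... | inj₂ refl | inj₂ refl | _ = a≢b refl

  avoiding : ∀ {T : Vertex → Set} → Three T → ∀ x y → ∃[ v ] T v × v ≢ x × v ≢ y
  avoiding {T} three@(a , b , c , ta , tb , tc , _) x y with good? a | good? b | good? c
    where
    good? : ∀ v → Dec (v ≢ x × v ≢ y)
    good? v = ¬? (v ≟ x) ×-dec ¬? (v ≟ y)
  ... | yes (p , q) | _ | _ = a , ta , p , q
  ... | no _ | yes (p , q) | _ = b , tb , p , q
  ... | no _ | no _ | yes (p , q) = c , tc , p , q
  ... | no ¬a | no ¬b | no ¬c = ⊥-elim (three-two {T = λ v → v ≡ a ⊎ v ≡ b ⊎ v ≡ c}
          (a , b , c , inj₁ refl , inj₂ (inj₁ refl) , inj₂ (inj₂ refl) , proj₂ (proj₂ (proj₂ (proj₂ (proj₂ (proj₂ three))))))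
          λ { (inj₁ refl) → bad ¬a ; (inj₂ (inj₁ refl)) → bad ¬b ; (inj₂ (inj₂ refl)) → bad ¬c })
    where
    bad : ∀ {v} → ¬ (v ≢ x × v ≢ y) → v ≡ x ⊎ v ≡ y
    bad {v} ¬g with v ≟ x | v ≟ y
    ... | yes e | _ = inj₁ e
    ... | no _ | yes e = inj₂ e
    ... | no p | no q = contradiction (p , q) ¬g

  flip : Config → Config
  flip K = record
    { k = l ; l = k ; c = d ; d = c ; path = λ i → R.path i ; k~c = λ i → ~-sym (d~l i) ; d~l = λ i → ~-sym (k~c i)
    ; only-k = λ i m a → only-l i (R.from i m) (~-sym a) ; only-l = λ i m a → only-k i (R.from i m) (~-sym a)
    ; apart = λ i j i≢j u v m n → apart i j i≢j u v (R.from i m) (R.from j n)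
    ; k∉ = λ i j m → l∉ i j (R.from j m) ; l∉ = λ i j m → k∉ i j (R.from j m) ; k≢l = λ i j → ≢-sym (k≢l j i)
    ; left = map₂ (λ f i j i≢j → proj₁ (f i j i≢j) , λ v m a → proj₂ (f i j i≢j) v (R.from j m) (~-sym a)) right
    ; right = map₂ (λ f i j i≢j → proj₁ (f i j i≢j) , λ v m a → proj₂ (f i j i≢j) v (R.from j m) (~-sym a)) left
    ; cross = λ i j a → map₂ swap (map₁ sym (cross j i (~-sym a))) }
    where
    open Config K
    module R i = Reversed (reversed (path i))

  Vx : Config → Vertex → Set
  Vx K v = ∃[ i ] (v ≡ k i ⊎ v ≡ l i ⊎ v ∈ₚ path i)
    where open Config K

  vx-flip : ∀ K {v} → Vx K v → Vx (flip K) v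
  vx-flip K (i , inj₁ e) = i , inj₂ (inj₁ e)
  vx-flip K (i , inj₂ (inj₁ e)) = i , inj₁ e
  vx-flip K (i , inj₂ (inj₂ m)) = i , inj₂ (inj₂ (Reversed.to (reversed (Config.path K i)) m))

  vx-unflip : ∀ K {v} → Vx (flip K) v → Vx K v
  vx-unflip K (i , inj₁ e) = i , inj₂ (inj₁ e)
  vx-unflip K (i , inj₂ (inj₁ e)) = i , inj₁ e
  vx-unflip K (i , inj₂ (inj₂ m)) = i , inj₂ (inj₂ (Reversed.from (reversed (Config.path K i)) m))

  ¬const : ∀ {f : Fin 3 → Vertex} → (∀ i j → i ≢ j → f i ~ f j) → ¬ Const f
  ¬const t e = ~⇒≢ (t 0F 1F λ ()) (e 0F 1F)

  module _ (K : Config) where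
    open Config K

    Tri : (Fin 3 → Vertex) → Set
    Tri f = ∀ i j → i ≢ j → f i ~ f j

    kind : Const k ⊎ Tri k
    kind = map₂ (λ f i j i≢j → proj₁ (f i j i≢j)) left

    path-nbr : ∀ {i v w} → v ∈ₚ path i → Vx K w → v ~ w → w ≡ k i ⊎ w ≡ l i ⊎ w ∈ₚ path i
    path-nbr {i} {v} {w} m (j , x) a with i ≟ j
    ... | yes refl = x
    ... | no i≢j with x
    ...   | inj₂ (inj₂ n) = contradiction a (proj₂ (apart i j i≢j v w m n))
    ...   | inj₁ refl = inj₁ ([ (λ e → e j i) , (λ f → contradiction (~-sym a) (proj₂ (f j i (≢-sym i≢j)) v m)) ] left)
    ...   | inj₂ (inj₁ refl) = inj₂ (inj₁ ([ (λ e → e j i) , (λ f → contradiction a (proj₂ (f j i (≢-sym i≢j)) v m)) ] right))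

    -- `p-k` names the outer neighbour of the first path vertex; for the last path vertex it is used
    -- after `flip`.
    record DegreeTwo (i : Fin 3) (x : Vertex) : Set where
      field
        {p n} : Vertex
        x~p   : x ~ p
        x~n   : x ~ n
        nbr   : ∀ {w} → Vx K w → x ~ w → w ≡ p ⊎ w ≡ n
        p-k   : x ≡ c i → p ≡ k i

    degree-two : ∀ {i x} → x ∈ₚ path i → DegreeTwo i x
    degree-two {i} {x} m with c i ≟ x | x ≟ d i
    ... | yes refl | yes e′ = record
      { x~p = ~-sym (k~c i) ; x~n = subst (_~ l i) (sym e′) (d~l i) ; p-k = λ _ → refl
      ; nbr = λ v a → case path-nbr m v a of λ
          { (inj₁ e) → inj₁ e ; (inj₂ (inj₁ e)) → inj₂ e
          ; (inj₂ (inj₂ n)) → contradiction e′ (loop (path i) n (≢-sym (~⇒≢ a))) } }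
    ... | yes refl | no c≢d = record
      { x~p = ~-sym (k~c i) ; x~n = U.x~b ; p-k = λ _ → refl
      ; nbr = λ v a → case path-nbr m v a of λ
          { (inj₁ e) → inj₁ e ; (inj₂ (inj₁ refl)) → contradiction (only-l i m a) c≢d
          ; (inj₂ (inj₂ n)) → inj₂ ([ (λ e → contradiction (sym e) (~⇒≢ a)) , (λ o → U.only o a) ] (U.from n)) } }
      where module U = Uncons (uncons (path i) c≢d)
    ... | no c≢d | yes refl = record
      { x~p = ~-sym I.b~y ; x~n = d~l i ; p-k = λ e → contradiction (sym e) c≢d
      ; nbr = λ v a → case path-nbr m v a of λ
          { (inj₁ refl) → contradiction (sym (only-k i m (~-sym a))) c≢d ; (inj₂ (inj₁ e)) → inj₂ e
          ; (inj₂ (inj₂ n)) → inj₁ ([ (λ e → contradiction (sym e) (~⇒≢ a)) , (λ o → I.only o (~-sym a)) ] (I.from n)) } }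
      where module I = Unsnoc (unsnoc (path i) c≢d)
    ... | no c≢x | no x≢d = record
      { x~p = ~-sym I.b~y ; x~n = U.x~b ; p-k = λ e → contradiction (sym e) c≢x
      ; nbr = λ v a → case path-nbr m v a of λ
          { (inj₁ refl) → contradiction (sym (only-k i m (~-sym a))) c≢x ; (inj₂ (inj₁ refl)) → contradiction (only-l i m a) x≢d
          ; (inj₂ (inj₂ n)) → case cover n of λ
              { (inj₁ o) → inj₁ ([ (λ e → contradiction (sym e) (~⇒≢ a)) , (λ o → I.only o (~-sym a)) ] (I.from o))
              ; (inj₂ o) → inj₂ ([ (λ e → contradiction (sym e) (~⇒≢ a)) , (λ o → U.only o a) ] (U.from o)) } } }
      where
      open Split (split (path i) m)
      module I = Unsnoc (unsnoc pre c≢x)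
      module U = Uncons (uncons suf x≢d)

    vk : ∀ i → Vx K (k i)
    vk i = i , inj₁ refl
    vl : ∀ i → Vx K (l i)
    vl i = i , inj₂ (inj₁ refl)
    vp : ∀ {i v} → v ∈ₚ path i → Vx K v
    vp {i} m = i , inj₂ (inj₂ m)

    private
      free : ∀ {t w} → w ∉ₚ path t → k t ≢ w → l t ≢ w → Walk (Vx K ∖ w) (k t) (l t)
      free {t} w∉ k≢w l≢w = step (vk t , k≢w) (k~c t)
        (along (path t) (λ m → vp m , ∈∉⇒≢ m w∉) ⊕ walk-edge (vp (end∈ (path t)) , ∈∉⇒≢ (end∈ (path t)) w∉) (vl t , l≢w) (d~l t))

      side : ∀ {f : Fin 3 → Vertex} → Const f ⊎ Tri f → (∀ i → Vx K (f i)) → ∀ {w} i j → f i ≢ w → f j ≢ w → Walk (Vx K ∖ w) (f i) (f j)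
      side (inj₁ e) vf i j p q = subst (Walk _ _) (e i j) (stop (vf i , p))
      side {f} (inj₂ t) vf i j p q with i ≟ j
      ... | yes refl = stop (vf i , p)
      ... | no i≢j = walk-edge (vf i , p) (vf j , q) (t i j i≢j)

      kindʳ : Const l ⊎ Tri l
      kindʳ = map₂ (λ f i j i≢j → proj₁ (f i j i≢j)) right

      -- Some path avoids `w` together with its ends: any path other than one that has `w` inside,
      -- and if there is no such path, path `i` or path `j`.
      across : ∀ w i j → k i ≢ w → l j ≢ w → Walk (Vx K ∖ w) (k i) (l j)
      across w i j p q = via free-index
        where
        free-index : ∃[ t ] w ∉ₚ path t × k t ≢ w × l t ≢ w
        free-index with any? (λ s → w ∈ₚ? path s)
        ... | yes (s , m) = let (t , t≢s) = other s in
              t , (λ n → proj₁ (apart t s t≢s w w n m) refl) , (λ e → k∉ t s (subst (_∈ₚ path s) (sym e) m)) , (λ e → l∉ t s (subst (_∈ₚ path s) (sym e) m))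
        ... | no ¬m with l i ≟ w
        ...   | no l≢w = i , (λ m → ¬m (i , m)) , p , l≢w
        ...   | yes refl = j , (λ m → ¬m (j , m)) , k≢l j i , q
        via : ∃[ t ] w ∉ₚ path t × k t ≢ w × l t ≢ w → Walk (Vx K ∖ w) (k i) (l j)
        via (t , w∉ , p′ , q′) = side kind vk i t p p′ ⊕ free w∉ p′ q′ ⊕ side kindʳ vl t j q′ q

      End : Vertex → Set
      End v = ∃[ i ] (v ≡ k i ⊎ v ≡ l i)

      ends : ∀ w {x y} → End x → End y → x ≢ w → y ≢ w → Walk (Vx K ∖ w) x y
      ends w (i , inj₁ refl) (j , inj₁ refl) p q = side kind vk i j p q
      ends w (i , inj₁ refl) (j , inj₂ refl) p q = across w i j p q
      ends w (i , inj₂ refl) (j , inj₁ refl) p q = walk-rev (across w j i q p)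
      ends w (i , inj₂ refl) (j , inj₂ refl) p q = side kindʳ vl i j p q

      to-end : ∀ w {x} → Vx K x → x ≢ w → ∃[ y ] End y × y ≢ w × Walk (Vx K ∖ w) x y
      to-end w (i , inj₁ refl) x≢w = k i , (i , inj₁ refl) , x≢w , stop (vk i , x≢w)
      to-end w (i , inj₂ (inj₁ refl)) x≢w = l i , (i , inj₂ refl) , x≢w , stop (vl i , x≢w)
      to-end w {x} (i , inj₂ (inj₂ m)) x≢w with w ∈ₚ? path i
      ... | yes n with split (path i) n
      ...   | s with Split.cover s m
      ...     | inj₁ o = k i , (i , inj₁ refl) , k≢w , walk-rev (step (vk i , k≢w) (k~c i) (along I.pre λ u → vp (Split.pre⊆ s (I.pre⊆ u)) , before u))
        where
        k≢w : k i ≢ w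
        k≢w refl = k∉ i i n
        module I = Split (split (Split.pre s) o)
        before : ∀ {u} → u ∈ₚ I.pre → u ≢ w
        before u refl = [ (λ e → x≢w (sym e)) , [ (λ e → x≢w (sym e)) , (λ f → proj₁ f refl) ] ] (I.cross u (end∈ I.suf))
      ...     | inj₂ o = l i , (i , inj₂ refl) , l≢w , (along I.suf (λ u → vp (Split.suf⊆ s (I.suf⊆ u)) , after u) ⊕ walk-edge (vp (end∈ (path i)) , after (end∈ I.suf)) (vl i , l≢w) (d~l i))
        where
        l≢w : l i ≢ w
        l≢w refl = l∉ i i n
        module I = Split (split (Split.suf s) o)
        after : ∀ {u} → u ∈ₚ I.suf → u ≢ w
        after u refl = [ (λ e → x≢w (sym e)) , [ (λ e → x≢w (sym e)) , (λ f → proj₁ f refl) ] ] (I.cross (start∈ I.pre) u)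
      to-end w {x} (i , inj₂ (inj₂ m)) x≢w | no w∉ with k i ≟ w
      ... | no k≢w = k i , (i , inj₁ refl) , k≢w , walk-rev (step (vk i , k≢w) (k~c i) (along pre λ u → vp (pre⊆ u) , ∈∉⇒≢ (pre⊆ u) w∉))
        where open Split (split (path i) m)
      ... | yes refl = l i , (i , inj₂ refl) , ≢-sym (k≢l i i) , (along suf (λ u → vp (suf⊆ u) , ∈∉⇒≢ (suf⊆ u) w∉)
              ⊕ walk-edge (vp (end∈ (path i)) , ∈∉⇒≢ (end∈ (path i)) w∉) (vl i , ≢-sym (k≢l i i)) (d~l i))
        where open Split (split (path i) m)

    two-connected : TwoConnected (Vx K)
    two-connected = (k 0F , l 0F , c 0F , vk 0F , vl 0F , vp (start∈ (path 0F)) , k≢l 0F 0F , ~⇒≢ (k~c 0F) , (λ e → l∉ 0F 0F (subst (_∈ₚ path 0F) (sym e) (start∈ (path 0F)))))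
      , λ w (x , x≢w) (y , y≢w) → let (_ , e , e≢w , ω) = to-end w x x≢w ; (_ , e′ , e′≢w , ω′) = to-end w y y≢w in
        ω ⊕ ends w e e′ e≢w e′≢w ⊕ walk-rev ω′

-- Configurations have no Hamiltonian cycle.

module NonHamiltonian (G : Graph) where
  open Obstructions G public

  data Next : List Vertex → Vertex → Vertex → Set where
    here  : ∀ {a b xs} → Next (a ∷ b ∷ xs) a b
    there : ∀ {a b x xs} → Next xs a b → Next (x ∷ xs) a b

  next-first : ∀ {xs a b} → Next xs a b → a ∈ xs
  next-first here      = here refl
  next-first (there n) = there (next-first n)

  next-second : ∀ {x xs a b} → Next (x ∷ xs) a b → b ∈ xs
  next-second here = here refl
  next-second {xs = _ ∷ _} (there n) = there (next-second n)

  next-adjacent : ∀ {x xs y a b} → Linked x xs y → Next (x ∷ xs) a b → a ~ b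
  next-adjacent ((e , _) ∷ π) here = e
  next-adjacent (_ ∷ π) (there n) = next-adjacent π n

  end-last : ∀ {x xs y b} → Linked x xs y → ¬ Next (x ∷ xs) y b
  end-last [] (there ())
  end-last ((_ , x∉) ∷ π) here      = x∉ (linked-end π)
  end-last (_ ∷ π) (there n) = end-last π n

  next-unique : ∀ {x xs y p b b′} → Linked x xs y → Next (x ∷ xs) p b → Next (x ∷ xs) p b′ → b ≡ b′
  next-unique _ here here = refl
  next-unique ((_ , x∉) ∷ _) here (there n) = contradiction (next-first n) x∉
  next-unique ((_ , x∉) ∷ _) (there n) here = contradiction (next-first n) x∉
  next-unique (_ ∷ π) (there n) (there n′) = next-unique π n n′
  next-unique [] (there ()) _

  linked-∉ : ∀ {x xs y} → Linked x xs y → x ∉ xs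
  linked-∉ [] ()
  linked-∉ ((_ , x∉) ∷ _) = x∉

  prev-unique : ∀ {x xs y p p′ b} → Linked x xs y → Next (x ∷ xs) p b → Next (x ∷ xs) p′ b → p ≡ p′
  prev-unique _ here here = refl
  prev-unique (_ ∷ π) here (there n) = contradiction (next-second n) (linked-∉ π)
  prev-unique (_ ∷ π) (there n) here = contradiction (next-second n) (linked-∉ π)
  prev-unique (_ ∷ π) (there n) (there n′) = prev-unique π n n′
  prev-unique [] (there ()) _

  next-exists : ∀ {x xs y p} → Linked x xs y → p ∈ x ∷ xs → p ≢ y → ∃[ b ] Next (x ∷ xs) p b
  next-exists [] (here e) p≢y = contradiction e p≢y
  next-exists (_ ∷ π) (here refl) _ = _ , here
  next-exists (_ ∷ π) (there m) p≢y = let (b , n) = next-exists π m p≢y in b , there n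

  prev-exists : ∀ {x xs b} → b ∈ xs → ∃[ p ] Next (x ∷ xs) p b
  prev-exists (here refl) = _ , here
  prev-exists (there m) = let (p , n) = prev-exists m in p , there n

  module _ {X : Vertex → Set} where

    to-last : ∀ {x xs y p} → Linked x xs y → (∀ {a b} → X a → Next (x ∷ xs) a b → X b) → p ∈ x ∷ xs → X p → X y
    to-last [] _ (here refl) Xp = Xp
    to-last (_ ∷ π) f (here refl) Xp = to-last π (λ a n → f a (there n)) (here refl) (f Xp here)
    to-last (_ ∷ π) f (there m) Xp = to-last π (λ a n → f a (there n)) m Xp

    from-first : ∀ {x xs y p} → Linked x xs y → (∀ {a b} → X a → Next (x ∷ xs) a b → X b) → X x → p ∈ x ∷ xs → X p
    from-first _ _ Xx (here refl) = Xx
    from-first (_ ∷ π) f Xx (there m) = from-first π (λ a n → f a (there n)) (f Xx here) m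

  module HamiltonianCycle {S : Vertex → Set} (h : Ham S) where
    open Ham h
    open Span span

    Succ : Vertex → Vertex → Set
    Succ a b = Next (u ∷ list) a b ⊎ (a ≡ v × b ≡ u)

    OnCycle : Vertex → Vertex → Set
    OnCycle a b = Succ a b ⊎ Succ b a

    succ-unique : ∀ {x a b} → Succ x a → Succ x b → a ≡ b
    succ-unique (inj₁ n) (inj₁ n′) = next-unique linked n n′
    succ-unique (inj₁ n) (inj₂ (refl , _)) = contradiction n (end-last linked)
    succ-unique (inj₂ (refl , _)) (inj₁ n) = contradiction n (end-last linked)
    succ-unique (inj₂ (_ , e)) (inj₂ (_ , e′)) = trans e (sym e′)

    pred-unique : ∀ {x a b} → Succ a x → Succ b x → a ≡ b
    pred-unique (inj₁ n) (inj₁ n′) = prev-unique linked n n′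
    pred-unique (inj₁ n) (inj₂ (_ , refl)) = contradiction (next-second n) (linked-∉ linked)
    pred-unique (inj₂ (_ , refl)) (inj₁ n) = contradiction (next-second n) (linked-∉ linked)
    pred-unique (inj₂ (e , _)) (inj₂ (e′ , _)) = trans e (sym e′)

    succ : ∀ {x} → S x → ∃[ s ] Succ x s
    succ {x} s with x ≟ v
    ... | yes e = u , inj₂ (e , refl)
    ... | no ne = let (b , n) = next-exists linked (complete s) ne in b , inj₁ n

    pred : ∀ {x} → S x → ∃[ p ] Succ p x
    pred s with complete s
    ... | here e = v , inj₂ (refl , e)
    ... | there m = let (p , n) = prev-exists m in p , inj₁ n

    succ-adjacent : ∀ {a b} → Succ a b → a ~ b
    succ-adjacent (inj₁ n) = next-adjacent linked n
    succ-adjacent (inj₂ (refl , refl)) = v~u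

    succ-in : ∀ {a b} → Succ a b → S b
    succ-in (inj₁ n) = sound (there (next-second n))
    succ-in (inj₂ (_ , refl)) = sound (here refl)

    pred-in : ∀ {a b} → Succ a b → S a
    pred-in (inj₁ n) = sound (next-first n)
    pred-in (inj₂ (refl , _)) = sound (linked-end linked)

    -- Closure under successors leads from `x` to the last vertex, over the closing edge to the
    -- first one, and from there through the whole list.
    everything : ∀ (X : Vertex → Set) → (∀ {a b} → X a → Succ a b → X b) → ∀ {x y} → S x → X x → S y → X y
    everything X f x Xx y = from-first linked (λ a → f a ∘ inj₁)
      (f (to-last linked (λ a → f a ∘ inj₁) (complete x) Xx) (inj₂ (refl , refl))) (complete y)

    on-sym : ∀ {a b} → OnCycle a b → OnCycle b a
    on-sym = swap

    -- Otherwise the whole cycle would consist of `x` and `s`.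
    succ≢pred : ∀ {x s p} → Succ x s → Succ p x → s ≢ p
    succ≢pred {x} {s} xs px refl = three-two three (λ {y} y∈ →
      everything (λ y → y ≡ x ⊎ y ≡ s)
        (λ { (inj₁ refl) n → inj₂ (succ-unique n xs) ; (inj₂ refl) n → inj₁ (succ-unique n px) })
        (pred-in xs) (inj₁ refl) y∈)

    at-most-two : ∀ {x a b c} → OnCycle x a → OnCycle x b → OnCycle x c → a ≢ b → a ≢ c → b ≢ c → ⊥
    at-most-two (inj₁ p) (inj₁ q) _ a≢b _ _ = a≢b (succ-unique p q)
    at-most-two (inj₂ p) (inj₂ q) _ a≢b _ _ = a≢b (pred-unique p q)
    at-most-two (inj₁ p) (inj₂ q) (inj₁ r) _ a≢c _ = a≢c (succ-unique p r)
    at-most-two (inj₁ p) (inj₂ q) (inj₂ r) _ _ b≢c = b≢c (pred-unique q r)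
    at-most-two (inj₂ p) (inj₁ q) (inj₁ r) _ _ b≢c = b≢c (succ-unique q r)
    at-most-two (inj₂ p) (inj₁ q) (inj₂ r) _ a≢c _ = a≢c (pred-unique p r)

    second : ∀ {x a} → OnCycle x a → ∃[ b ] OnCycle x b × b ≢ a
    second (inj₁ p) = let (b , q) = pred (pred-in p) in b , inj₂ q , ≢-sym (succ≢pred p q)
    second (inj₂ p) = let (b , q) = succ (succ-in p) in b , inj₁ q , succ≢pred q p

    -- The successor and the predecessor of `x` differ and are both among `p` and `n`, so one of
    -- them is `p`.
    forced : ∀ {x p n} → S x → (∀ {w} → S w → x ~ w → w ≡ p ⊎ w ≡ n) → OnCycle x p
    forced s nbr with succ s | pred s
    ... | a , xa | b , bx with nbr (succ-in xa) (succ-adjacent xa) | nbr (pred-in bx) (~-sym (succ-adjacent bx))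
    ...   | inj₁ refl | _ = inj₁ xa
    ...   | inj₂ _ | inj₁ refl = inj₂ bx
    ...   | inj₂ refl | inj₂ refl = contradiction refl (succ≢pred xa bx)

  module _ (K : Config) (h : Ham (Vx K)) where
    open Config K
    open HamiltonianCycle h

    k-link : ∀ i → OnCycle (k i) (c i)
    k-link i = on-sym (subst (OnCycle (c i)) (p-k refl) (forced (vp K (start∈ (path i))) nbr))
      where open DegreeTwo (degree-two K (start∈ (path i)))

    c-distinct : ∀ {i j} → i ≢ j → c i ≢ c j
    c-distinct {i} {j} i≢j = proj₁ (apart i j i≢j _ _ (start∈ (path i)) (start∈ (path j)))

    -- A common end would lie on three edges of the cycle, one into each path.
    not-const : ¬ Const k
    not-const e = at-most-two (k-link 0F) (moved 1F) (moved 2F) (c-distinct λ ()) (c-distinct λ ()) (c-distinct λ ())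
      where
      moved : ∀ i → OnCycle (k 0F) (c i)
      moved i = subst (λ x → OnCycle x (c i)) (e i 0F) (k-link i)

  ham-cong : ∀ {A B : Vertex → Set} → (∀ {v} → A v → B v) → (∀ {v} → B v → A v) → Ham A → Ham B
  ham-cong f g h = record
    { three = let (a , b , c , p , q , r , e) = Ham.three h in a , b , c , f p , f q , f r , e
    ; span = span-cong f g (Ham.span h) ; v~u = Ham.v~u h }

  module _ (K : Config) (h : Ham (Vx K)) where
    open Config K

    private
      module F = Config (flip K)
      hᶠ : Ham (Vx (flip K))
      hᶠ = ham-cong (vx-flip K) (vx-unflip K) h

    module Triangles (tk : Tri K k) (tl : Tri K l) where
      open HamiltonianCycle h

      l-link : ∀ i → OnCycle (l i) (d i)
      l-link i = on-sym (subst (OnCycle (d i)) (p-k refl) (forced (vp K (end∈ (path i)))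
        (λ w a → nbr (vx-flip K w) a)))
        where open DegreeTwo (degree-two (flip K) (start∈ (F.path i)))

      -- Path i and a chord would close up.
      chordless : ∀ i → ¬ OnCycle (k i) (l i)
      chordless i kl = [ k≢j , [ k≢l j i , k∉ j i ] ]
        (everything X closed (vk K i) (inj₁ refl) (vk K j))
        where
        j = proj₁ (other i)
        k≢j : k j ≢ k i
        k≢j = ~⇒≢ (tk j i (proj₂ (other i)))
        X : Vertex → Set
        X v = v ≡ k i ⊎ v ≡ l i ⊎ v ∈ₚ path i
        closed : ∀ {a b} → X a → Succ a b → X b
        closed {b = b} (inj₁ refl) n with b ≟ c i | b ≟ l i
        ... | yes refl | _ = inj₂ (inj₂ (start∈ (path i)))
        ... | no _ | yes e = inj₂ (inj₁ e)
        ... | no b≢c | no b≢l = ⊥-elim (at-most-two (k-link K h i) kl (inj₁ n)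
                (λ e → l∉ i i (subst (_∈ₚ path i) e (start∈ (path i)))) (≢-sym b≢c) (≢-sym b≢l))
        closed {b = b} (inj₂ (inj₁ refl)) n with b ≟ d i | b ≟ k i
        ... | yes refl | _ = inj₂ (inj₂ (end∈ (path i)))
        ... | no _ | yes e = inj₁ e
        ... | no b≢d | no b≢k = ⊥-elim (at-most-two (l-link i) (on-sym kl) (inj₁ n)
                (λ e → k∉ i i (subst (_∈ₚ path i) e (end∈ (path i)))) (≢-sym b≢d) (≢-sym b≢k))
        closed (inj₂ (inj₂ m)) n = path-nbr K m (succ-in n) (succ-adjacent n)

      on-adjacent : ∀ {a b} → OnCycle a b → a ~ b × Vx K b
      on-adjacent (inj₁ n) = succ-adjacent n , succ-in n
      on-adjacent (inj₂ n) = ~-sym (succ-adjacent n) , pred-in n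

      -- The cycle has a second edge at `k i`, besides the one into path `i`. It is not a chord by
      -- `chordless`, so it is an edge of the triangle.
      partner : ∀ i → ∃[ j ] j ≢ i × OnCycle (k i) (k j)
      partner i with second (k-link K h i)
      ... | b , cyc , b≢c with on-adjacent cyc
      ...   | a , j , x with i ≟ j
      ...     | yes refl with x
      ...       | inj₁ refl = contradiction refl (~⇒≢ a)
      ...       | inj₂ (inj₁ refl) = contradiction cyc (chordless i)
      ...       | inj₂ (inj₂ m) = contradiction (only-k i m a) b≢c
      partner i | b , cyc , b≢c | a , j , x | no i≢j with x
      ...       | inj₁ refl = j , ≢-sym i≢j , cyc
      ...       | inj₂ (inj₁ refl) = ⊥-elim ([ (λ e → i≢j e) , [ ¬const tk , ¬const tl ] ] (cross i j a))
      ...       | inj₂ (inj₂ m) = ⊥-elim ([ ¬const tk , (λ f → proj₂ (f i j i≢j) b m a) ] left)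

      one-partner : ∀ {i j s} → j ≢ s → OnCycle (k i) (k j) → OnCycle (k i) (k s) → ⊥
      one-partner {i} {j} {s} j≢s p q = at-most-two p q (k-link K h i) (~⇒≢ (tk j s j≢s)) (k≢c j) (k≢c s)
        where
        k≢c : ∀ t → k t ≢ c i
        k≢c t e = k∉ t i (subst (_∈ₚ path i) (sym e) (start∈ (path i)))

      -- If the corners 0 and `j` are partners, the partner of the remaining corner `s` is one of
      -- these two, which then has three edges on the cycle: to both partners and into its path.
      absurd : ⊥
      absurd with partner 0F
      ... | j , j≢0 , p with third (≢-sym j≢0)
      ...   | s , s≢0 , s≢j , all with partner s
      ...     | t , t≢s , q with all t
      ...       | inj₁ refl = one-partner (≢-sym s≢j) p (on-sym q)
      ...       | inj₂ (inj₁ refl) = one-partner (≢-sym s≢0) (on-sym p) (on-sym q)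
      ...       | inj₂ (inj₂ refl) = t≢s refl

    non-hamiltonian : ⊥
    non-hamiltonian with kind K | kind (flip K)
    ... | inj₁ e | _ = not-const K h e
    ... | inj₂ _ | inj₁ e = not-const (flip K) hᶠ e
    ... | inj₂ tk | inj₂ tl = Triangles.absurd tk tl

-- Proper 2-connected induced subgraphs of configurations are Hamiltonian.

module ProperSubgraphs (G : Graph) where
  open NonHamiltonian G public

  module Proper (K : Config) {T : Vertex → Set} (T? : Decidable₁ T) (T⊆ : ∀ {v} → T v → Vx K v)
    (two-conn : TwoConnected T) where
    open Config K

    private
      three = proj₁ two-conn

    -- Otherwise `y` would separate `x` from a third vertex of `T`.
    min-degree : ∀ {x y} → T x → x ≢ y → ¬ (∀ {w} → T w → x ~ w → w ≡ y)
    min-degree {x} {y} Tx x≢y f with avoiding three x y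
    ... | v , Tv , v≢x , v≢y with proj₂ two-conn y (Tx , x≢y) (Tv , v≢y)
    ...   | stop _ = v≢x refl
    ...   | step _ a ω = proj₂ (walk-start ω) (f (proj₁ (walk-start ω)) a)

    -- Otherwise `z` would be a cutvertex of `T`.
    confine : ∀ (X : Vertex → Set) z {x y} → (∀ {p q} → X p → p ~ q → T q → q ≢ z → X q) → T x → x ≢ z → X x → T y → y ≢ z → X y
    confine X z closed Tx x≢z Xx Ty y≢z =
      confined {X = X} (λ Xp a (Tq , q≢z) → closed Xp a Tq q≢z) (proj₂ two-conn z (Tx , x≢z) (Ty , y≢z)) Xx

    -- `x` has only two neighbours in the configuration and needs two in `T`.
    interior-closed : ∀ {i x w} → x ∈ₚ path i → T x → Vx K w → x ~ w → T w
    interior-closed {i} {x} {w} m Tx vw a with T? w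
    ... | yes Tw = Tw
    ... | no ¬Tw with DegreeTwo.nbr (degree-two K m) vw a
    ...   | inj₁ refl = contradiction (λ {v} Tv b → [ (λ { refl → contradiction Tv ¬Tw }) , id ] (nbr (T⊆ Tv) b))
                          (min-degree Tx (~⇒≢ x~n))
      where open DegreeTwo (degree-two K m)
    ...   | inj₂ refl = contradiction (λ {v} Tv b → [ id , (λ { refl → contradiction Tv ¬Tw }) ] (nbr (T⊆ Tv) b))
                          (min-degree Tx (~⇒≢ x~p))
      where open DegreeTwo (degree-two K m)

    along-path : ∀ {i x y} → x ∈ₚ path i → T x → y ∈ₚ path i → T y
    along-path {i} m Tx n = proj₁ (confined {S = _∈ₚ path i} {X = λ v → T v × v ∈ₚ path i}
      (λ (Tp , p∈) a q∈ → interior-closed p∈ Tp (vp K q∈) a , q∈) (connect m n) (Tx , m))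
      where
      connect : ∀ {u v} → u ∈ₚ path i → v ∈ₚ path i → Walk (_∈ₚ path i) u v
      connect p q = walk-rev (along (Split.pre (split (path i) p)) (Split.pre⊆ (split (path i) p)))
                    ⊕ along (Split.pre (split (path i) q)) (Split.pre⊆ (split (path i) q))

    Has : Fin 3 → Set
    Has i = T (c i)

    has : ∀ {i x} → x ∈ₚ path i → T x → Has i
    has {i} m Tx = along-path m Tx (start∈ (path i))

    whole : ∀ {i x} → Has i → x ∈ₚ path i → T x
    whole {i} h = along-path (start∈ (path i)) h

    has-k : ∀ {i} → Has i → T (k i)
    has-k {i} h = interior-closed (start∈ (path i)) h (vk K i) (~-sym (k~c i))

    has-l : ∀ {i} → Has i → T (l i)
    has-l {i} h = interior-closed (end∈ (path i)) (whole h (end∈ (path i))) (vl K i) (d~l i)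

    -- A connection between the two sides within `T`, by path `i` or by its chord.
    Link : Fin 3 → Set
    Link i = T (k i) × T (l i) × (Has i ⊎ k i ~ l i)

    link? : ∀ i → Dec (Link i)
    link? i = T? (k i) ×-dec T? (l i) ×-dec (T? (c i) ⊎-dec (k i ~? l i))

    has-link : ∀ {i} → Has i → Link i
    has-link h = has-k h , has-l h , inj₁ h

    -- The turn of a Hamiltonian cycle on one side: at the common end, or through the triangle, with
    -- `f r` on the way if it belongs to `T`.
    cap : ∀ {f : Fin 3 → Vertex} → Const f ⊎ Tri K f → ∀ {j s r} → (∀ i → i ≡ j ⊎ i ≡ s ⊎ i ≡ r) → j ≢ s → r ≢ j → r ≢ s → T (f j) → T (f s) →
          Span (λ v → T v × ∃[ i ] v ≡ f i) (f s) (f j)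
    cap {f} (inj₁ e) {j} {s} all j≢s r≢j r≢s Tj Ts = subst (Span _ (f s)) (e s j)
      (span-cong (λ { refl → Ts , s , refl }) (λ { (_ , i , refl) → e i s }) (span-single (f s)))
    cap {f} (inj₂ t) {j} {s} {r} all j≢s r≢j r≢s Tj Ts with T? (f r)
    ... | no ¬Tr = span-cong (λ { (inj₁ refl) → Ts , s , refl ; (inj₂ refl) → Tj , j , refl })
        (λ { (Tv , i , refl) → case all i of λ
           { (inj₁ refl) → inj₂ refl ; (inj₂ (inj₁ refl)) → inj₁ refl ; (inj₂ (inj₂ refl)) → contradiction Tv ¬Tr } })
        (span-join (span-single (f s)) (t s j (≢-sym j≢s)) (span-single (f j)) (λ p q → ~⇒≢ (t s j (≢-sym j≢s)) (trans (sym p) q)))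
    ... | yes Tr = span-cong (λ { (inj₁ (inj₁ refl)) → Ts , s , refl ; (inj₁ (inj₂ refl)) → Tr , r , refl ; (inj₂ refl) → Tj , j , refl })
        (λ { (Tv , i , refl) → case all i of λ
           { (inj₁ refl) → inj₂ refl ; (inj₂ (inj₁ refl)) → inj₁ (inj₁ refl) ; (inj₂ (inj₂ refl)) → inj₁ (inj₂ refl) } })
        (span-join (span-join (span-single (f s)) (t s r (≢-sym r≢s)) (span-single (f r)) (λ p q → ~⇒≢ (t s r (≢-sym r≢s)) (trans (sym p) q)))
          (t r j r≢j) (span-single (f j))
          (λ { (inj₁ p) q → ~⇒≢ (t s j (≢-sym j≢s)) (trans (sym p) q) ; (inj₂ p) q → ~⇒≢ (t r j r≢j) (trans (sym p) q) }))

    -- The cycle runs through the left cap, link `j`, the right cap and link `s`. As the interior of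
    -- path `r` is missed, this is all of `T`.
    two-links : ∀ {j s r} → (∀ i → i ≡ j ⊎ i ≡ s ⊎ i ≡ r) → j ≢ s → r ≢ j → r ≢ s → Link j → Link s → ¬ Has r → Ham T
    two-links {j} {s} {r} all j≢s r≢j r≢s (Tkj , Tlj , lj) (Tks , Tls , ls) ¬r = close ls
      where
      A B : Vertex → Set
      A v = T v × ∃[ i ] v ≡ k i
      B v = T v × ∃[ i ] v ≡ l i
      I : Fin 3 → Vertex → Set
      I i v = v ∈ₚ path i × T v
      none : ∀ {i v} → ¬ Has i → ¬ I i v
      none ¬h (m , Tv) = ¬h (has m Tv)
      capL = cap (kind K) all j≢s r≢j r≢s Tkj Tks
      capR = span-reverse (cap (kindʳ) all j≢s r≢j r≢s Tlj Tls)
        where kindʳ = map₂ (λ f i j i≢j → proj₁ (f i j i≢j)) right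
      seg₁ : Has j ⊎ k j ~ l j → ∃[ e ] Span (λ v → A v ⊎ I j v) (k s) e × e ~ l j
      -- The path takes precedence over the chord: if `T` contains it, the cycle has to cover it.
      seg₁ x with T? (c j) | x
      ... | yes h | _ = d j , span-cong (map₂ (λ m → m , whole h m)) (map₂ proj₁)
              (span-join capL (k~c j) (span-path (path j)) (λ { (_ , i , refl) m → k∉ i j m })) , d~l j
      ... | no ¬h | inj₁ h = contradiction h ¬h
      ... | no ¬h | inj₂ a = k j , span-cong inj₁ [ id , (λ m → contradiction m (none ¬h)) ] capL , a
      seg₂ : Span (λ v → (A v ⊎ I j v) ⊎ B v) (k s) (l s)
      seg₂ = let (e , σ , a) = seg₁ lj in span-join σ a capR
        (λ { (inj₁ (_ , i , refl)) (_ , t , e) → k≢l i t e ; (inj₂ (m , _)) (_ , t , refl) → l∉ t j m })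
      decompose : ∀ {v} → T v → ((A v ⊎ I j v) ⊎ B v) ⊎ I s v
      decompose Tv with T⊆ Tv
      ... | i , inj₁ e = inj₁ (inj₁ (inj₁ (Tv , i , e)))
      ... | i , inj₂ (inj₁ e) = inj₁ (inj₂ (Tv , i , e))
      ... | i , inj₂ (inj₂ m) with all i
      ...   | inj₁ refl = inj₁ (inj₁ (inj₂ (m , Tv)))
      ...   | inj₂ (inj₁ refl) = inj₂ (m , Tv)
      ...   | inj₂ (inj₂ refl) = contradiction (has m Tv) ¬r
      inT : ∀ {v} → (A v ⊎ I j v) ⊎ B v → T v
      inT = [ [ proj₁ , proj₂ ] , proj₁ ]
      close : Has s ⊎ k s ~ l s → Ham T
      close x with T? (c s) | x
      ... | yes h | _ = record
        { three = three ; v~u = ~-sym (k~c s)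
        ; span = span-cong [ inT , whole h ] (map₂ proj₁ ∘ decompose)
            (span-join seg₂ (~-sym (d~l s)) (span-reverse (span-path (path s)))
              (λ { (inj₁ (inj₁ (_ , i , refl))) m → k∉ i s m
                 ; (inj₁ (inj₂ (m , _))) n → proj₁ (apart j s j≢s _ _ m n) refl
                 ; (inj₂ (_ , i , refl)) m → l∉ i s m })) }
      ... | no ¬h | inj₁ h = contradiction h ¬h
      ... | no ¬h | inj₂ a = record
        { three = three ; v~u = ~-sym a
        ; span = span-cong inT (λ Tv → [ id , (λ m → contradiction m (none ¬h)) ] (decompose Tv)) seg₂ }

  -- Without two links, the third vertex of a triangle end is cut off by a single vertex.
  module Few (K : Config) {T : Vertex → Set} (T? : Decidable₁ T) (T⊆ : ∀ {v} → T v → Vx K v) (two-conn : TwoConnected T)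
    (j : Fin 3) (unlinked : ∀ i → i ≢ j → ¬ Proper.Link K T? T⊆ two-conn i) where
    open Config K
    open Proper K T? T⊆ two-conn

    private
      three = proj₁ two-conn

    -- With the other links missing, the triangle vertices of `T` other than `k j` can be left only
    -- through `k j`. So `T` lies within the triangle, and its three vertices are all of it.
    triangle-only : Tri K k → ∀ {s} → s ≢ j → T (k s) → Ham T
    triangle-only tk {s} s≢j Tks = record
      { three = three ; v~u = tk j s (≢-sym s≢j)
      ; span = span-cong proj₁ (λ Tv → Tv , inK Tv) (cap (inj₂ tk) (λ i → reorder (all i)) (≢-sym s≢j) r≢j r≢s (Tk j) Tks) }
      where
      r = proj₁ (third s≢j)
      r≢s = proj₁ (proj₂ (third s≢j))
      r≢j = proj₁ (proj₂ (proj₂ (third s≢j)))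
      all = proj₂ (proj₂ (proj₂ (third s≢j)))
      reorder : ∀ {i} → i ≡ s ⊎ i ≡ j ⊎ i ≡ r → i ≡ j ⊎ i ≡ s ⊎ i ≡ r
      reorder (inj₁ e) = inj₂ (inj₁ e)
      reorder (inj₂ (inj₁ e)) = inj₁ e
      reorder (inj₂ (inj₂ e)) = inj₂ (inj₂ e)
      X : Vertex → Set
      X v = T v × ∃[ i ] i ≢ j × v ≡ k i
      closed : ∀ {p q} → X p → p ~ q → T q → q ≢ k j → X q
      closed {q = q} (Tp , i , i≢j , refl) a Tq q≢k with T⊆ Tq
      ... | t , inj₁ refl = Tq , t , (λ { refl → q≢k refl }) , refl
      ... | t , inj₂ (inj₁ refl) = ⊥-elim ([ (λ { refl → unlinked i i≢j (Tp , Tq , inj₂ a) })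
                                          , [ ¬const tk , (λ e → unlinked i i≢j (Tp , subst T (e t i) Tq , inj₂ (subst (k i ~_) (e t i) a))) ] ] (cross i t a))
      ... | t , inj₂ (inj₂ m) with i ≟ t
      ...   | yes refl = contradiction (has-link (has m Tq)) (unlinked i i≢j)
      ...   | no i≢t = ⊥-elim ([ ¬const tk , (λ f → proj₂ (f i t i≢t) q m a) ] left)
      inK : ∀ {v} → T v → ∃[ i ] v ≡ k i
      inK {v} Tv with v ≟ k j
      ... | yes e = j , e
      ... | no ne = let (_ , i , _ , e) = confine X (k j) closed Tks (~⇒≢ (tk s j s≢j)) (Tks , s , s≢j , refl) Tv ne in i , e
      Tk : ∀ i → T (k i)
      Tk i with T? (k i)
      ... | yes Ti = Ti
      ... | no ¬Ti = let (a , a≢i) = other i ; (b , _ , _ , all′) = third a≢i in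
        ⊥-elim (three-two three {k a} {k b} λ Tv → case inK Tv of λ
          { (x , refl) → case all′ x of λ { (inj₁ refl) → inj₁ refl ; (inj₂ (inj₁ refl)) → contradiction Tv ¬Ti ; (inj₂ (inj₂ refl)) → inj₂ refl } })

    -- Three vertices force the interior of the path into `T`, and a second neighbour for `k j`
    -- forces the chord; path and chord together are a cycle.
    path-only : (∀ {v} → T v → v ≡ k j ⊎ v ≡ l j ⊎ v ∈ₚ path j) → Ham T
    path-only inP with T? (c j) | k j ~? l j
    ... | no ¬h | _ = ⊥-elim (three-two three λ Tv → [ inj₁ , [ inj₂ , (λ m → contradiction (has m Tv) ¬h) ] ] (inP Tv))
    ... | yes h | no k≁l = ⊥-elim (min-degree (has-k h) (~⇒≢ (k~c j)) λ Tv a → case inP Tv of λ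
          { (inj₁ refl) → contradiction refl (~⇒≢ a) ; (inj₂ (inj₁ refl)) → contradiction a k≁l ; (inj₂ (inj₂ m)) → only-k j m a })
    ... | yes h | yes k~l = record
      { three = three ; v~u = ~-sym k~l
      ; span = span-cong [ [ (λ { refl → has-k h }) , whole h ] , (λ { refl → has-l h }) ]
          (λ Tv → case inP Tv of λ { (inj₁ e) → inj₁ (inj₁ e) ; (inj₂ (inj₁ e)) → inj₂ e ; (inj₂ (inj₂ m)) → inj₁ (inj₂ m) })
          (span-join (span-join (span-single (k j)) (k~c j) (span-path (path j)) (λ { refl m → k∉ j j m })) (d~l j) (span-single (l j))
            (λ { (inj₁ refl) e → k≢l j j e ; (inj₂ m) refl → l∉ j j m })) }

  module _ (K : Config) {T : Vertex → Set} (T? : Decidable₁ T) (T⊆ : ∀ {v} → T v → Vx K v) (two-conn : TwoConnected T) where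
    open Config K
    open Proper K T? T⊆ two-conn
    private
      module Pᶠ = Proper (flip K) T? (vx-flip K ∘ T⊆) two-conn

    -- A triangle vertex of `T` with an index other than `j` reduces `T` to that triangle. Otherwise
    -- `T` consists of vertices of path `j` and its ends.
    few-links : ∀ j → (∀ i → i ≢ j → ¬ Link i) → Ham T
    few-links j unlinked = go (kind K) (kind (flip K))
      where
      unlinkedᶠ : ∀ i → i ≢ j → ¬ Pᶠ.Link i
      unlinkedᶠ i i≢j (Tl , Tk , x) = unlinked i i≢j (Tk , Tl , [ inj₁ ∘ has (end∈ (path i)) , inj₂ ∘ ~-sym ] x)

      stray? : ∀ (f : Fin 3 → Vertex) → Dec (∃[ s ] s ≢ j × T (f s))
      stray? f = any? (λ s → ¬? (s ≟ j) ×-dec T? (f s))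

      OnlyAt : (Fin 3 → Vertex) → Set
      OnlyAt f = ∀ {i} → T (f i) → f i ≡ f j

      finish : OnlyAt k → OnlyAt l → Ham T
      finish ok ol = Few.path-only K T? T⊆ two-conn j unlinked λ Tv → case T⊆ Tv of λ
        { (i , inj₁ refl) → inj₁ (ok Tv) ; (i , inj₂ (inj₁ refl)) → inj₂ (inj₁ (ol Tv))
        ; (i , inj₂ (inj₂ m)) → case i ≟ j of λ
            { (yes refl) → inj₂ (inj₂ m) ; (no i≢j) → contradiction (has-link (has m Tv)) (unlinked i i≢j) } }

      at : ∀ {f : Fin 3 → Vertex} → ¬ (∃[ s ] s ≢ j × T (f s)) → OnlyAt f
      at {f} ¬s {i} Ti with i ≟ j
      ... | yes refl = refl
      ... | no i≢j = contradiction (i , i≢j , Ti) ¬s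

      go : Const k ⊎ Tri K k → Const l ⊎ Tri (flip K) l → Ham T
      go (inj₁ ek) (inj₁ el) = finish (λ {i} _ → ek i j) (λ {i} _ → el i j)
      go (inj₂ tk) x with stray? k
      ... | yes (s , s≢j , Ts) = Few.triangle-only K T? T⊆ two-conn j unlinked tk s≢j Ts
      go (inj₂ tk) (inj₁ el) | no ¬k = finish (at ¬k) (λ {i} _ → el i j)
      go (inj₂ tk) (inj₂ tl) | no ¬k with stray? l
      ... | yes (s , s≢j , Ts) = Few.triangle-only (flip K) T? (vx-flip K ∘ T⊆) two-conn j unlinkedᶠ tl s≢j Ts
      ... | no ¬l = finish (at ¬k) (at ¬l)
      go (inj₁ ek) (inj₂ tl) with stray? l
      ... | yes (s , s≢j , Ts) = Few.triangle-only (flip K) T? (vx-flip K ∘ T⊆) two-conn j unlinkedᶠ tl s≢j Ts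
      ... | no ¬l = finish (λ {i} _ → ek i j) (at ¬l)

    -- `T` misses the interior of some path `r`. Two links close up once the interior of the third
    -- path is missed; the third index is `r` itself or one that is not linked.
    proper-hamiltonian : ∀ {m} → Vx K m → ¬ T m → Ham T
    proper-hamiltonian {m} vm ¬Tm with any? (λ r → ¬? (T? (c r)))
    ... | no ¬r = contradiction (full vm) ¬Tm
      where
      h : ∀ i → Has i
      h i = decidable-stable (T? (c i)) (λ ¬h → ¬r (i , ¬h))
      full : ∀ {v} → Vx K v → T v
      full (i , inj₁ refl) = has-k (h i)
      full (i , inj₂ (inj₁ refl)) = has-l (h i)
      full (i , inj₂ (inj₂ n)) = whole (h i) n
    ... | yes (r , ¬r) = choose (other r)
      where
      choose : ∃[ j ] j ≢ r → Ham T
      choose (j , j≢r) = go (third j≢r)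
        where
        go : ∃[ s ] s ≢ j × s ≢ r × (∀ i → i ≡ j ⊎ i ≡ r ⊎ i ≡ s) → Ham T
        go (s , s≢j , s≢r , all) = cases (link? j) (link? s) (link? r)
          where
          cases : Dec (Link j) → Dec (Link s) → Dec (Link r) → Ham T
          cases (yes lj) (yes ls) _ = two-links (λ i → case all i of λ { (inj₁ e) → inj₁ e ; (inj₂ (inj₁ e)) → inj₂ (inj₂ e) ; (inj₂ (inj₂ e)) → inj₂ (inj₁ e) })
                                        (≢-sym s≢j) (≢-sym j≢r) (≢-sym s≢r) lj ls ¬r
          cases (no ¬j) (yes ls) (yes lr) = two-links (λ i → case all i of λ { (inj₁ e) → inj₂ (inj₂ e) ; (inj₂ (inj₁ e)) → inj₁ e ; (inj₂ (inj₂ e)) → inj₂ (inj₁ e) })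
                                        (≢-sym s≢r) j≢r (≢-sym s≢j) lr ls (¬j ∘ has-link)
          cases (yes lj) (no ¬s) (yes lr) = two-links (λ i → case all i of λ { (inj₁ e) → inj₁ e ; (inj₂ (inj₁ e)) → inj₂ (inj₁ e) ; (inj₂ (inj₂ e)) → inj₂ (inj₂ e) })
                                        j≢r s≢j s≢r lj lr (¬s ∘ has-link)
          cases (no ¬j) (no ¬s) _ = few-links r λ i i≢r → case all i of λ
            { (inj₁ refl) → ¬j ; (inj₂ (inj₁ e)) → contradiction e i≢r ; (inj₂ (inj₂ refl)) → ¬s }
          cases (no ¬j) (yes _) (no ¬r′) = few-links s λ i i≢s → case all i of λ
            { (inj₁ refl) → ¬j ; (inj₂ (inj₁ refl)) → ¬r′ ; (inj₂ (inj₂ e)) → contradiction e i≢s }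
          cases (yes _) (no ¬s) (no ¬r′) = few-links j λ i i≢j → case all i of λ
            { (inj₁ e) → contradiction e i≢j ; (inj₂ (inj₁ refl)) → ¬r′ ; (inj₂ (inj₂ refl)) → ¬s }

-- Subsets and embeddings.

elem-∈ : ∀ {n} (S : Subset n) i → elem S i ∈ₛ S
elem-∈ (true  ∷ S) zero    = Vec.here
elem-∈ (true  ∷ S) (suc i) = Vec.there (elem-∈ S i)
elem-∈ (false ∷ S) i       = Vec.there (elem-∈ S i)

elem-injective : ∀ {n} (S : Subset n) {i j} → elem S i ≡ elem S j → i ≡ j
elem-injective (true  ∷ S) {zero}  {zero}  e = refl
elem-injective (true  ∷ S) {suc i} {suc j} e = cong suc (elem-injective S (suc-injective e))
elem-injective (false ∷ S) e = elem-injective S (suc-injective e)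

index : ∀ {n} {S : Subset n} {v} → v ∈ₛ S → ∃[ i ] elem S i ≡ v
index {S = true ∷ S} Vec.here = zero , refl
index {S = true ∷ S} (Vec.there m) = let (i , e) = index m in suc i , cong suc e
index {S = false ∷ S} (Vec.there m) = let (i , e) = index m in i , cong suc e

-- Removing `x` a second time changes nothing, whereas removing a member makes a subset smaller.
∈-minus⁻ : ∀ {n} {x y : Fin n} → x ∈ₛ ⊤ - y → x ≢ y
∈-minus⁻ {x = x} m refl = <-irrefl (cong ∣_∣ (p─q─q≡p─q ⊤ ⁅ x ⁆)) (x∈p⇒∣p-x∣<∣p∣ m)

three-distinct : ∀ {n} {a b c : Fin n} → a ≢ b → a ≢ c → b ≢ c → 3 ≤ n
three-distinct {n} {a} {b} {c} p q r = injective⇒≤ {f = fin3 a b c} λ {x} {y} → inj x y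
  where
  inj : ∀ x y → fin3 {λ _ → Fin n} a b c x ≡ fin3 a b c y → x ≡ y
  inj 0F 0F _ = refl
  inj 0F 1F e = contradiction e p
  inj 0F 2F e = contradiction e q
  inj 1F 0F e = contradiction (sym e) p
  inj 1F 1F _ = refl
  inj 1F 2F e = contradiction e r
  inj 2F 0F e = contradiction (sym e) q
  inj 2F 1F e = contradiction (sym e) r
  inj 2F 2F _ = refl

-- An isomorphism onto an induced subgraph. It is applied to `elem S` and to isomorphisms between
-- graphs.
module Embedding (H G : Graph) (f : Graph.Vertex H → Graph.Vertex G)
  (injective : ∀ {x y} → f x ≡ f y → x ≡ y) (preserves : ∀ {x y} → Graph._~_ H x y → Graph._~_ G (f x) (f y))
  (reflects : ∀ {x y} → Graph._~_ G (f x) (f y) → Graph._~_ H x y) where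

  private
    module H = Spanning H
    module G = Spanning G

  Image : G.Vertex → Set
  Image v = ∃[ x ] f x ≡ v

  far⁺ : ∀ {x y} → H.Far x y → G.Far (f x) (f y)
  far⁺ (x≢y , x≁y) = x≢y ∘ injective , x≁y ∘ reflects

  ∈-unmap : ∀ {x xs} → f x ∈ map f xs → x ∈ xs
  ∈-unmap m = let (y , y∈ , e) = ∈-map⁻ f m in subst (_∈ _) (sym (injective e)) y∈

  walk⁺ : ∀ {S : H.Vertex → Set} {T : G.Vertex → Set} → (∀ {v} → S v → T (f v)) → ∀ {u v} → H.Walk S u v → G.Walk T (f u) (f v)
  walk⁺ t (H.stop s)     = G.stop (t s)
  walk⁺ t (H.step s a ω) = G.step (t s) (preserves a) (walk⁺ t ω)

  -- The ends are given by equations, since matching on a walk between images of the form `f u`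
  -- would get stuck.
  walk⁻ : ∀ {S : H.Vertex → Set} {T : G.Vertex → Set} → (∀ {v} → T v → Image v) → (∀ {v} → T (f v) → S v) →
          ∀ {u v u′ v′} → G.Walk T u′ v′ → f u ≡ u′ → f v ≡ v′ → H.Walk S u v
  walk⁻ im s (G.stop t) refl e with injective e
  ... | refl = H.stop (s t)
  walk⁻ im s (G.step t a ω) refl refl with im (G.walk-start ω)
  ... | w , refl = H.step (s t) (reflects a) (walk⁻ im s ω refl refl)

  linked⁺ : ∀ {x xs y} → H.Linked x xs y → G.Linked (f x) (map f xs) (f y)
  linked⁺ H.[] = G.[]
  linked⁺ ((a , x∉) H.∷ π) = (preserves a , x∉ ∘ ∈-unmap) G.∷ linked⁺ π

  record LinkedPreimage (x : H.Vertex) (ys : List (G.Vertex)) (z : G.Vertex) : Set where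
    constructor preimage
    field
      {xs}   : List (H.Vertex)
      {w}    : H.Vertex
      linked : H.Linked x xs w
      list-≡ : map f xs ≡ ys
      end-≡  : f w ≡ z

  linked⁻ : ∀ {x y ys z} → G.Linked y ys z → f x ≡ y → (∀ {v} → v ∈ ys → Image v) → LinkedPreimage x ys z
  linked⁻ G.[] refl _ = preimage H.[] refl refl
  linked⁻ ((a , y∉) G.∷ π) refl im with im (here refl)
  ... | w , refl with linked⁻ π refl (im ∘ there)
  ...   | preimage ρ refl e = preimage ((reflects a , y∉ ∘ ∈-map⁺ f) H.∷ ρ) refl e

  induced⁺ : ∀ {x xs y} → H.Induced x xs y → G.Induced (f x) (map f xs) (f y)
  induced⁺ H.[] = G.[]
  induced⁺ {x} ((a , fs) H.∷ π) = (preserves a , All.tabulate far) G.∷ induced⁺ π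
    where
    far : ∀ {v} → v ∈ map f _ → G.Far (f x) v
    far m = let (y , y∈ , e) = ∈-map⁻ f m in subst (G.Far (f x)) (sym e) (far⁺ (All.lookup fs y∈))

  record InducedPreimage (x : H.Vertex) (ys : List (G.Vertex)) (z : G.Vertex) : Set where
    constructor preimage
    field
      {xs}    : List (H.Vertex)
      {w}     : H.Vertex
      induced : H.Induced x xs w
      list-≡  : map f xs ≡ ys
      end-≡   : f w ≡ z

  induced⁻ : ∀ {x y ys z} → G.Induced y ys z → f x ≡ y → (∀ {v} → v ∈ ys → Image v) → InducedPreimage x ys z
  induced⁻ G.[] refl _ = preimage H.[] refl refl
  induced⁻ ((a , fs) G.∷ π) refl im with im (here refl)
  ... | w , refl with induced⁻ π refl (im ∘ there)
  ...   | preimage ρ refl e = preimage ((reflects a , All.tabulate far) H.∷ ρ) refl e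
    where
    far : ∀ {v} → v ∈ _ → H.Far _ v
    far m = let (≢ , ≁) = All.lookup fs (∈-map⁺ f m) in ≢ ∘ cong f , ≁ ∘ preserves

  three⁺ : ∀ {S : H.Vertex → Set} {T : G.Vertex → Set} → (∀ {v} → S v → T (f v)) → H.Three S → G.Three T
  three⁺ t (a , b , c , p , q , r , x , y , z) = f a , f b , f c , t p , t q , t r , x ∘ injective , y ∘ injective , z ∘ injective

  three⁻ : ∀ {S : H.Vertex → Set} {T : G.Vertex → Set} → (∀ {v} → T v → Image v) → (∀ {v} → T (f v) → S v) → G.Three T → H.Three S
  three⁻ im s (a , b , c , p , q , r , x , y , z) with im p | im q | im r
  ... | _ , refl | _ , refl | _ , refl = _ , _ , _ , s p , s q , s r , x ∘ cong f , y ∘ cong f , z ∘ cong f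

  module _ {T : G.Vertex → Set} (im : ∀ {v} → T v → Image v) (on : ∀ x → T (f x)) where

    ham⁺ : H.Ham (λ _ → Unit) → G.Ham T
    ham⁺ h = record
      { three = three⁺ (λ _ → on _) (H.Ham.three h)
      ; span = record
        { linked = linked⁺ linked
        ; sound = λ m → let (x , _ , e) = ∈-map⁻ f {xs = _ ∷ list} m in subst T (sym e) (on x)
        ; complete = λ t → case im t of λ { (x , refl) → ∈-map⁺ f (complete {x} tt) } }
      ; v~u = preserves (H.Ham.v~u h) }
      where open H.Span (H.Ham.span h)

    ham⁻ : G.Ham T → H.Ham (λ _ → Unit)
    ham⁻ record { three = three ; span = record { linked = π ; sound = sound ; complete = complete } ; v~u = v~u }
      with im (sound (here refl))
    ... | u , refl with linked⁻ π refl (im ∘ sound ∘ there)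
    ...   | preimage ρ refl refl = record
      { three = three⁻ im (λ _ → tt) three
      ; span = record { linked = ρ ; sound = λ _ → tt ; complete = λ {x} _ → ∈-unmap {xs = _ ∷ _} (complete (on x)) }
      ; v~u = reflects v~u }

    twoConnected⁺ : H.TwoConnected (λ _ → Unit) → G.TwoConnected T
    twoConnected⁺ (three , conn) = three⁺ (λ _ → on _) three , walk
      where
      walk : ∀ w {u v} → T u × u ≢ w → T v × v ≢ w → G.Walk (λ v → T v × v ≢ w) u v
      walk w {u} {v} (tu , u≢w) (tv , v≢w) with im tu | im tv | any? (λ x → f x ≟ w)
      ... | x , refl | y , refl | yes (z , refl) =
        walk⁺ (λ {v} (_ , v≢z) → on v , v≢z ∘ injective) (conn z (tt , u≢w ∘ cong f) (tt , v≢w ∘ cong f))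
      -- If `w` is not in the image, connectedness of `H` is enough; it follows by deleting a third
      -- vertex.
      ... | x , refl | y , refl | no ∉ = walk⁺ {S = λ _ → Unit} (λ {v} _ → on v , λ e → ∉ (v , e)) (connected x y)
        where
        connected : ∀ x y → H.Walk (λ _ → Unit) x y
        connected x y with H.walk? {S = λ _ → Unit} (λ _ → yes tt) x y
        ... | yes ω = ω
        ... | no ¬ω = let (w , x≢w , y≢w) = third-vertex in contradiction (H.walk-map (λ _ → tt) (conn w (tt , x≢w) (tt , y≢w))) ¬ω
          where
          third-vertex : ∃[ w ] x ≢ w × y ≢ w
          third-vertex = let (w , _ , p , q) = Obstructions.avoiding H three x y in w , ≢-sym p , ≢-sym q

    twoConnected⁻ : G.TwoConnected T → H.TwoConnected (λ _ → Unit)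
    twoConnected⁻ (three , conn) = three⁻ im (λ _ → tt) three , λ w {u} {v} (_ , u≢w) (_ , v≢w) →
      walk⁻ (im ∘ proj₁) (λ (_ , ≢) → tt , ≢ ∘ cong f) (conn (f w) (on u , u≢w ∘ injective) (on v , v≢w ∘ injective)) refl refl

-- 2-connectedness in terms of cutvertices.

module FromDefs (G : Graph) where
  open ProperSubgraphs G public

  module _ (S : Subset order) where
    private
      module E = Embedding (G [ S ]) G (elem S) (elem-injective S) id id

    reachable⁺ : ∀ {x y} → Reachable (G [ S ]) x y → Walk (_∈ₛ S) (elem S x) (elem S y)
    reachable⁺ {x} ε = stop (elem-∈ S x)
    reachable⁺ {x} (a ◅ r) = step (elem-∈ S x) a (reachable⁺ r)

    reachable⁻ : ∀ {u v x y} → Walk (_∈ₛ S) u v → elem S x ≡ u → elem S y ≡ v → Reachable (G [ S ]) x y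
    reachable⁻ {y = y} (stop _) refl e with elem-injective S {y} e
    ... | refl = ε
    reachable⁻ (step _ a ω) refl refl with index (walk-start ω)
    ... | w , refl = a ◅ reachable⁻ ω refl refl

  reachable-walk : ∀ {x y} → Reachable G x y → Walk (λ _ → Unit) x y
  reachable-walk ε = stop tt
  reachable-walk (a ◅ r) = step tt a (reachable-walk r)

  walk-reachable : ∀ {S : Vertex → Set} {x y} → Walk S x y → Reachable G x y
  walk-reachable (stop _) = ε
  walk-reachable (step _ a ω) = a ◅ walk-reachable ω

  two-connected⁺ : 2-Connected G → TwoConnected (λ _ → Unit)
  two-connected⁺ (3≤ , connected , no-cut) = three-of 3≤ {id} id , walk
    where
    three-of : ∀ {n} → 3 ≤ n → {f : Fin n → Vertex} → (∀ {i j} → f i ≡ f j → i ≡ j) → Three (λ _ → Unit)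
    three-of (s≤s (s≤s (s≤s _))) {f} inj = f 0F , f 1F , f 2F , tt , tt , tt
      , (λ e → case inj e of λ ()) , (λ e → case inj e of λ ()) , (λ e → case inj e of λ ())
    walk : ∀ w {u v} → Unit × u ≢ w → Unit × v ≢ w → Walk (λ v → Unit × v ≢ w) u v
    walk w {u} {v} (_ , u≢w) (_ , v≢w) with walk? {S = λ v → Unit × v ≢ w} (λ v → yes tt ×-dec ¬? (v ≟ w)) u v
    ... | yes ω = ω
    -- Without such a walk `w` would be a cutvertex, because `G` is connected.
    ... | no ¬ω with index (x∈p∧x≢y⇒x∈p-y {x = u} {y = w} ∈⊤ u≢w) | index (x∈p∧x≢y⇒x∈p-y {x = v} {y = w} ∈⊤ v≢w)
    ...   | x , refl | y , refl = contradiction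
            (x , y , connected _ _ , λ r → ¬ω (walk-map (λ m → tt , ∈-minus⁻ m) (reachable⁺ (⊤ - w) r))) (no-cut w)

  two-connected⁻ : TwoConnected (λ _ → Unit) → 2-Connected G
  two-connected⁻ (three , conn) = three-≤ three , connected , no-cut
    where
    three-≤ : Three (λ _ → Unit) → 3 ≤ order
    three-≤ (a , b , c , _ , _ , _ , p , q , r) = three-distinct p q r
    connected : Connected G
    connected x y = let (w , _ , p , q) = avoiding three x y in walk-reachable (conn w (tt , ≢-sym p) (tt , ≢-sym q))
    no-cut : ∀ v → ¬ IsCutvertex G v
    no-cut v (x , y , _ , ¬r) = ¬r (reachable⁻ (⊤ - v)
      (walk-map (λ (_ , ≢v) → x∈p∧x≢y⇒x∈p-y ∈⊤ ≢v) (conn v (tt , ∈-minus⁻ (elem-∈ (⊤ - v) x)) (tt , ∈-minus⁻ (elem-∈ (⊤ - v) y)))) refl refl)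

module _ (G : Graph) (S : Subset (Graph.order G)) where
  private
    module E = Embedding (G [ S ]) G (elem S) (elem-injective S) id id
    module G = Spanning G
    module H = Spanning (G [ S ])

  sub-twoConnected⁺ : 2-Connected (G [ S ]) → G.TwoConnected (_∈ₛ S)
  sub-twoConnected⁺ tc = E.twoConnected⁺ index (elem-∈ S) (FromDefs.two-connected⁺ (G [ S ]) tc)

  sub-twoConnected⁻ : G.TwoConnected (_∈ₛ S) → 2-Connected (G [ S ])
  sub-twoConnected⁻ tc = FromDefs.two-connected⁻ (G [ S ]) (E.twoConnected⁻ index (elem-∈ S) tc)

  sub-ham⁺ : H.Ham (λ _ → Unit) → G.Ham (_∈ₛ S)
  sub-ham⁺ = E.ham⁺ index (elem-∈ S)

  sub-ham⁻ : G.Ham (_∈ₛ S) → H.Ham (λ _ → Unit)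
  sub-ham⁻ = E.ham⁻ index (elem-∈ S)

-- Hamiltonian cycles and wheels in terms of the definitions.

module Cycles (G : Graph) where
  open FromDefs G public

  lookup-end : ∀ {x xs y} → Linked x xs y → lookup (x ∷ xs) (fromℕ (length xs)) ≡ y
  lookup-end []      = refl
  lookup-end (_ ∷ π) = lookup-end π

  linked-injective : ∀ {x xs y} → Linked x xs y → ∀ {i j} → lookup (x ∷ xs) i ≡ lookup (x ∷ xs) j → i ≡ j
  linked-injective π {zero} {zero} e = refl
  linked-injective {xs = xs} π {zero} {suc j} e = contradiction (subst (_∈ xs) (sym e) (∈-lookup j)) (linked-∉ π)
  linked-injective {xs = xs} π {suc i} {zero} e = contradiction (subst (_∈ xs) e (∈-lookup i)) (linked-∉ π)
  linked-injective (_ ∷ π) {suc i} {suc j} e = cong suc (linked-injective π e)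

  toPath : ∀ {x xs y} → Linked x xs y → Path x y
  toPath {x} {xs} π = record
    { length = length xs ; vertex = lookup (x ∷ xs) ; injective = linked-injective π ; start = refl ; end = lookup-end π }

  module _ {x : Vertex} {xs : List Vertex} {y : Vertex} (π : Linked x xs y) where

    toPath-V⁺ : ∀ {v} → v ∈ x ∷ xs → V (Path.graph (toPath π)) v
    toPath-V⁺ m = Any.index m , lookup-index m

    toPath-V⁻ : ∀ {v} → V (Path.graph (toPath π)) v → v ∈ x ∷ xs
    toPath-V⁻ (i , refl) = ∈-lookup i

    toPath-E⁺ : ∀ {a b} → Next (x ∷ xs) a b ⊎ Next (x ∷ xs) b a → E (Path.graph (toPath π)) a b
    toPath-E⁺ = [ (λ n → let (i , p , q) = position n in i , inj₁ (p , q)) , (λ n → let (i , p , q) = position n in i , inj₂ (q , p)) ]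
      where
      position : ∀ {x xs a b} → Next (x ∷ xs) a b → ∃[ i ] a ≡ lookup (x ∷ xs) (inject₁ i) × b ≡ lookup (x ∷ xs) (suc i)
      position here = zero , refl , refl
      position {xs = _ ∷ _} (there n) = let (i , p , q) = position n in suc i , p , q

    toPath-E⁻ : ∀ {a b} → E (Path.graph (toPath π)) a b → Next (x ∷ xs) a b ⊎ Next (x ∷ xs) b a
    toPath-E⁻ (i , inj₁ (refl , refl)) = inj₁ (at xs i)
      where
      at : ∀ {x} xs (i : Fin (length xs)) → Next (x ∷ xs) (lookup (x ∷ xs) (inject₁ i)) (lookup (x ∷ xs) (suc i))
      at (_ ∷ _) zero = here
      at (_ ∷ xs) (suc i) = there (at xs i)
    toPath-E⁻ (i , inj₂ (refl , refl)) = inj₂ (at xs i)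
      where
      at : ∀ {x} xs (i : Fin (length xs)) → Next (x ∷ xs) (lookup (x ∷ xs) (inject₁ i)) (lookup (x ∷ xs) (suc i))
      at (_ ∷ _) zero = here
      at (_ ∷ xs) (suc i) = there (at xs i)

    toPath-adjacent : ∀ {a b} → E (Path.graph (toPath π)) a b → a ~ b
    toPath-adjacent e = [ next-adjacent π , ~-sym ∘ next-adjacent π ] (toPath-E⁻ e)

  tabulated : ∀ n (f : Fin (suc n) → Vertex) → (∀ {i j} → f i ≡ f j → i ≡ j) → (∀ i → f (inject₁ i) ~ f (suc i)) →
              Linked (f zero) (tabulate (f ∘ suc)) (f (fromℕ n))
  tabulated zero f inj adj = []
  tabulated (suc n) f inj adj =
    (adj zero , λ m → case ∈-tabulate⁻ {f = f ∘ suc} m of λ { (i , e) → case inj e of λ () })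
    ∷ tabulated n (f ∘ suc) (suc-injective ∘ inj) (adj ∘ suc)

  ham⁺ : Hamiltonian G → Ham (λ _ → Unit)
  ham⁺ (record { path = record { length = suc (suc n) ; vertex = f ; injective = inj ; start = refl ; end = refl } ; long = _ } , e⇒ , all) = record
    { three = f 0F , f 1F , f 2F , tt , tt , tt , (λ e → case inj e of λ ()) , (λ e → case inj e of λ ()) , (λ e → case inj e of λ ())
    ; span = record
      { linked = tabulated _ f inj (λ i → e⇒ (inj₁ (i , inj₁ (refl , refl)))) ; sound = λ _ → tt
      ; complete = λ {w} _ → member (all w) }
    ; v~u = e⇒ (inj₂ (inj₂ (refl , refl))) }
    where
    listed : ∀ i → f i ∈ f zero ∷ tabulate (f ∘ suc)
    listed zero = here refl
    listed (suc i) = there (∈-tabulate⁺ {f = f ∘ suc} i)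
    member : ∀ {w} → (∃[ i ] w ≡ f i) ⊎ (w ≡ f zero ⊎ w ≡ f (fromℕ (suc (suc n)))) → w ∈ f zero ∷ tabulate (f ∘ suc)
    member (inj₁ (i , refl)) = listed i
    member (inj₂ (inj₁ refl)) = listed zero
    member (inj₂ (inj₂ refl)) = listed (fromℕ _)
  ham⁺ (record { path = record { length = zero } ; long = () } , _)
  ham⁺ (record { path = record { length = suc zero } ; long = s≤s () } , _)

  ham⁻ : Ham (λ _ → Unit) → Hamiltonian G
  ham⁻ h = record { path = toPath linked ; long = long _ complete } , edges , λ v → inj₁ (toPath-V⁺ linked (complete tt))
    where
    open Ham h
    open Span span
    long : ∀ xs → (∀ {w} → Unit → w ∈ u ∷ xs) → 2 ≤ length xs
    long [] f = ⊥-elim (three-two three {u} {u} λ t → case f t of λ { (here e) → inj₁ e })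
    long (x ∷ []) f = ⊥-elim (three-two three {u} {x} λ t → case f t of λ { (here e) → inj₁ e ; (there (here e)) → inj₂ e })
    long (_ ∷ _ ∷ _) _ = s≤s (s≤s z≤n)
    edges : ∀ {a b} → E (Cycle.graph (record { path = toPath linked ; long = long _ complete })) a b → a ~ b
    edges (inj₁ e) = toPath-adjacent linked e
    edges (inj₂ (inj₁ (refl , refl))) = ~-sym v~u
    edges (inj₂ (inj₂ (refl , refl))) = v~u

  induced-next : ∀ {x xs y} → Induced x xs y → ∀ {p q} → p ∈ x ∷ xs → q ∈ x ∷ xs → p ~ q → Next (x ∷ xs) p q ⊎ Next (x ∷ xs) q p
  induced-next _ (here refl) (here refl) a = contradiction refl (~⇒≢ a)
  induced-next (_ ∷ _) (here refl) (there (here refl)) _ = inj₁ here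
  induced-next ((_ , fs) ∷ _) (here refl) (there (there m)) a = contradiction a (proj₂ (All.lookup fs m))
  induced-next (_ ∷ _) (there (here refl)) (here refl) _ = inj₂ here
  induced-next ((_ , fs) ∷ _) (there (there m)) (here refl) a = contradiction (~-sym a) (proj₂ (All.lookup fs m))
  induced-next (_ ∷ π) (there m) (there n) a = map₁ there (map₂ there (induced-next π m n a))

  -- `IsWheel` speaks of an entire graph, so this one is assumed to consist of `C` and `h`;
  -- `no-wheel` supplies the induced subgraph.
  module Wheels {u : Vertex} (C : Cyc u) {h : Vertex} (h∉ : ¬ h ∈ₒ C) (cover : ∀ v → v ≡ h ⊎ v ∈ₒ C) where
    open Cyc C hiding (arc)

    rim-linked : Linked u (a ∷ rest (arc C)) z
    rim-linked = (u~a , u∉) ∷ induced-linked (induced (arc C))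

    rim : Cycle Vertex
    rim = record { path = toPath rim-linked ; long = s≤s (rest-pos (arc C) a≢z) }

    on-rim : ∀ {v} → v ∈ₒ C → V (Cycle.graph rim) v
    on-rim (inj₁ e) = inj₁ (toPath-V⁺ rim-linked (here e))
    on-rim (inj₂ m) = inj₁ (toPath-V⁺ rim-linked (there m))

    on-rim⁻ : ∀ {v} → V (Cycle.graph rim) v → v ∈ₒ C
    on-rim⁻ (inj₁ x) with toPath-V⁻ rim-linked x
    ... | here e = inj₁ e
    ... | there m = inj₂ m
    on-rim⁻ (inj₂ (inj₁ e)) = inj₁ e
    on-rim⁻ (inj₂ (inj₂ refl)) = inj₂ (end∈ (arc C))

    rim-edge⁺ : ∀ {p q} → p ∈ₒ C → q ∈ₒ C → p ~ q → E (Cycle.graph rim) p q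
    rim-edge⁺ (inj₁ refl) (inj₁ refl) a = contradiction refl (~⇒≢ a)
    rim-edge⁺ (inj₁ refl) (inj₂ m) a with only m a
    ... | inj₁ refl = inj₁ (toPath-E⁺ rim-linked (inj₁ here))
    ... | inj₂ refl = inj₂ (inj₁ (refl , refl))
    rim-edge⁺ (inj₂ m) (inj₁ refl) a with only m (~-sym a)
    ... | inj₁ refl = inj₁ (toPath-E⁺ rim-linked (inj₂ here))
    ... | inj₂ refl = inj₂ (inj₂ (refl , refl))
    rim-edge⁺ (inj₂ m) (inj₂ n) a = inj₁ (toPath-E⁺ rim-linked (map₁ there (map₂ there (induced-next (induced (arc C)) m n a))))

    rim-edge⁻ : ∀ {p q} → E (Cycle.graph rim) p q → p ~ q
    rim-edge⁻ (inj₁ e) = toPath-adjacent rim-linked e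
    rim-edge⁻ (inj₂ (inj₁ (refl , refl))) = ~-sym z~u
    rim-edge⁻ (inj₂ (inj₂ (refl , refl))) = z~u

    spokes = comprehension (h ~?_)

    isWheel : ∀ {p q r} → p ≢ q → p ≢ r → q ≢ r → h ~ p → h ~ q → h ~ r → IsWheel G
    isWheel p≢q p≢r q≢r h~p h~q h~r = record
      { rim = rim ; hub = h ; hub∉rim = h∉ ∘ on-rim⁻ ; spokes = spokes
      ; spokes⊆rim = λ m → on-rim (spoke-on (∈-comprehension⁻ (h ~?_) m))
      ; 3≤spokes = size (index (∈-comprehension⁺ (h ~?_) h~p)) (index (∈-comprehension⁺ (h ~?_) h~q)) (index (∈-comprehension⁺ (h ~?_) h~r)) p≢q p≢r q≢r
      ; isUnion = ((λ {v} _ → [ inj₂ ∘ inj₁ , inj₁ ∘ on-rim ] (cover v)) , λ _ → tt)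
                , (λ {x} {y} a → edge⁺ (cover x) (cover y) a) , edge⁻ }
      where
      spoke-on : ∀ {x} → h ~ x → x ∈ₒ C
      spoke-on {x} a = [ (λ e → contradiction (sym e) (~⇒≢ a)) , id ] (cover x)
      size : ∀ {p q r} → (∃[ i ] elem spokes i ≡ p) → (∃[ i ] elem spokes i ≡ q) → (∃[ i ] elem spokes i ≡ r) → p ≢ q → p ≢ r → q ≢ r → 3 ≤ ∣ spokes ∣
      size (_ , refl) (_ , refl) (_ , refl) a b c = three-distinct (a ∘ cong (elem spokes)) (b ∘ cong (elem spokes)) (c ∘ cong (elem spokes))
      X = Cycle.graph rim ∪ star h (_∈ₛ spokes)
      edge⁺ : ∀ {x y} → x ≡ h ⊎ x ∈ₒ C → y ≡ h ⊎ y ∈ₒ C → x ~ y → E X x y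
      edge⁺ (inj₂ m) (inj₂ n) a = inj₁ (rim-edge⁺ m n a)
      edge⁺ (inj₁ refl) _ a = inj₂ (inj₁ (refl , ∈-comprehension⁺ (h ~?_) a))
      edge⁺ (inj₂ _) (inj₁ refl) a = inj₂ (inj₂ (∈-comprehension⁺ (h ~?_) (~-sym a) , refl))
      edge⁻ : ∀ {x y} → E X x y → x ~ y
      edge⁻ (inj₁ e) = rim-edge⁻ e
      edge⁻ (inj₂ (inj₁ (refl , m))) = ∈-comprehension⁻ (h ~?_) m
      edge⁻ (inj₂ (inj₂ (m , refl))) = ~-sym (∈-comprehension⁻ (h ~?_) m)

≅-refl : ∀ G → G ≅ G
≅-refl G = record { bijection = ↔-id _ ; preserves = id , id }

module _ {G : Graph} (wheel-free : WheelFree G) where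
  open Spanning G

  -- Pulled back along `elem S`, the cycle becomes the rim of the subgraph induced by it and `h`, so
  -- this subgraph is itself a forbidden wheel.
  no-wheel : ∀ {u} (C : Cyc u) {h} → ¬ h ∈ₒ C → ∀ {p q r} → p ∈ₒ C → q ∈ₒ C → r ∈ₒ C → p ≢ q → p ≢ r → q ≢ r →
             h ~ p → h ~ q → h ~ r → ⊥
  no-wheel {u} C {h} h∉ {p} {q} {r} p∈ q∈ r∈ p≢q p≢r q≢r h~p h~q h~r = pull (induced⁻ (induced (arc C)) a≡ (λ m → image (inj₁ (inj₂ (there m)))))
    where
    open Cyc C hiding (arc)
    In : Vertex → Set
    In v = v ∈ₒ C ⊎ v ≡ h
    In? : Decidable₁ In
    In? v = (v ∈ₒ? C) ⊎-dec v ≟ h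
    S = comprehension In?
    open Embedding (G [ S ]) G (elem S) (elem-injective S) id id
    module H = Cycles (G [ S ])
    image : ∀ {v} → In v → Image v
    image = index ∘ ∈-comprehension⁺ In?
    inside : ∀ x → In (elem S x)
    inside x = ∈-comprehension⁻ In? (elem-∈ S x)
    a≡ = proj₂ (image (inj₁ (inj₂ (start∈ (arc C)))))

    pull : InducedPreimage (proj₁ (image (inj₁ (inj₂ (start∈ (arc C)))))) (rest (arc C)) z → ⊥
    pull (preimage {xs} {w} π l≡ z≡) with image (inj₁ (inj₁ refl)) | image (inj₂ refl)
    ... | u′ , u≡ | h′ , h≡ = spokes (image (inj₁ p∈)) (image (inj₁ q∈)) (image (inj₁ r∈)) p≢q p≢r q≢r h~p h~q h~r
      where
      arc⁺ : ∀ {x} → x ∈ proj₁ (image (inj₁ (inj₂ (start∈ (arc C))))) ∷ xs → elem S x ∈ₚ arc C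
      arc⁺ (here refl) = here a≡
      arc⁺ (there m) = there (subst (_ ∈_) l≡ (∈-map⁺ (elem S) m))
      arc⁻ : ∀ {x} → elem S x ∈ₚ arc C → x ∈ proj₁ (image (inj₁ (inj₂ (start∈ (arc C))))) ∷ xs
      arc⁻ (here e) = here (elem-injective S (trans e (sym a≡)))
      arc⁻ (there m) = there (∈-unmap (subst (_ ∈_) (sym l≡) m))
      C′ : H.Cyc u′
      C′ = record
        { arc = H.ipath π ; u~a = adj u≡ a≡ u~a ; z~u = adj z≡ u≡ z~u
        ; a≢z = λ e → a≢z (trans (sym a≡) (trans (cong (elem S) e) z≡))
        ; only = λ {v} m a′ → case only (arc⁺ m) (subst (λ x → x ~ elem S v) u≡ a′) of λ
            { (inj₁ e) → inj₁ (elem-injective S (trans e (sym a≡))) ; (inj₂ e) → inj₂ (elem-injective S (trans e (sym z≡))) }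
        ; u∉ = λ m → u∉ (subst (_∈ₚ arc C) u≡ (arc⁺ m)) }
        where
        adj : ∀ {x y x′ y′} → elem S x ≡ x′ → elem S y ≡ y′ → x′ ~ y′ → elem S x ~ elem S y
        adj refl refl a = a
      on⁺ : ∀ {x} → elem S x ∈ₒ C → x H.∈ₒ C′
      on⁺ (inj₁ e) = inj₁ (elem-injective S (trans e (sym u≡)))
      on⁺ (inj₂ m) = inj₂ (arc⁻ m)
      on⁻ : ∀ {x} → x H.∈ₒ C′ → elem S x ∈ₒ C
      on⁻ (inj₁ refl) = inj₁ u≡
      on⁻ (inj₂ m) = inj₂ (arc⁺ m)
      spokes : ∀ {p q r} → Image p → Image q → Image r → p ≢ q → p ≢ r → q ≢ r → h ~ p → h ~ q → h ~ r → ⊥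
      spokes (i , refl) (j , refl) (o , refl) p≢q p≢r q≢r h~p h~q h~r = wheel-free S (G [ S ] , H.Wheels.isWheel C′
          (λ m → h∉ (subst (_∈ₒ C) h≡ (on⁻ m)))
          (λ x → [ inj₂ ∘ on⁺ , (λ e → inj₁ (elem-injective S (trans e (sym h≡)))) ] (inside x))
          (p≢q ∘ cong (elem S)) (p≢r ∘ cong (elem S)) (q≢r ∘ cong (elem S))
          (subst (λ x → x ~ elem S i) (sym h≡) h~p) (subst (λ x → x ~ elem S j) (sym h≡) h~q) (subst (λ x → x ~ elem S o) (sym h≡) h~r) , ≅-refl _)

-- From spanning configurations to 3PCs.

module ToDefs (G : Graph) where
  open Cycles G public

  next-++ˡ : ∀ {xs ys a b} → Next xs a b → Next (xs ++ ys) a b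
  next-++ˡ here      = here
  next-++ˡ (there n) = there (next-++ˡ n)

  next-last : ∀ {x xs y z} → Induced x xs y → Next (x ∷ xs ++ z ∷ []) y z
  next-last []      = here
  next-last (_ ∷ π) = there (next-last π)

  next-members : ∀ {xs a b} → Next xs a b → a ∈ xs × b ∈ xs
  next-members here      = here refl , there (here refl)
  next-members (there n) = let (p , q) = next-members n in there p , there q

  module Realise (K : Config) (cover : ∀ v → Vx K v) where
    open Config K

    route-list : Fin 3 → List Vertex
    route-list i = c i ∷ rest (path i) ++ l i ∷ []

    -- A path with its ends restored. A chord may join them, so it need not be induced.
    route : ∀ i → Linked (k i) (route-list i) (l i)
    route i = (k~c i , λ m → [ k∉ i i , (λ { (here e) → k≢l i i e }) ] (∈-++⁻ (c i ∷ rest (path i)) m))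
            ∷ join-linked (induced-linked (induced (path i))) (d~l i) [] (λ { m (here refl) → l∉ i i m })

    member⁺ : ∀ {i v} → v ≡ k i ⊎ v ≡ l i ⊎ v ∈ₚ path i → v ∈ k i ∷ route-list i
    member⁺ (inj₁ e) = here e
    member⁺ {i} (inj₂ (inj₁ e)) = there (∈-++⁺ʳ (c i ∷ rest (path i)) (here e))
    member⁺ (inj₂ (inj₂ m)) = there (∈-++⁺ˡ m)

    member⁻ : ∀ {i v} → v ∈ k i ∷ route-list i → v ≡ k i ⊎ v ≡ l i ⊎ v ∈ₚ path i
    member⁻ (here e) = inj₁ e
    member⁻ {i} (there m) = inj₂ ([ inj₂ , (λ { (here e) → inj₁ e }) ] (∈-++⁻ (c i ∷ rest (path i)) m))

    P : ∀ i {a b} → k i ≡ a → l i ≡ b → Path a b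
    P i e e′ = record { length = length (route-list i) ; vertex = lookup (k i ∷ route-list i)
                      ; injective = linked-injective (route i) ; start = e ; end = trans (lookup-end (route i)) e′ }

    P-V⁺ : ∀ {i a b} {e : k i ≡ a} {e′ : l i ≡ b} {v} → v ≡ k i ⊎ v ≡ l i ⊎ v ∈ₚ path i → V (Path.graph (P i e e′)) v
    P-V⁺ {i} = toPath-V⁺ (route i) ∘ member⁺

    P-V⁻ : ∀ {i a b} {e : k i ≡ a} {e′ : l i ≡ b} {v} → V (Path.graph (P i e e′)) v → v ≡ k i ⊎ v ≡ l i ⊎ v ∈ₚ path i
    P-V⁻ {i} = member⁻ ∘ toPath-V⁻ (route i)

    long : ∀ i → 2 ≤ length (route-list i)
    long i = s≤s (nonempty (rest (path i)))
      where
      nonempty : ∀ (xs : List Vertex) {y} → 1 ≤ length (xs ++ y ∷ [])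
      nonempty [] = s≤s z≤n
      nonempty (_ ∷ _) = s≤s z≤n

    meet : ∀ {i j v} → i ≢ j → v ≡ k i ⊎ v ≡ l i ⊎ v ∈ₚ path i → v ≡ k j ⊎ v ≡ l j ⊎ v ∈ₚ path j →
           (v ≡ k i × Const k) ⊎ (v ≡ l i × Const l)
    meet {i} {j} i≢j (inj₁ refl) (inj₁ e) = inj₁ (refl , [ id , (λ f → contradiction e (~⇒≢ (proj₁ (f i j i≢j)))) ] left)
    meet {i} {j} i≢j (inj₁ refl) (inj₂ (inj₁ e)) = contradiction e (k≢l i j)
    meet {i} {j} i≢j (inj₁ refl) (inj₂ (inj₂ m)) = contradiction m (k∉ i j)
    meet {i} {j} i≢j (inj₂ (inj₁ refl)) (inj₁ e) = contradiction (sym e) (k≢l j i)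
    meet {i} {j} i≢j (inj₂ (inj₁ refl)) (inj₂ (inj₁ e)) = inj₂ (refl , [ id , (λ f → contradiction e (~⇒≢ (proj₁ (f i j i≢j)))) ] right)
    meet {i} {j} i≢j (inj₂ (inj₁ refl)) (inj₂ (inj₂ m)) = contradiction m (l∉ i j)
    meet {i} {j} i≢j (inj₂ (inj₂ m)) (inj₁ refl) = contradiction m (k∉ j i)
    meet {i} {j} i≢j (inj₂ (inj₂ m)) (inj₂ (inj₁ refl)) = contradiction m (l∉ j i)
    meet {i} {j} i≢j (inj₂ (inj₂ m)) (inj₂ (inj₂ n)) = contradiction refl (proj₁ (apart i j i≢j _ _ m n))

    OnRoute : Fin 3 → Vertex → Vertex → Set
    OnRoute i u v = Next (k i ∷ route-list i) u v ⊎ Next (k i ∷ route-list i) v u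

    data Kind (u v : Vertex) : Set where
      route-edge : ∀ i → OnRoute i u v → Kind u v
      left-edge  : ∀ i j → i ≢ j → u ≡ k i → v ≡ k j → Kind u v
      right-edge : ∀ i j → i ≢ j → u ≡ l i → v ≡ l j → Kind u v
      chord-edge : ∀ i → k i ~ l i → (u ≡ k i × v ≡ l i) ⊎ (u ≡ l i × v ≡ k i) → Kind u v

    kind-sym : ∀ {u v} → Kind u v → Kind v u
    kind-sym (route-edge i x) = route-edge i (swap x)
    kind-sym (left-edge i j i≢j e e′) = left-edge j i (≢-sym i≢j) e′ e
    kind-sym (right-edge i j i≢j e e′) = right-edge j i (≢-sym i≢j) e′ e
    kind-sym (chord-edge i a (inj₁ (e , e′))) = chord-edge i a (inj₂ (e′ , e))
    kind-sym (chord-edge i a (inj₂ (e , e′))) = chord-edge i a (inj₁ (e′ , e))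

    path-kind : ∀ {i u v} → u ∈ₚ path i → u ~ v → Kind u v
    path-kind {i} {u} {v} m a with path-nbr K m (cover v) a
    ... | inj₁ refl with only-k i m (~-sym a)
    ...   | refl = route-edge i (inj₂ here)
    path-kind {i} {u} {v} m a | inj₂ (inj₁ refl) with only-l i m a
    ...   | refl = route-edge i (inj₁ (there (next-last (induced (path i)))))
    path-kind {i} {u} {v} m a | inj₂ (inj₂ n) =
      route-edge i (map₁ (there ∘ next-++ˡ) (map₂ (there ∘ next-++ˡ) (induced-next (induced (path i)) m n a)))

    -- An edge between different indices occurs only if one side has a common end, and then it is a
    -- chord.
    kl-kind : ∀ i j → k i ~ l j → Kind (k i) (l j)
    kl-kind i j a with cross i j a
    ... | inj₁ refl = chord-edge i a (inj₁ (refl , refl))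
    ... | inj₂ (inj₁ e) = chord-edge j (subst (_~ l j) (e i j) a) (inj₁ (e i j , refl))
    ... | inj₂ (inj₂ e) = chord-edge i (subst (k i ~_) (e j i) a) (inj₁ (refl , e j i))

    classify : ∀ {u v} → u ~ v → Kind u v
    classify {u} {v} a with cover u | cover v
    ... | i , inj₂ (inj₂ m) | _ = path-kind m a
    ... | _ | j , inj₂ (inj₂ n) = kind-sym (path-kind n (~-sym a))
    ... | i , inj₁ refl | j , inj₁ refl = left-edge i j (λ { refl → ~⇒≢ a refl }) refl refl
    ... | i , inj₂ (inj₁ refl) | j , inj₂ (inj₁ refl) = right-edge i j (λ { refl → ~⇒≢ a refl }) refl refl
    ... | i , inj₁ refl | j , inj₂ (inj₁ refl) = kl-kind i j a
    ... | i , inj₂ (inj₁ refl) | j , inj₁ refl = kind-sym (kl-kind j i (~-sym a))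

    chord? : ∀ i → Dec (k i ~ l i)
    chord? i = k i ~? l i

    -- For prisms and pyramids, this is the selection of paths in the version with chords; that it
    -- is nonempty distinguishes the two versions.
    chordal = comprehension chord?

    nonempty : ∀ {i} → k i ~ l i → Nonempty chordal
    nonempty {i} a = i , ∈-comprehension⁺ chord? a

    module TriTri (tk : ∀ i j → i ≢ j → k i ~ k j) (tl : ∀ i j → i ≢ j → l i ~ l j) where

      apart-routes : ∀ {i j v} → i ≢ j → v ≡ k i ⊎ v ≡ l i ⊎ v ∈ₚ path i → ¬ (v ≡ k j ⊎ v ≡ l j ⊎ v ∈ₚ path j)
      apart-routes i≢j x y = [ ¬const tk ∘ proj₂ , ¬const tl ∘ proj₂ ] (meet i≢j x y)

      prism : Prism Vertex
      prism = record
        { k = k ; l = l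
        ; k-injective = λ {i} {j} e → decidable-stable (i ≟ j) (λ ne → ~⇒≢ (tk i j ne) e)
        ; l-injective = λ {i} {j} e → decidable-stable (i ≟ j) (λ ne → ~⇒≢ (tl i j ne) e)
        ; k≢l = k≢l ; P = λ i → P i refl refl ; long = long
        ; disjoint = λ {i} {j} i≢j x y → apart-routes i≢j (on i x) (on j y)
        ; meets = λ { i x (inj₁ (j , refl)) → inj₁ (same-k i j (on i x)) ; i x (inj₂ (j , refl)) → inj₂ (same-l i j (on i x)) } }
        where
        on : ∀ i {v} → V (Path.graph (P i refl refl)) v → v ≡ k i ⊎ v ≡ l i ⊎ v ∈ₚ path i
        on i = P-V⁻ {i} {e = refl} {refl}
        same-k : ∀ i j → k j ≡ k i ⊎ k j ≡ l i ⊎ k j ∈ₚ path i → k j ≡ k i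
        same-k i j x with i ≟ j
        ... | yes refl = refl
        ... | no i≢j = contradiction (inj₁ refl) (apart-routes i≢j x)
        same-l : ∀ i j → l j ≡ k i ⊎ l j ≡ l i ⊎ l j ∈ₚ path i → l j ≡ l i
        same-l i j x with i ≟ j
        ... | yes refl = refl
        ... | no i≢j = contradiction (inj₂ (inj₁ refl)) (apart-routes i≢j x)

      edge⁺ : ∀ {u v} → u ~ v → E (Prism.graph prism) u v ⊎ E (Prism.chords prism chordal) u v
      edge⁺ a with classify a
      ... | route-edge i x = inj₁ (inj₂ (i , toPath-E⁺ (route i) x))
      ... | left-edge i j i≢j e e′ = inj₁ (inj₁ (inj₁ (i , j , i≢j , e , e′)))
      ... | right-edge i j i≢j e e′ = inj₁ (inj₁ (inj₂ (i , j , i≢j , e , e′)))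
      ... | chord-edge i b x = inj₂ ((i , ∈-comprehension⁺ chord? b) , x)

      edge⁻ : ∀ {u v} → E (Prism.graph prism) u v → u ~ v
      edge⁻ (inj₁ (inj₁ (i , j , i≢j , refl , refl))) = tk i j i≢j
      edge⁻ (inj₁ (inj₂ (i , j , i≢j , refl , refl))) = tl i j i≢j
      edge⁻ (inj₂ (i , x)) = toPath-adjacent (route i) x

      vertex⁺ : ∀ v → V (Prism.graph prism) v
      vertex⁺ v = let (i , x) = cover v in inj₂ (i , P-V⁺ {i} {e = refl} {refl} x)

      result : Is3PC G
      result with any? chord?
      ... | yes (i , a) = G , ≅-refl G , inj₂ (inj₂ (inj₂ (inj₁ (prism , chordal , nonempty a
            , ((λ {v} _ → inj₁ (vertex⁺ v)) , λ _ → tt) , edge⁺ , [ edge⁻ , chord⁻ ]))))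
        where
        chord⁻ : ∀ {u v} → E (Prism.chords prism chordal) u v → u ~ v
        chord⁻ ((i , m) , inj₁ (refl , refl)) = ∈-comprehension⁻ chord? m
        chord⁻ ((i , m) , inj₂ (refl , refl)) = ~-sym (∈-comprehension⁻ chord? m)
      ... | no ¬a = G , ≅-refl G , inj₁ (prism , ((λ {v} _ → vertex⁺ v) , λ _ → tt)
            , (λ a → [ id , (λ { ((i , m) , _) → contradiction (i , ∈-comprehension⁻ chord? m) ¬a }) ] (edge⁺ a)) , edge⁻)

    module TriConst (tk : ∀ i j → i ≢ j → k i ~ k j) (el : Const l) where

      pyramid : Pyramid Vertex
      pyramid = record
        { k = k ; l = l 0F
        ; k-injective = λ {i} {j} e → decidable-stable (i ≟ j) (λ ne → ~⇒≢ (tk i j ne) e)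
        ; k≢l = λ i → k≢l i 0F ; P = λ i → P i refl (el i 0F) ; long = long
        ; disjoint = λ {i} {j} i≢j x y → [ (λ (_ , ek) → contradiction ek (¬const tk)) , (λ (e , _) → trans e (el i 0F)) ]
            (meet i≢j (P-V⁻ {i} {e = refl} {el i 0F} x) (P-V⁻ {j} {e = refl} {el j 0F} y)) }

      edge⁺ : ∀ {u v} → u ~ v → E (Pyramid.graph pyramid) u v ⊎ E (Pyramid.chords pyramid chordal) u v
      edge⁺ a with classify a
      ... | route-edge i x = inj₁ (inj₂ (i , toPath-E⁺ (route i) x))
      ... | left-edge i j i≢j e e′ = inj₁ (inj₁ (i , j , i≢j , e , e′))
      ... | right-edge i j i≢j refl refl = contradiction (el i j) (~⇒≢ a)
      ... | chord-edge i b (inj₁ (e , e′)) = inj₂ ((i , ∈-comprehension⁺ chord? b) , inj₁ (e , trans e′ (el i 0F)))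
      ... | chord-edge i b (inj₂ (e , e′)) = inj₂ ((i , ∈-comprehension⁺ chord? b) , inj₂ (trans e (el i 0F) , e′))

      edge⁻ : ∀ {u v} → E (Pyramid.graph pyramid) u v → u ~ v
      edge⁻ (inj₁ (i , j , i≢j , refl , refl)) = tk i j i≢j
      edge⁻ (inj₂ (i , x)) = toPath-adjacent (route i) x

      vertex⁺ : ∀ v → V (Pyramid.graph pyramid) v
      vertex⁺ v = let (i , x) = cover v in inj₂ (i , P-V⁺ {i} {e = refl} {el i 0F} x)

      result : Is3PC G
      result with any? chord?
      ... | yes (i , a) = G , ≅-refl G , inj₂ (inj₂ (inj₂ (inj₂ (inj₁ (pyramid , chordal , nonempty a
            , ((λ {v} _ → inj₁ (vertex⁺ v)) , λ _ → tt) , edge⁺ , [ edge⁻ , chord⁻ ])))))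
        where
        chord⁻ : ∀ {u v} → E (Pyramid.chords pyramid chordal) u v → u ~ v
        chord⁻ ((i , m) , inj₁ (refl , refl)) = subst (k i ~_) (el i 0F) (∈-comprehension⁻ chord? m)
        chord⁻ ((i , m) , inj₂ (refl , refl)) = ~-sym (subst (k i ~_) (el i 0F) (∈-comprehension⁻ chord? m))
      ... | no ¬a = G , ≅-refl G , inj₂ (inj₁ (pyramid , ((λ {v} _ → vertex⁺ v) , λ _ → tt)
            , (λ a → [ id , (λ { ((i , m) , _) → contradiction (i , ∈-comprehension⁻ chord? m) ¬a }) ] (edge⁺ a)) , edge⁻))

    module ConstConst (ek : Const k) (el : Const l) where

      θ : Theta Vertex
      θ = record
        { a = k 0F ; b = l 0F ; a≢b = k≢l 0F 0F ; P = λ i → P i (ek i 0F) (el i 0F) ; long = long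
        ; disjoint = λ {i} {j} i≢j x y → map₁ (λ (e , _) → trans e (ek i 0F)) (map₂ (λ (e , _) → trans e (el i 0F))
            (meet i≢j (P-V⁻ {i} {e = ek i 0F} {el i 0F} x) (P-V⁻ {j} {e = ek j 0F} {el j 0F} y))) }

      edge⁺ : ∀ {u v} → u ~ v → E (Theta.graph θ) u v ⊎ (k 0F ~ l 0F × E (Theta.chord θ) u v)
      edge⁺ a with classify a
      ... | route-edge i x = inj₁ (i , toPath-E⁺ (route i) x)
      ... | left-edge i j i≢j refl refl = contradiction (ek i j) (~⇒≢ a)
      ... | right-edge i j i≢j refl refl = contradiction (el i j) (~⇒≢ a)
      ... | chord-edge i b (inj₁ (e , e′)) rewrite ek i 0F | el i 0F = inj₂ (b , inj₁ (e , e′))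
      ... | chord-edge i b (inj₂ (e , e′)) rewrite ek i 0F | el i 0F = inj₂ (b , inj₂ (e , e′))

      edge⁻ : ∀ {u v} → E (Theta.graph θ) u v → u ~ v
      edge⁻ (i , x) = toPath-adjacent (route i) x

      vertex⁺ : ∀ v → V (Theta.graph θ) v
      vertex⁺ v = let (i , x) = cover v in i , P-V⁺ {i} {e = ek i 0F} {el i 0F} x

      result : Is3PC G
      result with k 0F ~? l 0F
      ... | yes a = G , ≅-refl G , inj₂ (inj₂ (inj₂ (inj₂ (inj₂ (θ , ((λ {v} _ → inj₁ (vertex⁺ v)) , λ _ → tt)
            , (λ b → map₂ proj₂ (edge⁺ b)) , [ edge⁻ , chord⁻ ])))))
        where
        chord⁻ : ∀ {u v} → E (Theta.chord θ) u v → u ~ v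
        chord⁻ (inj₁ (refl , refl)) = a
        chord⁻ (inj₂ (refl , refl)) = ~-sym a
      ... | no ¬a = G , ≅-refl G , inj₂ (inj₂ (inj₁ (θ , ((λ {v} _ → vertex⁺ v) , λ _ → tt)
            , (λ b → [ id , (λ (a , _) → contradiction a ¬a) ] (edge⁺ b)) , edge⁻)))

  -- A `Pyramid` has its triangle at `k`, so a configuration with the triangle on the right is
  -- flipped.
  realise : (K : Config) → (∀ v → Vx K v) → Is3PC G
  realise K cover with kind K | kind (flip K)
  ... | inj₁ ek | inj₁ el = Realise.ConstConst.result K cover ek el
  ... | inj₂ tk | inj₁ el = Realise.TriConst.result K cover tk el
  ... | inj₂ tk | inj₂ tl = Realise.TriTri.result K cover tk tl
  ... | inj₁ ek | inj₂ tl = Realise.TriConst.result (flip K) (vx-flip K ∘ cover) tl ek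

-- From 3PCs to spanning configurations.

module ThreePathGraphs (G : Graph) where
  open Cycles G public

  record InnerPath {a b} (p : Path a b) : Set where
    field
      {c d}    : Vertex
      path     : IPath c d
      a~c      : a ~ c
      d~b      : d ~ b
      only-a   : ∀ {v} → v ∈ₚ path → a ~ v → v ≡ c
      only-b   : ∀ {v} → v ∈ₚ path → v ~ b → v ≡ d
      sound    : ∀ {v} → v ∈ₚ path → V (Path.graph p) v × v ≢ a × v ≢ b
      complete : ∀ {v} → V (Path.graph p) v → v ≡ a ⊎ v ≡ b ⊎ v ∈ₚ path

  induced-tabulate : ∀ m (g : Fin (suc m) → Vertex) → (∀ i → g (inject₁ i) ~ g (suc i)) →
                     (∀ i j → suc (toℕ i) < toℕ j → Far (g i) (g j)) → Induced (g zero) (tabulate (g ∘ suc)) (g (fromℕ m))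
  induced-tabulate zero g adj far = []
  induced-tabulate (suc m) g adj far =
    (adj zero , All.tabulate λ n → let (i , e) = ∈-tabulate⁻ {f = λ x → g (suc (suc x))} n in
      subst (Far (g zero)) (sym e) (far zero (suc (suc i)) (s≤s (s≤s z≤n))))
    ∷ induced-tabulate m (g ∘ suc) (adj ∘ suc) (λ i j → far (suc i) (suc j) ∘ s≤s)

  last-or-not : ∀ {m} (t : Fin (suc m)) → t ≡ fromℕ m ⊎ ∃[ j ] t ≡ inject₁ j
  last-or-not {zero} zero = inj₁ refl
  last-or-not {suc m} zero = inj₂ (zero , refl)
  last-or-not {suc m} (suc t) with last-or-not t
  ... | inj₁ e = inj₁ (cong suc e)
  ... | inj₂ (j , e) = inj₂ (suc j , cong suc e)

  -- Every edge at an interior vertex is an edge of the path, so only the two ends may be joined by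
  -- a further edge, and the interior is induced.
  inner : ∀ {a b} (p : Path a b) → 2 ≤ Path.length p → (∀ {u v} → E (Path.graph p) u v → u ~ v) →
          (∀ {v w} → V (Path.graph p) v → v ≢ a → v ≢ b → v ~ w → E (Path.graph p) v w) → InnerPath p
  inner record { length = zero } () _ _
  inner record { length = suc zero } (s≤s ()) _ _
  inner (record { length = suc (suc n) ; vertex = f ; injective = inj ; start = refl ; end = refl }) _ adj inner-adj = record
    { path = ipath π ; a~c = adj (zero , inj₁ (refl , refl)) ; d~b = adj (fromℕ (suc n) , inj₁ (refl , refl))
    ; only-a = λ m → at-start (listed m) ; only-b = λ m → at-end (listed m)
    ; sound = λ m → sound (listed m)
    ; complete = λ (t , e) → cover t e }
    where
    -- The interior vertices, at positions 1 to `n + 1` among 0 to `n + 2`.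
    g : Fin (suc n) → Vertex
    g j = f (suc (inject₁ j))

    Successive : ∀ s t → Set
    Successive s t = toℕ t ≡ suc (toℕ s) ⊎ toℕ s ≡ suc (toℕ t)

    g≢start : ∀ j → g j ≢ f zero
    g≢start j e = case inj e of λ ()

    g≢end : ∀ j → g j ≢ f (fromℕ (suc (suc n)))
    g≢end j e = <⇒≱ (≤-reflexive (trans (cong suc (sym (toℕ-fromℕ n))) (cong toℕ (sym (suc-injective (inj e))))))
                     (subst (_≤ n) (sym (toℕ-inject₁ j)) (toℕ≤pred[n] j))

    successive : ∀ {s t} → (∃[ i ] E (edge (f (inject₁ i)) (f (suc i))) (f s) (f t)) → Successive s t
    successive (i , inj₁ (e , e′)) with inj e | inj e′
    ... | refl | refl = inj₁ (cong suc (sym (toℕ-inject₁ i)))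
    successive (i , inj₂ (e , e′)) with inj e | inj e′
    ... | refl | refl = inj₂ (cong suc (sym (toℕ-inject₁ i)))

    edge-at : ∀ {j t} → g j ~ f t → Successive (suc (inject₁ j)) t
    edge-at {j} a = successive (inner-adj (_ , refl) (g≢start j) (g≢end j) a)

    shift : ∀ {i j} → Successive (suc (inject₁ i)) (suc (inject₁ j)) → toℕ j ≡ suc (toℕ i) ⊎ toℕ i ≡ suc (toℕ j)
    shift {i} {j} = map₁ (lower i j) ∘ map₂ (lower j i)
      where
      lower : ∀ (i j : Fin (suc n)) → suc (toℕ (inject₁ j)) ≡ suc (suc (toℕ (inject₁ i))) → toℕ j ≡ suc (toℕ i)
      lower i j e = trans (sym (toℕ-inject₁ j)) (trans (ℕ-suc-injective e) (cong suc (toℕ-inject₁ i)))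

    far : ∀ i j → suc (toℕ i) < toℕ j → Far (g i) (g j)
    far i j lt = (λ e → <-irrefl (cong toℕ (inject-injective (suc-injective (inj e)))) (≤-trans (n≤1+n _) lt))
               , λ a → [ (λ e → <-irrefl (sym e) lt) , (λ e → <⇒≱ lt (≤-trans (n≤1+n _) (s≤s (≤-trans (n≤1+n _) (≤-reflexive (sym e)))))) ] (shift (edge-at a))
      where
      inject-injective : ∀ {i j : Fin (suc n)} → inject₁ i ≡ inject₁ j → i ≡ j
      inject-injective {i} {j} e = toℕ-injective (trans (sym (toℕ-inject₁ i)) (trans (cong toℕ e) (toℕ-inject₁ j)))

    π : Induced (g zero) (tabulate (g ∘ suc)) (g (fromℕ n))
    π = induced-tabulate n g (λ i → adj (suc (inject₁ i) , inj₁ (refl , refl))) far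

    listed : ∀ {v} → v ∈ g zero ∷ tabulate (g ∘ suc) → ∃[ j ] v ≡ g j
    listed (here e) = zero , e
    listed (there m) = let (j , e) = ∈-tabulate⁻ {f = g ∘ suc} m in suc j , e

    member : ∀ j → g j ∈ g zero ∷ tabulate (g ∘ suc)
    member zero = here refl
    member (suc j) = there (∈-tabulate⁺ {f = g ∘ suc} j)

    at-start : ∀ {v} → ∃[ j ] v ≡ g j → f zero ~ v → v ≡ g zero
    at-start (j , refl) a with edge-at {j} {zero} (~-sym a)
    ... | inj₂ e = cong g (toℕ-injective (trans (sym (toℕ-inject₁ j)) (ℕ-suc-injective e)))

    at-end : ∀ {v} → ∃[ j ] v ≡ g j → v ~ f (fromℕ (suc (suc n))) → v ≡ g (fromℕ n)
    at-end (j , refl) a with edge-at {j} {fromℕ (suc (suc n))} a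
    ... | inj₁ e = cong g (toℕ-injective (trans (sym (toℕ-inject₁ j)) (sym (ℕ-suc-injective (ℕ-suc-injective e)))))
    ... | inj₂ e = contradiction (subst (_≤ n) (trans (sym (toℕ-inject₁ j)) (ℕ-suc-injective e)) (toℕ≤pred[n] j))
                     (<⇒≱ (s≤s (≤-trans (n≤1+n _) (s≤s (≤-reflexive (sym (toℕ-fromℕ n)))))))

    sound : ∀ {v} → ∃[ j ] v ≡ g j → (∃[ t ] v ≡ f t) × v ≢ f zero × v ≢ f (fromℕ (suc (suc n)))
    sound (j , refl) = (_ , refl) , g≢start j , g≢end j

    cover : ∀ {v} t → v ≡ f t → v ≡ f zero ⊎ v ≡ f (fromℕ (suc (suc n))) ⊎ v ∈ g zero ∷ tabulate (g ∘ suc)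
    cover zero e = inj₁ e
    cover (suc t) e with last-or-not t
    ... | inj₁ refl = inj₂ (inj₁ e)
    ... | inj₂ (j , refl) = inj₂ (inj₂ (subst (_∈ _) (sym e) (member j)))

  -- The common shape of the six kinds of 3PC. The last alternative of `adj⁻` allows for chords
  -- without demanding them.
  record ThreePaths : Set where
    field
      k l   : Fin 3 → Vertex
      P     : ∀ i → Path (k i) (l i)
      long  : ∀ i → 2 ≤ Path.length (P i)
      k≢l   : ∀ i j → k i ≢ l j
      left  : Const k ⊎ (∀ i j → i ≢ j → k i ~ k j)
      right : Const l ⊎ (∀ i j → i ≢ j → l i ~ l j)
      meet  : ∀ {i j x} → i ≢ j → V (Path.graph (P i)) x → V (Path.graph (P j)) x → (x ≡ k i × Const k) ⊎ (x ≡ l i × Const l)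
      cover : ∀ v → ∃[ i ] V (Path.graph (P i)) v
      adj⁺  : ∀ i {u v} → E (Path.graph (P i)) u v → u ~ v
      adj⁻  : ∀ {u v} → u ~ v → (∃[ i ] E (Path.graph (P i)) u v) ⊎ (∃[ i ] ∃[ j ] i ≢ j × u ≡ k i × v ≡ k j)
              ⊎ (∃[ i ] ∃[ j ] i ≢ j × u ≡ l i × v ≡ l j) ⊎ (∃[ i ] E (edge (k i) (l i)) u v)

  module FromThreePaths (X : ThreePaths) where
    open ThreePaths X

    k-on : ∀ i → V (Path.graph (P i)) (k i)
    k-on i = zero , sym (Path.start (P i))

    l-on : ∀ i → V (Path.graph (P i)) (l i)
    l-on i = fromℕ _ , sym (Path.end (P i))

    E-V : ∀ {a b : Vertex} (p : Path a b) {u v} → E (Path.graph p) u v → V (Path.graph p) u × V (Path.graph p) v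
    E-V _ (i , inj₁ (e , e′)) = (inject₁ i , e) , (suc i , e′)
    E-V _ (i , inj₂ (e , e′)) = (suc i , e) , (inject₁ i , e′)

    inside : ∀ {i j v} → V (Path.graph (P i)) v → v ≢ k i → v ≢ l i → V (Path.graph (P j)) v → i ≡ j
    inside {i} {j} x ≢k ≢l y with i ≟ j
    ... | yes e = e
    ... | no i≢j = ⊥-elim ([ ≢k ∘ proj₁ , ≢l ∘ proj₁ ] (meet i≢j x y))

    inside-k : ∀ {i j v} → V (Path.graph (P i)) v → v ≢ k i → v ≢ l i → v ≢ k j
    inside-k {i} {j} x ≢k ≢l refl with inside {i} {j} x ≢k ≢l (k-on j)
    ... | refl = ≢k refl

    inside-l : ∀ {i j v} → V (Path.graph (P i)) v → v ≢ k i → v ≢ l i → v ≢ l j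
    inside-l {i} {j} x ≢k ≢l refl with inside {i} {j} x ≢k ≢l (l-on j)
    ... | refl = ≢l refl

    inside-adj : ∀ i {v w} → V (Path.graph (P i)) v → v ≢ k i → v ≢ l i → v ~ w → E (Path.graph (P i)) v w
    inside-adj i x ≢k ≢l a with adj⁻ a
    ... | inj₁ (j , e) with inside {i} {j} x ≢k ≢l (proj₁ (E-V (P j) e))
    ...   | refl = e
    inside-adj i x ≢k ≢l a | inj₂ (inj₁ (j , _ , _ , e , _)) = contradiction e (inside-k x ≢k ≢l)
    inside-adj i x ≢k ≢l a | inj₂ (inj₂ (inj₁ (j , _ , _ , e , _))) = contradiction e (inside-l x ≢k ≢l)
    inside-adj i x ≢k ≢l a | inj₂ (inj₂ (inj₂ (j , inj₁ (e , _)))) = contradiction e (inside-k x ≢k ≢l)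
    inside-adj i x ≢k ≢l a | inj₂ (inj₂ (inj₂ (j , inj₂ (e , _)))) = contradiction e (inside-l x ≢k ≢l)

    module I i = InnerPath (inner (P i) (long i) (adj⁺ i) (inside-adj i))

    in-V : ∀ {i v} → v ∈ₚ I.path i → V (Path.graph (P i)) v
    in-V {i} m = proj₁ (I.sound i m)

    in-adj : ∀ {i v w} → v ∈ₚ I.path i → v ~ w → V (Path.graph (P i)) w
    in-adj {i} m a = let (x , p , q) = I.sound i m in proj₂ (E-V (P i) (inside-adj i x p q a))

    index-of : ∀ {i j v} → v ∈ₚ I.path i → V (Path.graph (P j)) v → i ≡ j
    index-of {i} {j} m y = let (x , p , q) = I.sound i m in inside {i} {j} x p q y

    end-k : ∀ {i j} → i ≢ j → V (Path.graph (P j)) (k i) → Const k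
    end-k {i} {j} i≢j x = [ proj₂ , (λ (e , _) → contradiction e (k≢l i i)) ] (meet i≢j (k-on i) x)

    end-l : ∀ {i j} → i ≢ j → V (Path.graph (P j)) (l i) → Const l
    end-l {i} {j} i≢j x = [ (λ (e , _) → contradiction (sym e) (k≢l i i)) , proj₂ ] (meet i≢j (l-on i) x)

    -- Such an edge belongs to a path or chord of some index, which differs from `i` or from `j`. So
    -- an end of one path lies on another path, and `meet` allows this only at a common end.
    crossing : ∀ i j → k i ~ l j → i ≡ j ⊎ Const k ⊎ Const l
    crossing i j a with i ≟ j
    ... | yes e = inj₁ e
    ... | no i≢j with adj⁻ a
    ...   | inj₁ (s , e) with i ≟ s
    ...     | no i≢s = inj₂ (inj₁ (end-k i≢s (proj₁ (E-V (P s) e))))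
    ...     | yes refl = inj₂ (inj₂ (end-l (≢-sym i≢j) (proj₂ (E-V (P i) e))))
    crossing i j a | no i≢j | inj₂ (inj₁ (_ , t , _ , _ , e)) = contradiction (sym e) (k≢l t j)
    crossing i j a | no i≢j | inj₂ (inj₂ (inj₁ (t , _ , _ , e , _))) = contradiction e (k≢l i t)
    crossing i j a | no i≢j | inj₂ (inj₂ (inj₂ (t , inj₂ (e , _)))) = contradiction e (k≢l i t)
    crossing i j a | no i≢j | inj₂ (inj₂ (inj₂ (t , inj₁ (e , e′)))) with i ≟ t
    ...     | no i≢t = inj₂ (inj₁ (end-k i≢t (subst (V (Path.graph (P t))) (sym e) (k-on t))))
    ...     | yes refl = inj₂ (inj₂ (end-l (≢-sym i≢j) (subst (V (Path.graph (P i))) (sym e′) (l-on i))))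

    config : Config
    config = record
      { k = k ; l = l ; path = I.path ; k~c = I.a~c ; d~l = I.d~b
      ; only-k = λ i → I.only-a i ; only-l = λ i → I.only-b i
      ; apart = λ i j i≢j u v m n → (λ { refl → i≢j (index-of m (in-V n)) })
                                  , λ a → i≢j (sym (index-of n (in-adj m a)))
      ; k∉ = λ i j m → let (x , p , q) = I.sound j m in inside-k {j} {i} x p q refl
      ; l∉ = λ i j m → let (x , p , q) = I.sound j m in inside-l {j} {i} x p q refl
      ; k≢l = k≢l
      ; left = left-cap left
      ; right = right-cap right
      ; cross = crossing }
      where
      left-cap : Const k ⊎ (∀ i j → i ≢ j → k i ~ k j) → Const k ⊎ (∀ i j → i ≢ j → k i ~ k j × (∀ v → v ∈ₚ I.path j → ¬ k i ~ v))
      left-cap (inj₁ e) = inj₁ e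
      left-cap (inj₂ t) = inj₂ λ i j i≢j → t i j i≢j , λ v m a → ¬const t (end-k i≢j (in-adj m (~-sym a)))
      right-cap : Const l ⊎ (∀ i j → i ≢ j → l i ~ l j) → Const l ⊎ (∀ i j → i ≢ j → l i ~ l j × (∀ v → v ∈ₚ I.path j → ¬ v ~ l i))
      right-cap (inj₁ e) = inj₁ e
      right-cap (inj₂ t) = inj₂ λ i j i≢j → t i j i≢j , λ v m a → ¬const t (end-l i≢j (in-adj m a))

    config-cover : ∀ v → Vx config v
    config-cover v = let (i , x) = cover v in i , I.complete i x

  module _ (X : Prism Vertex) where
    open Prism X

    prism-paths : (∀ v → V graph v) → (∀ {u v} → E graph u v → u ~ v) →
                  (∀ {u v} → u ~ v → E graph u v ⊎ (∃[ s ] E (chords s) u v)) → ThreePaths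
    prism-paths cover adj⁺ adj⁻ = record
      { k = k ; l = l ; P = P ; long = long ; k≢l = k≢l
      ; left = inj₂ λ i j i≢j → adj⁺ (inj₁ (inj₁ (i , j , i≢j , refl , refl)))
      ; right = inj₂ λ i j i≢j → adj⁺ (inj₁ (inj₂ (i , j , i≢j , refl , refl)))
      ; meet = λ i≢j x y → contradiction y (disjoint i≢j x)
      ; cover = λ v → case cover v of λ
          { (inj₁ (inj₁ (i , refl))) → i , zero , sym (Path.start (P i))
          ; (inj₁ (inj₂ (i , refl))) → i , fromℕ _ , sym (Path.end (P i))
          ; (inj₂ x) → x }
      ; adj⁺ = λ i e → adj⁺ (inj₂ (i , e))
      ; adj⁻ = λ a → case adj⁻ a of λ
          { (inj₁ (inj₁ (inj₁ x))) → inj₂ (inj₁ x) ; (inj₁ (inj₁ (inj₂ x))) → inj₂ (inj₂ (inj₁ x)) ; (inj₁ (inj₂ x)) → inj₁ x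
          ; (inj₂ (s , (i , _) , x)) → inj₂ (inj₂ (inj₂ (i , x))) } }

  module _ (X : Pyramid Vertex) where
    open Pyramid X

    pyramid-paths : (∀ v → V graph v) → (∀ {u v} → E graph u v → u ~ v) →
                    (∀ {u v} → u ~ v → E graph u v ⊎ (∃[ s ] E (chords s) u v)) → ThreePaths
    pyramid-paths cover adj⁺ adj⁻ = record
      { k = k ; l = λ _ → l ; P = P ; long = long ; k≢l = λ i _ → k≢l i
      ; left = inj₂ λ i j i≢j → adj⁺ (inj₁ (i , j , i≢j , refl , refl))
      ; right = inj₁ λ _ _ → refl
      ; meet = λ i≢j x y → inj₂ (disjoint i≢j x y , λ _ _ → refl)
      ; cover = λ v → case cover v of λ
          { (inj₁ (i , refl)) → i , zero , sym (Path.start (P i)) ; (inj₂ x) → x }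
      ; adj⁺ = λ i e → adj⁺ (inj₂ (i , e))
      ; adj⁻ = λ a → case adj⁻ a of λ
          { (inj₁ (inj₁ x)) → inj₂ (inj₁ x) ; (inj₁ (inj₂ x)) → inj₁ x ; (inj₂ (s , (i , _) , x)) → inj₂ (inj₂ (inj₂ (i , x))) } }

  module _ (X : Theta Vertex) where
    open Theta X

    theta-paths : (∀ v → V graph v) → (∀ {u v} → E graph u v → u ~ v) →
                  (∀ {u v} → u ~ v → E graph u v ⊎ E chord u v) → ThreePaths
    theta-paths cover adj⁺ adj⁻ = record
      { k = λ _ → a ; l = λ _ → b ; P = P ; long = long ; k≢l = λ _ _ → a≢b
      ; left = inj₁ λ _ _ → refl ; right = inj₁ λ _ _ → refl
      ; meet = λ i≢j x y → map₁ (_, λ _ _ → refl) (map₂ (_, λ _ _ → refl) (disjoint i≢j x y))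
      ; cover = cover
      ; adj⁺ = λ i e → adj⁺ (i , e)
      ; adj⁻ = λ e → [ inj₁ , (λ x → inj₂ (inj₂ (inj₂ (0F , x)))) ] (adj⁻ e) }

  three-paths : IsPrism G ⊎ IsPyramid G ⊎ IsTheta G ⊎ IsPrism⁺ G ⊎ IsPyramid⁺ G ⊎ IsTheta⁺ G → ThreePaths
  three-paths (inj₁ (X , (c , _) , (f , g))) = prism-paths X (λ v → c {v} tt) g (inj₁ ∘ f)
  three-paths (inj₂ (inj₁ (X , (c , _) , (f , g)))) = pyramid-paths X (λ v → c {v} tt) g (inj₁ ∘ f)
  three-paths (inj₂ (inj₂ (inj₁ (X , (c , _) , (f , g))))) = theta-paths X (λ v → c {v} tt) g (inj₁ ∘ f)
  three-paths (inj₂ (inj₂ (inj₂ (inj₁ (X , s , _ , (c , _) , (f , g)))))) =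
    prism-paths X (λ v → [ id , (λ { ((i , _) , inj₁ refl) → inj₁ (inj₁ (i , refl)) ; ((i , _) , inj₂ refl) → inj₁ (inj₂ (i , refl)) }) ] (c {v} tt))
      (g ∘ inj₁) (map₂ (s ,_) ∘ f)
  three-paths (inj₂ (inj₂ (inj₂ (inj₂ (inj₁ (X , s , _ , (c , _) , (f , g))))))) =
    pyramid-paths X (λ v → [ id , (λ { ((i , _) , inj₁ refl) → inj₁ (i , refl)
                                     ; ((i , _) , inj₂ refl) → inj₂ (i , fromℕ _ , sym (Path.end (Pyramid.P X i))) }) ] (c {v} tt))
      (g ∘ inj₁) (map₂ (s ,_) ∘ f)
  three-paths (inj₂ (inj₂ (inj₂ (inj₂ (inj₂ (X , (c , _) , (f , g))))))) =
    theta-paths X (λ v → [ id , (λ { (inj₁ refl) → 0F , zero , sym (Path.start (Theta.P X 0F))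
                                   ; (inj₂ refl) → 0F , fromℕ _ , sym (Path.end (Theta.P X 0F)) }) ] (c {v} tt))
      (g ∘ inj₁) f

-- Isomorphic copies of configurations.

module Transport {H G : Graph} (iso : H ≅ G) where
  private
    module H = Obstructions H
    module G = Obstructions G

  f : H.Vertex → G.Vertex
  f = _≅_.to iso

  private
    module B = Inverse (_≅_.bijection iso)

  injective : ∀ {x y} → f x ≡ f y → x ≡ y
  injective {x} {y} e = trans (sym (B.strictlyInverseʳ x)) (trans (cong B.from e) (B.strictlyInverseʳ y))

  open Embedding H G f injective (proj₁ (_≅_.preserves iso)) (proj₂ (_≅_.preserves iso))

  module _ (K : H.Config) where
    open H.Config K

    path⁺ : ∀ i → G.IPath (f (c i)) (f (d i))
    path⁺ i = G.ipath (induced⁺ (H.induced (path i)))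

    source : ∀ {i v} → v G.∈ₚ path⁺ i → ∃[ x ] x H.∈ₚ path i × v ≡ f x
    source {i} = ∈-map⁻ f {xs = c i ∷ H.rest (path i)}

    const⁺ : ∀ {g : Fin 3 → H.Vertex} → Const g → Const (f ∘ g)
    const⁺ e i j = cong f (e i j)

    config⁺ : G.Config
    config⁺ = record
      { k = f ∘ k ; l = f ∘ l ; path = path⁺ ; k~c = preserve ∘ k~c ; d~l = preserve ∘ d~l
      ; only-k = λ i m a → case source {i} m of λ { (x , n , refl) → cong f (only-k i n (reflect a)) }
      ; only-l = λ i m a → case source {i} m of λ { (x , n , refl) → cong f (only-l i n (reflect a)) }
      ; apart = λ i j i≢j u v m n → case source {i} m , source {j} n of λ
          { ((x , m′ , refl) , (y , n′ , refl)) → far⁺ (apart i j i≢j x y m′ n′) }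
      ; k∉ = λ i j m → case source {j} m of λ { (x , n , e) → k∉ i j (subst (H._∈ₚ path j) (sym (injective e)) n) }
      ; l∉ = λ i j m → case source {j} m of λ { (x , n , e) → l∉ i j (subst (H._∈ₚ path j) (sym (injective e)) n) }
      ; k≢l = λ i j → k≢l i j ∘ injective
      ; left = [ inj₁ ∘ const⁺ , (λ t → inj₂ λ i j i≢j → preserve (proj₁ (t i j i≢j))
               , λ v m a → case source {j} m of λ { (x , n , refl) → proj₂ (t i j i≢j) x n (reflect a) }) ] left
      ; right = [ inj₁ ∘ const⁺ , (λ t → inj₂ λ i j i≢j → preserve (proj₁ (t i j i≢j))
               , λ v m a → case source {j} m of λ { (x , n , refl) → proj₂ (t i j i≢j) x n (reflect a) }) ] right
      ; cross = λ i j a → map₂ (map₁ const⁺ ∘ map₂ const⁺) (cross i j (reflect a)) }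
      where
      preserve : ∀ {x y} → x H.~ y → f x G.~ f y
      preserve = proj₁ (_≅_.preserves iso)
      reflect : ∀ {x y} → f x G.~ f y → x H.~ y
      reflect = proj₂ (_≅_.preserves iso)

    cover⁺ : (∀ v → H.Vx K v) → ∀ v → G.Vx config⁺ v
    cover⁺ cover v = subst (G.Vx config⁺) (B.strictlyInverseˡ v) (image (cover (B.from v)))
      where
      image : ∀ {x} → H.Vx K x → G.Vx config⁺ (f x)
      image (i , inj₁ e) = i , inj₁ (cong f e)
      image (i , inj₂ (inj₁ e)) = i , inj₂ (inj₁ (cong f e))
      image (i , inj₂ (inj₂ m)) = i , inj₂ (inj₂ (∈-map⁺ f m))

-- Both directions of the characterisation.

module _ (G : Graph) where
  open ToDefs G

  -- The last condition on an HC-obstruction is a disjunction, so its alternatives have to be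
  -- decided.
  two-connected? : ∀ {S : Vertex → Set} → Decidable₁ S → Dec (TwoConnected S)
  two-connected? {S} S? = three? ×-dec map′ (λ g w {u} {v} → g w u v) (λ g w u v → g w {u} {v})
      (all? λ w → all? λ u → all? λ v → minus? w u →-dec (minus? w v →-dec walk? (minus? w) u v))
    where
    minus? : ∀ w → Decidable₁ (S ∖ w)
    minus? w v = S? v ×-dec ¬? (v ≟ w)
    three? : Dec (Three S)
    three? = any? λ a → any? λ b → any? λ c → S? a ×-dec S? b ×-dec S? c ×-dec ¬? (a ≟ b) ×-dec ¬? (a ≟ c) ×-dec ¬? (b ≟ c)

  two-connected-cong : ∀ {S T : Vertex → Set} → (∀ {v} → S v → T v) → (∀ {v} → T v → S v) → TwoConnected S → TwoConnected T
  two-connected-cong f g ((a , b , c , p , q , r , e) , conn) = (a , b , c , f p , f q , f r , e)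
    , λ w (x , x≢w) (y , y≢w) → walk-map (λ (s , ≢w) → f s , ≢w) (conn w (g x , x≢w) (g y , y≢w))

  config-obstruction : (K : Config) → (∀ v → Vx K v) → IsHCObstruction G
  config-obstruction K cover = two-connected⁻ (two-connected-cong (λ _ → tt) (λ {v} _ → cover v) (two-connected K))
    , (λ h → non-hamiltonian K (ham-cong (λ {v} _ → cover v) (λ _ → tt) (ham⁺ h)))
    , proper
    where
    proper : ∀ S → S ≡ ⊤ ⊎ ¬ 2-Connected (G [ S ]) ⊎ Hamiltonian (G [ S ])
    proper S with any? (λ v → ¬? (v ∈ₛ? S)) | two-connected? (_∈ₛ? S)
    ... | no ¬v | _ = inj₁ (⊆-antisym ⊆⊤ λ {v} _ → decidable-stable (v ∈ₛ? S) (λ ¬m → ¬v (v , ¬m)))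
    ... | yes _ | no ¬tc = inj₂ (inj₁ (¬tc ∘ sub-twoConnected⁺ G S))
    ... | yes (v , v∉) | yes tc = inj₂ (inj₂ (Cycles.ham⁻ (G [ S ])
            (sub-ham⁻ G S (proper-hamiltonian K (_∈ₛ? S) (λ {v} _ → cover v) tc (cover v) v∉))))

  vx? : ∀ K → Decidable₁ (Vx K)
  vx? K v = any? λ i → (v ≟ Config.k K i) ⊎-dec (v ≟ Config.l K i) ⊎-dec (v ∈ₚ? Config.path K i)

  module _ (obstruction : IsHCObstruction G) (wheel-free : WheelFree G) where

    obstruction-setting : Setting G
    obstruction-setting = record
      { Bad = ∃[ K ] (∀ v → Vx K v)
      ; wheel = λ C h∉ p∈ q∈ r∈ a b c x y z → ⊥-elim (no-wheel wheel-free C h∉ p∈ q∈ r∈ a b c x y z)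
      ; found = λ K → K , λ v → covered K v
      ; connected = two-connected⁺ (proj₁ obstruction)
      ; minimal = smaller-ham
      ; spanning = λ h → contradiction (ham⁻ h) (proj₁ (proj₂ obstruction)) }
      where
      module _ {S : Vertex → Set} (S? : Decidable₁ S) where
        subset = comprehension S?

        sub-ham : Hamiltonian (G [ subset ]) → Ham S
        sub-ham h = ham-cong (∈-comprehension⁻ S?) (∈-comprehension⁺ S?) (sub-ham⁺ G subset (Cycles.ham⁺ (G [ subset ]) h))

        sub-connected : TwoConnected S → 2-Connected (G [ subset ])
        sub-connected tc = sub-twoConnected⁻ G subset (two-connected-cong (∈-comprehension⁺ S?) (∈-comprehension⁻ S?) tc)

      smaller-ham : ∀ {S} → Decidable₁ S → TwoConnected S → (∃ λ v → ¬ S v) → Ham S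
      smaller-ham S? tc (v , ¬s) with proj₂ (proj₂ obstruction) (subset S?)
      ... | inj₁ e = contradiction (∈-comprehension⁻ S? (subst (v ∈ₛ_) (sym e) ∈⊤)) ¬s
      ... | inj₂ (inj₁ ¬tc) = contradiction (sub-connected S? tc) ¬tc
      ... | inj₂ (inj₂ h) = sub-ham S? h

      -- By minimality: the subgraph induced by the configuration is 2-connected and not
      -- Hamiltonian, so it is all of `G`.
      covered : ∀ K v → Vx K v
      covered K v with proj₂ (proj₂ obstruction) (subset (vx? K))
      ... | inj₁ e = ∈-comprehension⁻ (vx? K) (subst (v ∈ₛ_) (sym e) ∈⊤)
      ... | inj₂ (inj₁ ¬tc) = contradiction (sub-connected (vx? K) (two-connected K)) ¬tc
      ... | inj₂ (inj₂ h) = ⊥-elim (non-hamiltonian K (sub-ham (vx? K) h))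

    obstruction-3PC : Is3PC G
    obstruction-3PC = let (K , cover) = MainArgument.contradictory G obstruction-setting in realise K cover

3PC-obstruction : ∀ G → Is3PC G → IsHCObstruction G
3PC-obstruction G (H , iso , x) = config-obstruction G (Transport.config⁺ iso config) (Transport.cover⁺ iso config config-cover)
  where open ThreePathGraphs.FromThreePaths H (ThreePathGraphs.three-paths H x)

theorem1 : (∀ (G : Graph) → Is3PC G → IsHCObstruction G) ×
    (∀ (G : Graph) → IsHCObstruction G → WheelFree G → Is3PC G)
theorem1 = 3PC-obstruction , obstruction-3PC
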